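{- Let $p$ be an odd prime, $r,t$ positive integers with $t>4$, $q=p^r$ and $n=2t$. For $h\in\mathbb{F}_{q^n}$ with $h^{q^t+1}=-1$ let $\psi_{h,t}(x)= x^{q}+x^{q^{t-1}}-h^{1-q^{t+1}}x^{q^{t+1}}+h^{1-q^{2t-1}}x^{q^{2t-1}}$ and \[L_{h,t}=\{\langle (x,\psi_{h,t}(x))\rangle_{\mathbb{F}_{q^n}}: x\in\mathbb{F}_{q^n}^*\}\subseteq \mathrm{PG}(1,q^n).\] Then the number $M$ of $\mathrm{P\Gamma L}(2,q^n)$-inequivalent linear sets among the $L_{h,t}$ (with $h$ ranging over all $h\in\mathbb{F}_{q^n}$ with $h^{q^t+1}=-1$) satisfies \[M\geq\begin{cases}\left\lfloor\frac{q^t+1}{8rt}\right\rfloor, & t\not\equiv 2\pmod 4,\\[4pt] \left\lfloor\frac{q^t+1}{4rt(q^2+1)}\right\rfloor,& t\equiv 2\pmod 4.\end{cases}\]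
   Context: $\langle v\rangle_{\mathbb{F}_{q^n}}$ denotes the point of the projective line $\mathrm{PG}(1,q^n)$ determined by a nonzero vector $v\in\mathbb{F}_{q^n}^2$. Two point sets $L,L'$ of $\mathrm{PG}(1,q^n)$ are $\mathrm{P\Gamma L}(2,q^n)$-equivalent if there is a collineation $\varphi\in\mathrm{P\Gamma L}(2,q^n)$ with $L^\varphi=L'$. -}

module Defs where

open import Level using (0ℓ)
open import Data.Nat as ℕ using (ℕ; zero; suc; _/_)
open import Data.Fin using (Fin)
open import Data.Product using (Σ; ∃; ∃-syntax; _×_; _,_)
open import Relation.Binary.PropositionalEquality using (_≡_)
open import Relation.Nullary using (¬_)
open import Algebra.Structures using (IsCommutativeRing)
open import Function.Bundles using (_↔_)

record FiniteField (N : ℕ) : Set₁ where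
  infixl 7 _*_
  infixl 6 _+_
  field
    F      : Set
    _+_    : F → F → F
    _*_    : F → F → F
    -_     : F → F
    0# 1#  : F
    isCommutativeRing : IsCommutativeRing _≡_ _+_ _*_ -_ 0# 1#
    0≢1    : ¬ (0# ≡ 1#)
    inv    : F → F
    inv-0  : inv 0# ≡ 0#
    inv-r  : ∀ x → ¬ (x ≡ 0#) → x * inv x ≡ 1#
    enum   : F ↔ Fin N

  _^_ : F → ℕ → F
  x ^ zero  = 1#
  x ^ suc k = x * (x ^ k)

  record Automorphism : Set where
    field
      σ      : F → F
      σ⁻¹    : F → F
      σ-invˡ : ∀ x → σ⁻¹ (σ x) ≡ x
      σ-invʳ : ∀ x → σ (σ⁻¹ x) ≡ x
      σ-+    : ∀ x y → σ (x + y) ≡ σ x + σ y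
      σ-*    : ∀ x y → σ (x * y) ≡ σ x * σ y
      σ-1    : σ 1# ≡ 1#

  Vec2 : Set
  Vec2 = F × F

  NonZeroVec : Vec2 → Set
  NonZeroVec (a , b) = ¬ (a ≡ 0# × b ≡ 0#)

  SamePoint : Vec2 → Vec2 → Set
  SamePoint (a , b) (c , d) = ∃[ λ′ ] (¬ (λ′ ≡ 0#) × a ≡ λ′ * c × b ≡ λ′ * d)

  -- A point set of PG(1,F), encoded as the predicate "the point ⟨v⟩ lies in the set"
  -- on nonzero vectors v.
  PointSet : Set₁
  PointSet = Vec2 → Set

  record Collineation : Set where
    field
      a b c d : F
      det≢0   : ¬ (a * d + - (b * c) ≡ 0#)
      aut     : Automorphism

    apply : Vec2 → Vec2
    apply (x , y) = let s = Automorphism.σ aut in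
      (a * s x + b * s y , c * s x + d * s y)

  ImageIs : Collineation → PointSet → PointSet → Set
  ImageIs φ L L′ =
    (∀ v → NonZeroVec v → L v → L′ (Collineation.apply φ v)) ×
    (∀ w → NonZeroVec w → L′ w → ∃[ v ] (NonZeroVec v × L v × SamePoint (Collineation.apply φ v) w))

  PΓL-equivalent : PointSet → PointSet → Set
  PΓL-equivalent L L′ = ∃[ φ ] ImageIs φ L L′

  LinSet : (F → F) → PointSet
  LinSet f v = ∃[ x ] (¬ (x ≡ 0#) × SamePoint v (x , f x))

-- floor division (the divisor is positive in all uses)
floorDiv : ℕ → ℕ → ℕ
floorDiv a zero    = 0
floorDiv a (suc b) = a / suc b

module _ {N : ℕ} (K : FiniteField N) (q t : ℕ) where
  open FiniteField K

  -- ψ_{h,t}(x) = x^q + x^{q^{t-1}} - h^{1-q^{t+1}} x^{q^{t+1}} + h^{1-q^{2t-1}} x^{q^{2t-1}}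
  -- with h^{1-m} written as h * (h^m)⁻¹
  ψ : F → F → F
  ψ h x = x ^ q + x ^ (q ℕ.^ (t ℕ.∸ 1))
          + - ((h * inv (h ^ (q ℕ.^ (t ℕ.+ 1)))) * x ^ (q ℕ.^ (t ℕ.+ 1)))
          + (h * inv (h ^ (q ℕ.^ (2 ℕ.* t ℕ.∸ 1)))) * x ^ (q ℕ.^ (2 ℕ.* t ℕ.∸ 1))

  L : F → PointSet
  L h = LinSet (ψ h)

  Admissible : F → Set
  Admissible h = h ^ (q ℕ.^ t ℕ.+ 1) ≡ - 1#

  AtLeastInequivalent : ℕ → Set
  AtLeastInequivalent k = Σ (Fin k → F) λ hs → ((∀ (i : Fin k) → Admissible (hs i)) ×
    (∀ (i j : Fin k) → ¬ (i ≡ j) → ¬ PΓL-equivalent (L (hs i)) (L (hs j))))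

{-# OPTIONS --safe #-}

-- Up to applying a field automorphism to h, an equivalence of L_h and L_k is given by a matrix A. Its image of the graph
-- of ψ_h is the graph of an F_q-linear map F whose slopes F(x)/x form the same set as those of ψ_k. The multiplicity of each
-- slope is -1 in characteristic p, so the sums over x of (F(x)/x)^e and of (ψ_k(x)/x)^e agree for every e. The exponents
-- 1, 1 + q^i and 1 + q + q^j show that F has no term of q-degree 0, ±2, t, t ± 2 (mod 2t) and determine the
-- products F_1 F_{-1}^q and F_{t-1} F_{t+1}^{q^{t-1}} of its coefficients. Comparing coefficients in
-- F(a x + b ψ_h(x)) = c x + d ψ_h(x) then gives F_s = κ λ^{q^s} (ψ_h)_s for s = ±1, t ± 1 (if a = 0, up to signs at t ± 1,
-- because ψ_h⁻¹ is explicitly of the same shape), and eliminating κ λ yields m^{2(q²+1)} = 1 for m = k/h. If t ≢ 2 mod 4,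
-- m^{q^t+1} = 1 improves this to m⁴ = 1. Since an element has at most 2rt images under automorphisms, each class contains at
-- most 8rt, respectively 4rt(q²+1), of the q^t + 1 admissible h, and inequivalent ones can be chosen greedily.

module Submission where

open import Defs
open import Level using (0ℓ)
import Algebra.Properties.Ring
import Algebra.Solver.Ring
open import Algebra.Bundles using (CommutativeMonoid; CommutativeRing)
open import Algebra.Solver.Ring.AlmostCommutativeRing using (fromCommutativeRing; _-Raw-AlmostCommutative⟶_)
open import Algebra.Structures using (IsCommutativeMonoid)
open import Data.Bool using (if_then_else_)
import Data.Fin as Fin
import Data.Fin.Properties as Fin
open import Data.Fin using (Fin)
open import Data.Fin.Permutation using (Permutation; permutation)
open import Data.Fin.Properties using (punchInᵢ≢i)
import Data.Integer as ℤ
import Data.Integer.Properties as ℤ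
open import Data.Integer using (ℤ; -[1+_]; _⊖_) renaming (+_ to pos)
import Data.List as List
import Data.List.Properties as List
import Data.List.Relation.Unary.All as All
import Data.List.Relation.Unary.All.Properties as All
import Data.List.Relation.Unary.Any as Any
open import Data.List using (List; []; _∷_)
open import Data.List.Membership.Propositional using (_∈_; _∉_)
open import Data.List.Membership.Propositional.Properties using (∈-tabulate⁺; ∈-filter⁺; ∈-concatMap⁺; ∈-++⁺ˡ; ∈-++⁺ʳ)
open import Data.List.Relation.Unary.All using (All; []; _∷_)
open import Data.List.Relation.Unary.All.Properties using (all-filter)
open import Data.List.Relation.Unary.AllPairs using ([]; _∷_)
open import Data.List.Relation.Unary.Any.Properties using (lookup-index)
open import Data.List.Relation.Unary.Unique.Propositional using (Unique)
open import Data.List.Relation.Unary.Unique.Propositional.Properties using (tabulate⁺; filter⁺)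
import Data.Maybe as Maybe
open import Data.Maybe using (Maybe)
import Data.Nat as ℕ
import Data.Nat.Properties as ℕ
import Data.Nat.Solver
open import Data.Nat using (ℕ; zero; suc)
open import Data.Nat.Combinatorics using (_C_; nCn≡1; nC1≡n; k>n⇒nCk≡0; nCk≡nC[n∸k]; nCk+nC[k+1]≡[n+1]C[k+1])
open import Data.Nat.Coprimality using (coprime-Bézout; prime⇒coprime)
open import Data.Nat.Divisibility using (_∣_; divides; >⇒∤; ∣m+n∣m⇒∣n; ∣m∣n⇒∣m+n)
open import Data.Nat.DivMod using (m≡m%n+[m/n]*n; m%n<n; m/n*n≤m)
open import Data.Nat.GCD using (module Bézout)
open import Data.Nat.Primality using (Prime; euclidsLemma; prime⇒nonZero; prime⇒nonTrivial)
open import Data.Product using (Σ; ∃-syntax; _×_; _,_; proj₁; proj₂)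
open import Data.Sum using (_⊎_; inj₁; inj₂)
open import Data.Unit using (⊤; tt)
import Data.Vec as Vec
import Data.Vec.Properties as Vec
open import Data.Vec using (Vec; []; _∷_)
open import Function using (_∘_; case_of_; _↔_; Inverse)
open import Function.Properties.Inverse using (↔⇒↣)
open import Relation.Binary.Definitions using (DecidableEquality; tri<; tri≈; tri>)
open import Relation.Binary.PropositionalEquality using (_≡_; _≢_; refl; sym; trans; cong; cong₂; subst; module ≡-Reasoning)
open import Relation.Nullary using (¬_; ¬?; Dec; yes; no; does; contradiction)
open import Relation.Nullary.Decidable using (via-injection; dec⇒maybe; decidable-stable; True; False; toWitness; toWitnessFalse; from-yes)

-- The degrees 0, ±2, t, t ± 2 are the differences modulo 2t of the four degrees ±1, t ± 1 of ψ_h.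
-- So once F has no terms there, the part of F(a x + b ψ_h(x)) that involves b has no terms at the
-- four degrees themselves, and these are compared as if b were 0. This carries no information when
-- a = 0; hence the explicit inverse of ψ_h in that case. The power sums give only products of
-- coefficients of F at opposite degrees, never single coefficients. This is why κ and λ stay
-- unknown: only κλ enters the two surviving products, and two relations in one unknown leave a
-- condition on m. A power sum may be read as a coefficient only if distinct exponents stay distinct
-- modulo q^n - 1. Since p is odd, q is at least 3, so a sum of three powers q^i with i < n is at
-- most q^n, and reduction modulo q^n - 1 identifies no two of the sums that are compared.

-- Sums and products over a finite carrier

module BigOp {N : ℕ} {F : Set} (enum : F ↔ Fin N) {_∙_ : F → F → F} {ε : F}
             (isCM : IsCommutativeMonoid _≡_ _∙_ ε) where
  private
    M : CommutativeMonoid 0ℓ 0ℓ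
    M = record { isCommutativeMonoid = isCM }
    open import Algebra.Properties.CommutativeMonoid.Sum M
    open import Algebra.Properties.Monoid.Mult (CommutativeMonoid.monoid M) using () renaming (_×_ to _×ᴹ_)
    el : Fin N → F
    el = Inverse.from enum
    ix : F → Fin N
    ix = Inverse.to enum
    el-ix : ∀ x → el (ix x) ≡ x
    el-ix = Inverse.strictlyInverseʳ enum
    ix-el : ∀ i → ix (el i) ≡ i
    ix-el = Inverse.strictlyInverseˡ enum
    sum-single : ∀ {n} (f : Fin n → F) (j : Fin n) → (∀ i → i ≢ j → f i ≡ ε) → sum f ≡ f j
    sum-single {suc n} f j z = trans (sum-remove {i = j} f)
      (trans (cong (f j ∙_) (trans (sum-cong-≗ (λ i → z _ (punchInᵢ≢i j i))) (sum-replicate-zero n)))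
             (CommutativeMonoid.identityʳ M _))

  abstract
    -- Generic in the operation: the additive monoid of the field gives `∑`, the multiplicative one
    -- gives `∏`, the latter for `fermat`.
    big : (F → F) → F
    big f = sum (f ∘ el)

    big-cong : ∀ {f g} → (∀ x → f x ≡ g x) → big f ≡ big g
    big-cong e = sum-cong-≗ (λ i → e (el i))

    big-∙ : ∀ f g → big (λ x → f x ∙ g x) ≡ big f ∙ big g
    big-∙ f g = ∑-distrib-+ (f ∘ el) (g ∘ el)

    big-swap : ∀ (f : F → F → F) → big (λ x → big (f x)) ≡ big (λ y → big (λ x → f x y))
    big-swap f = ∑-comm (λ i j → f (el i) (el j))

    big-reindex : ∀ (f : F → F) (g g⁻¹ : F → F) → (∀ x → g (g⁻¹ x) ≡ x) → (∀ x → g⁻¹ (g x) ≡ x) →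
                  big f ≡ big (f ∘ g)
    big-reindex f g g⁻¹ l r = trans (sum-permute (f ∘ el) π)
        (sum-cong-≗ (λ i → cong f (el-ix (g (el i)))))
      where
      π : Permutation N N
      π = permutation (ix ∘ g ∘ el) (ix ∘ g⁻¹ ∘ el)
            (λ i → trans (cong (ix ∘ g) (el-ix _)) (trans (cong ix (l _)) (ix-el i)))
            (λ i → trans (cong (ix ∘ g⁻¹) (el-ix _)) (trans (cong ix (r _)) (ix-el i)))

    big-const : ∀ c → big (λ _ → c) ≡ N ×ᴹ c
    big-const c = sum-replicate N

    big-ε : big (λ _ → ε) ≡ ε
    big-ε = sum-replicate-zero N

    big-single : ∀ f a → (∀ x → x ≢ a → f x ≡ ε) → big f ≡ f a
    big-single f a z = trans (sum-single (f ∘ el) (ix a)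
        (λ i ne → z (el i) (λ e → ne (trans (sym (ix-el i)) (cong ix e)))))
      (cong f (el-ix a))

    -- Applied to multiplication by a constant and to the powers of the Frobenius map.
    big-hom : ∀ (φ : F → F) → φ ε ≡ ε → (∀ x y → φ (x ∙ y) ≡ φ x ∙ φ y) → ∀ f → φ (big f) ≡ big (φ ∘ f)
    big-hom φ φε φ∙ f = go (f ∘ el)
      where
      go : ∀ {n} (g : Fin n → F) → φ (sum g) ≡ sum (φ ∘ g)
      go {zero} g = φε
      go {suc n} g = trans (φ∙ _ _) (cong (φ (g Fin.zero) ∙_) (go (g ∘ Fin.suc)))

    big-closed : ∀ (P : F → Set) → P ε → (∀ {x y} → P x → P y → P (x ∙ y)) → ∀ f → (∀ x → P (f x)) → P (big f)
    big-closed P Pε P∙ f h = go (f ∘ el) (λ i → h (el i))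
      where
      go : ∀ {n} (g : Fin n → F) → (∀ i → P (g i)) → P (sum g)
      go {zero} g z = Pε
      go {suc n} g z = P∙ (z Fin.zero) (go (g ∘ Fin.suc) (λ i → z (Fin.suc i)))

-- Arithmetic in a finite field

module FieldProperties {N : ℕ} (K : FiniteField N) where
  open FiniteField K

  R : CommutativeRing 0ℓ 0ℓ
  R = record { isCommutativeRing = isCommutativeRing }

  module R = CommutativeRing R
  module RP = Algebra.Properties.Ring R.ring
  open R public using (+-comm; +-assoc; *-comm; *-assoc; +-identityˡ; +-identityʳ; *-identityˡ; *-identityʳ;
                       -‿inverseˡ; -‿inverseʳ; distribˡ; distribʳ; zeroˡ; zeroʳ; semiring; *-monoid)
  open import Algebra.Properties.Semiring.Mult.TCOptimised semiring public
    using (×-homo-+; ×1-homo-*; 1+×; ×ᵤ≈×) renaming (_×_ to _·_)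
  open import Algebra.Properties.Semiring.Mult semiring using () renaming (_×_ to _·ᵤ_)

  infix 4 _≟_
  abstract
    _≟_ : DecidableEquality F
    _≟_ = via-injection (↔⇒↣ enum) Fin._≟_

  private
    -- The ring solver normalises with integer coefficients mapped into K this way, so that
    -- cancellation of constants is a computation in ℤ.
    ⟦_⟧ : ℤ → F
    ⟦ pos n ⟧ = n · 1#
    ⟦ -[1+ n ] ⟧ = - (suc n · 1#)

    neg-⟦⟧ : ∀ i → ⟦ ℤ.- i ⟧ ≡ - ⟦ i ⟧
    neg-⟦⟧ (pos zero) = sym RP.-0#≈0#
    neg-⟦⟧ (pos (suc n)) = refl
    neg-⟦⟧ -[1+ n ] = sym (RP.-‿involutive _)

    suc-diff : ∀ x y → x + - y ≡ (1# + x) + - (1# + y)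
    suc-diff x y = begin
      x + - y ≡⟨ cong (_+ - y) (sym (trans (+-assoc _ _ _) (trans (cong (x +_) (-‿inverseʳ 1#)) (+-identityʳ x)))) ⟩
      ((x + 1#) + - 1#) + - y ≡⟨ +-assoc _ _ _ ⟩
      (x + 1#) + (- 1# + - y) ≡⟨ cong₂ _+_ (+-comm x 1#) (RP.-‿+-comm 1# y) ⟩
      (1# + x) + - (1# + y) ∎
      where open ≡-Reasoning

    ⊖-⟦⟧ : ∀ m n → ⟦ m ⊖ n ⟧ ≡ m · 1# + - (n · 1#)
    ⊖-⟦⟧ zero zero = sym (trans (cong (0# +_) RP.-0#≈0#) (+-identityˡ _))
    ⊖-⟦⟧ zero (suc n) = sym (+-identityˡ _)
    ⊖-⟦⟧ (suc m) zero = sym (trans (cong (suc m · 1# +_) RP.-0#≈0#) (+-identityʳ _))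
    ⊖-⟦⟧ (suc m) (suc n) = begin
      ⟦ suc m ⊖ suc n ⟧ ≡⟨ cong ⟦_⟧ (ℤ.[1+m]⊖[1+n]≡m⊖n m n) ⟩
      ⟦ m ⊖ n ⟧ ≡⟨ ⊖-⟦⟧ m n ⟩
      m · 1# + - (n · 1#) ≡⟨ suc-diff _ _ ⟩
      (1# + m · 1#) + - (1# + n · 1#) ≡⟨ cong₂ (λ a b → a + - b) (sym (1+× m 1#)) (sym (1+× n 1#)) ⟩
      suc m · 1# + - (suc n · 1#) ∎
      where open ≡-Reasoning

    +-⟦⟧ : ∀ i j → ⟦ i ℤ.+ j ⟧ ≡ ⟦ i ⟧ + ⟦ j ⟧
    +-⟦⟧ (pos m) (pos n) = ×-homo-+ 1# m n
    +-⟦⟧ (pos m) -[1+ n ] = ⊖-⟦⟧ m (suc n)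
    +-⟦⟧ -[1+ m ] (pos n) = trans (⊖-⟦⟧ n (suc m)) (+-comm _ _)
    +-⟦⟧ -[1+ m ] -[1+ n ] = begin
      - (suc (suc (m ℕ.+ n)) · 1#) ≡⟨ cong (λ z → - (z · 1#)) (cong suc (sym (ℕ.+-suc m n))) ⟩
      - ((suc m ℕ.+ suc n) · 1#) ≡⟨ cong -_ (×-homo-+ 1# (suc m) (suc n)) ⟩
      - (suc m · 1# + suc n · 1#) ≡⟨ sym (RP.-‿+-comm _ _) ⟩
      - (suc m · 1#) + - (suc n · 1#) ∎
      where open ≡-Reasoning

    pos-*-⟦⟧ : ∀ m n → ⟦ pos m ℤ.* pos n ⟧ ≡ ⟦ pos m ⟧ * ⟦ pos n ⟧
    pos-*-⟦⟧ m n = trans (cong ⟦_⟧ (sym (ℤ.pos-* m n))) (×1-homo-* m n)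

    *-⟦⟧ : ∀ i j → ⟦ i ℤ.* j ⟧ ≡ ⟦ i ⟧ * ⟦ j ⟧
    *-⟦⟧ (pos m) (pos n) = pos-*-⟦⟧ m n
    *-⟦⟧ (pos m) -[1+ n ] = begin
      ⟦ pos m ℤ.* -[1+ n ] ⟧ ≡⟨ cong ⟦_⟧ (sym (ℤ.neg-distribʳ-* (pos m) (pos (suc n)))) ⟩
      ⟦ ℤ.- (pos m ℤ.* pos (suc n)) ⟧ ≡⟨ neg-⟦⟧ (pos m ℤ.* pos (suc n)) ⟩
      - ⟦ pos m ℤ.* pos (suc n) ⟧ ≡⟨ cong -_ (pos-*-⟦⟧ m (suc n)) ⟩
      - (m · 1# * suc n · 1#) ≡⟨ RP.-‿distribʳ-* _ _ ⟩
      m · 1# * - (suc n · 1#) ∎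
      where open ≡-Reasoning
    *-⟦⟧ -[1+ m ] (pos n) = begin
      ⟦ -[1+ m ] ℤ.* pos n ⟧ ≡⟨ cong ⟦_⟧ (sym (ℤ.neg-distribˡ-* (pos (suc m)) (pos n))) ⟩
      ⟦ ℤ.- (pos (suc m) ℤ.* pos n) ⟧ ≡⟨ neg-⟦⟧ (pos (suc m) ℤ.* pos n) ⟩
      - ⟦ pos (suc m) ℤ.* pos n ⟧ ≡⟨ cong -_ (pos-*-⟦⟧ (suc m) n) ⟩
      - (suc m · 1# * n · 1#) ≡⟨ RP.-‿distribˡ-* _ _ ⟩
      - (suc m · 1#) * n · 1# ∎
      where open ≡-Reasoning
    *-⟦⟧ -[1+ m ] -[1+ n ] = begin
      ⟦ -[1+ m ] ℤ.* -[1+ n ] ⟧ ≡⟨ pos-*-⟦⟧ (suc m) (suc n) ⟩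
      suc m · 1# * suc n · 1# ≡⟨ sym (RP.-‿involutive _) ⟩
      - - (suc m · 1# * suc n · 1#) ≡⟨ cong -_ (RP.-‿distribʳ-* _ _) ⟩
      - (suc m · 1# * - (suc n · 1#)) ≡⟨ RP.-‿distribˡ-* _ _ ⟩
      - (suc m · 1#) * - (suc n · 1#) ∎
      where open ≡-Reasoning

    ℤ-morphism : ℤ.+-*-rawRing -Raw-AlmostCommutative⟶ fromCommutativeRing R
    ℤ-morphism = record
      { ⟦_⟧ = ⟦_⟧ ; +-homo = +-⟦⟧ ; *-homo = *-⟦⟧ ; -‿homo = neg-⟦⟧ ; 0-homo = refl ; 1-homo = refl }

    -- Equality is tested in ℤ only. Integers that agree merely modulo the characteristic are left
    -- undecided, which is sound for the solver.
    coeff≟ : ∀ i j → Maybe (⟦ i ⟧ ≡ ⟦ j ⟧)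
    coeff≟ i j = Maybe.map (cong ⟦_⟧) (dec⇒maybe (i ℤ.≟ j))

  module Solver = Algebra.Solver.Ring ℤ.+-*-rawRing (fromCommutativeRing R) ℤ-morphism coeff≟
  open Solver public using (solve; _:=_; _:+_; _:*_; :-_; con; Polynomial)

  :1 :0 : ∀ {k} → Polynomial k
  :1 = con (pos 1)
  :0 = con (pos 0)

  x-y≡0⇒x≡y : ∀ {x y} → x + - y ≡ 0# → x ≡ y
  x-y≡0⇒x≡y {x} {y} e = trans (solve 2 (λ x y → x := (x :+ :- y) :+ y) refl x y)
                              (trans (cong (_+ y) e) (+-identityˡ y))

  +-cancelʳ : ∀ {x y} z → x + z ≡ y + z → x ≡ y
  +-cancelʳ z e = RP.+-cancelʳ z _ _ e

  inv-l : ∀ x → x ≢ 0# → inv x * x ≡ 1#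
  inv-l x ne = trans (*-comm _ _) (inv-r x ne)

  *-cancelˡ : ∀ {x y z} → x ≢ 0# → x * y ≡ x * z → y ≡ z
  *-cancelˡ {x} {y} {z} ne e = begin
    y ≡⟨ sym (*-identityˡ y) ⟩
    1# * y ≡⟨ cong (_* y) (sym (inv-l x ne)) ⟩
    (inv x * x) * y ≡⟨ *-assoc _ _ _ ⟩
    inv x * (x * y) ≡⟨ cong (inv x *_) e ⟩
    inv x * (x * z) ≡⟨ sym (*-assoc _ _ _) ⟩
    (inv x * x) * z ≡⟨ cong (_* z) (inv-l x ne) ⟩
    1# * z ≡⟨ *-identityˡ z ⟩
    z ∎
    where open ≡-Reasoning

  *-cancelʳ : ∀ {x y z} → x ≢ 0# → y * x ≡ z * x → y ≡ z
  *-cancelʳ ne e = *-cancelˡ ne (trans (*-comm _ _) (trans e (*-comm _ _)))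

  *≡0 : ∀ {x y} → x * y ≡ 0# → x ≢ 0# → y ≡ 0#
  *≡0 {x} e ne = *-cancelˡ ne (trans e (sym (zeroʳ x)))

  *≢0 : ∀ {x y} → x ≢ 0# → y ≢ 0# → x * y ≢ 0#
  *≢0 nx ny e = ny (*≡0 e nx)

  *≢0ˡ : ∀ {x y} → x * y ≢ 0# → x ≢ 0#
  *≢0ˡ {x} {y} ne e = ne (trans (cong (_* y) e) (zeroˡ y))

  *≢0ʳ : ∀ {x y} → x * y ≢ 0# → y ≢ 0#
  *≢0ʳ {x} {y} ne e = ne (trans (cong (x *_) e) (zeroʳ x))

  1≢0 : 1# ≢ 0#
  1≢0 e = 0≢1 (sym e)

  *≡1⇒≢0 : ∀ {x y} → x * y ≡ 1# → x ≢ 0#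
  *≡1⇒≢0 e = *≢0ˡ (λ z → 1≢0 (trans (sym e) z))

  inv≢0 : ∀ {x} → x ≢ 0# → inv x ≢ 0#
  inv≢0 {x} ne = *≡1⇒≢0 (inv-l x ne)

  inv-unique : ∀ {x y} → x * y ≡ 1# → y ≡ inv x
  inv-unique {x} e = *-cancelˡ (*≡1⇒≢0 e) (trans e (sym (inv-r x (*≡1⇒≢0 e))))

  inv-1 : inv 1# ≡ 1#
  inv-1 = sym (inv-unique (*-identityˡ 1#))

  -- Total because `inv` sends 0 to 0. Quotients of monomials can therefore be treated as functions
  -- on all of K, with value 0 at 0 as soon as the exponent is positive.
  inv-* : ∀ x y → inv (x * y) ≡ inv x * inv y
  inv-* x y with x ≟ 0# | y ≟ 0#
  ... | yes refl | _ = trans (cong inv (zeroˡ y)) (trans inv-0 (sym (trans (cong (_* inv y) inv-0) (zeroˡ _))))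
  ... | no _ | yes refl = trans (cong inv (zeroʳ x)) (trans inv-0 (sym (trans (cong (inv x *_) inv-0) (zeroʳ _))))
  ... | no nx | no ny = sym (inv-unique (begin
    (x * y) * (inv x * inv y) ≡⟨ solve 4 (λ x y a b → (x :* y) :* (a :* b) := (x :* a) :* (y :* b)) refl x y (inv x) (inv y) ⟩
    (x * inv x) * (y * inv y) ≡⟨ cong₂ _*_ (inv-r x nx) (inv-r y ny) ⟩
    1# * 1# ≡⟨ *-identityˡ _ ⟩
    1# ∎))
    where open ≡-Reasoning

  ^-+ : ∀ x m n → x ^ (m ℕ.+ n) ≡ x ^ m * x ^ n
  ^-+ x zero n = sym (*-identityˡ _)
  ^-+ x (suc m) n = trans (cong (x *_) (^-+ x m n)) (sym (*-assoc _ _ _))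

  1^ : ∀ n → 1# ^ n ≡ 1#
  1^ zero = refl
  1^ (suc n) = trans (*-identityˡ _) (1^ n)

  *-^ : ∀ x y n → (x * y) ^ n ≡ x ^ n * y ^ n
  *-^ x y zero = sym (*-identityˡ _)
  *-^ x y (suc n) = trans (cong ((x * y) *_) (*-^ x y n))
    (solve 4 (λ x y a b → (x :* y) :* (a :* b) := (x :* a) :* (y :* b)) refl x y (x ^ n) (y ^ n))

  ^-* : ∀ x m n → x ^ (m ℕ.* n) ≡ (x ^ m) ^ n
  ^-* x zero n = sym (1^ n)
  ^-* x (suc m) n = trans (^-+ x n (m ℕ.* n)) (trans (cong (x ^ n *_) (^-* x m n)) (sym (*-^ x (x ^ m) n)))

  ^-1 : ∀ x → x ^ 1 ≡ x
  ^-1 = *-identityʳ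

  0^ : ∀ {n} → 0 ℕ.< n → 0# ^ n ≡ 0#
  0^ {suc n} _ = zeroˡ _

  ^≢0 : ∀ {x} n → x ≢ 0# → x ^ n ≢ 0#
  ^≢0 zero ne = 1≢0
  ^≢0 (suc n) ne = *≢0 ne (^≢0 n ne)

  inv-^ : ∀ x n → inv (x ^ n) ≡ inv x ^ n
  inv-^ x zero = inv-1
  inv-^ x (suc n) = trans (inv-* x (x ^ n)) (cong (inv x *_) (inv-^ x n))

  open BigOp enum R.+-isCommutativeMonoid public
    renaming (big to ∑; big-cong to ∑-cong; big-∙ to ∑-+; big-swap to ∑-swap; big-reindex to ∑-reindex;
              big-const to ∑-const; big-ε to ∑-0; big-single to ∑-single; big-hom to ∑-hom)
  open BigOp enum R.*-isCommutativeMonoid public using ()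
    renaming (big to ∏; big-cong to ∏-cong; big-∙ to ∏-*; big-reindex to ∏-reindex;
              big-const to ∏-const; big-single to ∏-single; big-closed to ∏-closed)

  ∑-*ˡ : ∀ c f → c * ∑ f ≡ ∑ (λ x → c * f x)
  ∑-*ˡ c f = ∑-hom (c *_) (zeroʳ c) (distribˡ c) f

  ∑-*ʳ : ∀ c f → ∑ f * c ≡ ∑ (λ x → f x * c)
  ∑-*ʳ c f = ∑-hom (_* c) (zeroˡ c) (distribʳ c) f

  ite : ∀ {P : Set} → Dec P → F → F → F
  ite d a b = if does d then a else b

  ite-yes : ∀ {P : Set} (d : Dec P) {a b} → P → ite d a b ≡ a
  ite-yes (yes _) p = refl
  ite-yes (no ¬p) p = contradiction p ¬p

  ite-no : ∀ {P : Set} (d : Dec P) {a b} → ¬ P → ite d a b ≡ b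
  ite-no (yes p) ¬p = contradiction p ¬p
  ite-no (no _) _ = refl

  open import Algebra.Properties.Monoid.Mult *-monoid using () renaming (_×_ to _×ᴹ_)

  private
    ×ᴹ-^ : ∀ n x → _×ᴹ_ n x ≡ x ^ n
    ×ᴹ-^ zero x = refl
    ×ᴹ-^ (suc n) x = cong (x *_) (×ᴹ-^ n x)

    ∏≢0 : ∀ f → (∀ x → f x ≢ 0#) → ∏ f ≢ 0#
    ∏≢0 = ∏-closed (_≢ 0#) 1≢0 *≢0

  -- Multiplication by x permutes K; comparing the products of the nonzero elements before and after
  -- gives W = 1, where W is the product of one factor x for each nonzero element.
  fermat : ∀ x → x ^ N ≡ x
  fermat x with x ≟ 0#
  ... | yes refl = fermat-0 enum
    where
    fermat-0 : ∀ {n} → F ↔ Fin n → 0# ^ n ≡ 0#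
    fermat-0 {zero} e with () ← Inverse.to e 0#
    fermat-0 {suc n} e = zeroˡ _
  ... | no nx = sym (begin
      x ≡⟨ sym (*-identityʳ x) ⟩
      x * 1# ≡⟨ cong (x *_) (sym W≡1) ⟩
      x * W ≡⟨ cong (_* W) (sym ∏g′) ⟩
      ∏ g′ * W ≡⟨ sym (∏-* _ _) ⟩
      ∏ (λ y → g′ y * w y) ≡⟨ ∏-cong g′w ⟩
      ∏ (λ _ → x) ≡⟨ ∏-const x ⟩
      _×ᴹ_ N x ≡⟨ ×ᴹ-^ N x ⟩
      x ^ N ∎)
    where
    open ≡-Reasoning
    g g′ w : F → F
    g y = ite (y ≟ 0#) 1# y
    g′ y = ite (y ≟ 0#) x 1#
    w y = ite (y ≟ 0#) 1# x
    W P : F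
    W = ∏ w
    P = ∏ g
    g′w : ∀ y → g′ y * w y ≡ x
    g′w y with y ≟ 0#
    ... | yes _ = *-identityʳ x
    ... | no _ = *-identityˡ x
    ∏g′ : ∏ g′ ≡ x
    ∏g′ = trans (∏-single g′ 0# (λ y ne → ite-no (y ≟ 0#) ne)) (ite-yes (0# ≟ 0#) refl)
    gxy : ∀ y → g (x * y) ≡ g y * w y
    gxy y with y ≟ 0#
    ... | yes refl = trans (ite-yes (x * 0# ≟ 0#) (zeroʳ x)) (sym (*-identityˡ _))
    ... | no ny = trans (ite-no (x * y ≟ 0#) (*≢0 nx ny)) (*-comm x y)
    g≢0 : ∀ y → g y ≢ 0#
    g≢0 y with y ≟ 0#
    ... | yes _ = 1≢0
    ... | no ne = ne
    W≡1 : W ≡ 1#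
    W≡1 = *-cancelˡ (∏≢0 g g≢0) (begin
      P * W ≡⟨ sym (∏-* g w) ⟩
      ∏ (λ y → g y * w y) ≡⟨ ∏-cong (λ y → sym (gxy y)) ⟩
      ∏ (λ y → g (x * y)) ≡⟨ sym (∏-reindex g (x *_) (inv x *_)
          (λ y → trans (sym (*-assoc _ _ _)) (trans (cong (_* y) (inv-r x nx)) (*-identityˡ y)))
          (λ y → trans (sym (*-assoc _ _ _)) (trans (cong (_* y) (inv-l x nx)) (*-identityˡ y)))) ⟩
      P ≡⟨ sym (*-identityʳ P) ⟩
      P * 1# ∎)

  ·ᵤ≡· : ∀ n x → n ·ᵤ x ≡ n · x
  ·ᵤ≡· = ×ᵤ≈×

  ·-suc : ∀ n x → suc n · x ≡ x + n · x
  ·-suc = 1+×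

  -- Translation by 1 permutes K, so the sum S of all elements equals S + N · 1.
  N·1≡0 : N · 1# ≡ 0#
  N·1≡0 = trans (sym (·ᵤ≡· N 1#)) (trans (sym (∑-const 1#)) (+-cancelˡ′ (begin
      S + ∑ (λ _ → 1#) ≡⟨ sym (∑-+ _ _) ⟩
      ∑ (λ x → x + 1#) ≡⟨ sym (∑-reindex (λ x → x) (_+ 1#) (_+ - 1#)
          (solve 1 (λ x → (x :+ :- :1) :+ :1 := x) refl)
          (solve 1 (λ x → (x :+ :1) :+ :- :1 := x) refl)) ⟩
      S ≡⟨ sym (+-identityʳ S) ⟩
      S + 0# ∎)))
    where
    open ≡-Reasoning
    S = ∑ (λ x → x)
    +-cancelˡ′ : ∀ {y z} → S + y ≡ S + z → y ≡ z
    +-cancelˡ′ = RP.+-cancelˡ S _ _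

  module AutomorphismProperties (s : Automorphism) where
    open Automorphism s

    σ-0 : σ 0# ≡ 0#
    σ-0 = RP.+-cancelʳ (σ 0#) _ _ (trans (sym (σ-+ 0# 0#)) (trans (cong σ (+-identityˡ 0#)) (sym (+-identityˡ _))))

    σ≢0 : ∀ {x} → x ≢ 0# → σ x ≢ 0#
    σ≢0 {x} ne e = ne (trans (sym (σ-invˡ x)) (trans (cong σ⁻¹ (trans e (sym σ-0))) (σ-invˡ 0#)))

    σ-neg : ∀ x → σ (- x) ≡ - σ x
    σ-neg x = RP.+-cancelʳ (σ x) _ _ (trans (sym (σ-+ (- x) x)) (trans (cong σ (-‿inverseˡ x)) (trans σ-0 (sym (-‿inverseˡ _)))))

    σ-inv : ∀ x → σ (inv x) ≡ inv (σ x)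
    σ-inv x with x ≟ 0#
    ... | yes refl = trans (cong σ inv-0) (trans σ-0 (sym (trans (cong inv σ-0) inv-0)))
    ... | no ne = inv-unique (trans (sym (σ-* x (inv x))) (trans (cong σ (inv-r x ne)) σ-1))

    σ-^ : ∀ x n → σ (x ^ n) ≡ σ x ^ n
    σ-^ x zero = σ-1
    σ-^ x (suc n) = trans (σ-* _ _) (cong (σ x *_) (σ-^ x n))

    inverse : Automorphism
    inverse = record
      { σ = σ⁻¹ ; σ⁻¹ = σ ; σ-invˡ = σ-invʳ ; σ-invʳ = σ-invˡ
      ; σ-+ = λ x y → trans (cong₂ (λ a b → σ⁻¹ (a + b)) (sym (σ-invʳ x)) (sym (σ-invʳ y))) (trans (cong σ⁻¹ (sym (σ-+ _ _))) (σ-invˡ _))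
      ; σ-* = λ x y → trans (cong₂ (λ a b → σ⁻¹ (a * b)) (sym (σ-invʳ x)) (sym (σ-invʳ y))) (trans (cong σ⁻¹ (sym (σ-* _ _))) (σ-invˡ _))
      ; σ-1 = trans (cong σ⁻¹ (sym σ-1)) (σ-invˡ 1#) }

-- Binomial coefficients and additivity of the p-th power

k*nCk : ∀ n k → suc k ℕ.* (suc n C suc k) ≡ suc n ℕ.* (n C k)
k*nCk zero zero = refl
k*nCk zero (suc k) = trans (cong (suc (suc k) ℕ.*_) (k>n⇒nCk≡0 {1} {suc (suc k)} (ℕ.s≤s (ℕ.s≤s ℕ.z≤n))))
  (trans (ℕ.*-zeroʳ (suc (suc k))) (sym (trans (ℕ.*-identityˡ (0 C suc k)) (k>n⇒nCk≡0 {0} {suc k} (ℕ.s≤s ℕ.z≤n)))))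
k*nCk (suc n) zero = trans (ℕ.*-identityˡ (suc (suc n) C 1)) (trans (nC1≡n (suc (suc n)))
  (sym (trans (cong (suc (suc n) ℕ.*_) {suc n C 0} {1} (trans (nCk≡nC[n∸k] {0} {suc n} ℕ.z≤n) (nCn≡1 (suc n)))) (ℕ.*-identityʳ (suc (suc n))))))
k*nCk (suc n) (suc k) = begin
  suc (suc k) ℕ.* (suc (suc n) C suc (suc k)) ≡⟨ cong (suc (suc k) ℕ.*_) (sym (nCk+nC[k+1]≡[n+1]C[k+1] (suc n) (suc k))) ⟩
  suc (suc k) ℕ.* (A ℕ.+ B) ≡⟨ ℕ.*-distribˡ-+ (suc (suc k)) A B ⟩
  (A ℕ.+ suc k ℕ.* A) ℕ.+ suc (suc k) ℕ.* B ≡⟨ cong₂ (λ x y → (A ℕ.+ x) ℕ.+ y) (k*nCk n k) (k*nCk n (suc k)) ⟩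
  (A ℕ.+ suc n ℕ.* (n C k)) ℕ.+ suc n ℕ.* (n C suc k) ≡⟨ ℕ.+-assoc A (suc n ℕ.* (n C k)) (suc n ℕ.* (n C suc k)) ⟩
  A ℕ.+ (suc n ℕ.* (n C k) ℕ.+ suc n ℕ.* (n C suc k)) ≡⟨ cong (A ℕ.+_) (sym (ℕ.*-distribˡ-+ (suc n) (n C k) (n C suc k))) ⟩
  A ℕ.+ suc n ℕ.* ((n C k) ℕ.+ (n C suc k)) ≡⟨ cong (λ z → A ℕ.+ suc n ℕ.* z) (nCk+nC[k+1]≡[n+1]C[k+1] n k) ⟩
  suc (suc n) ℕ.* A ∎
  where
  open ≡-Reasoning
  A = suc n C suc k
  B = suc n C suc (suc k)

-- By the absorption identity `k*nCk`, p divides k times the binomial coefficient, and it cannot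
-- divide k itself because 0 < k < p.
p∣pCk : ∀ {p k} → Prime p → 0 ℕ.< k → k ℕ.< p → p ∣ p C k
p∣pCk {suc p} {suc k} pp _ k<p with euclidsLemma (suc k) (suc p C suc k) pp
    (divides (p C k) (trans (k*nCk p k) (ℕ.*-comm (suc p) (p C k))))
... | inj₁ d = contradiction d (>⇒∤ k<p)
... | inj₂ d = d

module Freshman {N : ℕ} (K : FiniteField N) where
  open FiniteField K
  open FieldProperties K
  private
    open import Algebra.Properties.Semiring.Exp semiring using () renaming (_^_ to _^ᴱ_)
    open import Algebra.Properties.Semiring.Mult semiring using () renaming (_×_ to _×ᵤ_)
    open import Algebra.Properties.Semiring.Sum semiring using (sum; sum-init-last; sum-cong-≗; sum-replicate-zero)
    open import Algebra.Properties.CommutativeSemiring.Binomial R.commutativeSemiring using (binomialTerm) renaming (theorem to binomial-theorem)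

    ^ᴱ≡^ : ∀ z n → z ^ᴱ n ≡ z ^ n
    ^ᴱ≡^ z zero = refl
    ^ᴱ≡^ z (suc n) = cong (z *_) (^ᴱ≡^ z n)

  freshman : ∀ n → 0 ℕ.< n → (∀ k x → 0 ℕ.< k → k ℕ.< n → (n C k) · x ≡ 0#) →
             ∀ x y → (x + y) ^ n ≡ x ^ n + y ^ n
  freshman (suc n) _ nCk≡0 x y = begin
      (x + y) ^ P ≡⟨ sym (^ᴱ≡^ _ P) ⟩
      (x + y) ^ᴱ P ≡⟨ binomial-theorem P x y ⟩
      sum T ≡⟨⟩
      T Fin.zero + sum (T ∘ Fin.suc) ≡⟨ cong₂ _+_ first (trans (sum-init-last (T ∘ Fin.suc)) (cong₂ _+_ middle last)) ⟩
      y ^ P + (0# + x ^ P) ≡⟨ trans (cong (y ^ P +_) (+-identityˡ _)) (+-comm _ _) ⟩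
      x ^ P + y ^ P ∎
      where
      open ≡-Reasoning
      P = suc n
      T : Fin (suc P) → F
      T = binomialTerm x y P
      term : ℕ → F
      term k = (P C k) ×ᵤ (x ^ᴱ k * y ^ᴱ (P ℕ.∸ k))
      first : T Fin.zero ≡ y ^ P
      first = trans (cong (_×ᵤ (1# * y ^ᴱ P)) (trans (nCk≡nC[n∸k] {0} {P} ℕ.z≤n) (nCn≡1 P)))
        (trans (+-identityʳ _) (trans (*-identityˡ _) (^ᴱ≡^ y P)))
      last : T (Fin.suc (Fin.fromℕ n)) ≡ x ^ P
      last = begin
        term (suc (Fin.toℕ (Fin.fromℕ n))) ≡⟨ cong (λ k → term (suc k)) (Fin.toℕ-fromℕ n) ⟩
        term P ≡⟨ cong₂ (λ a b → a ×ᵤ (x ^ᴱ P * y ^ᴱ b)) (nCn≡1 P) (ℕ.n∸n≡0 P) ⟩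
        x ^ᴱ P * 1# + 0# ≡⟨ trans (+-identityʳ _) (trans (*-identityʳ _) (^ᴱ≡^ x P)) ⟩
        x ^ P ∎
      k : Fin n → ℕ
      k i = suc (Fin.toℕ (Fin.inject₁ i))
      middle : sum (λ i → T (Fin.suc (Fin.inject₁ i))) ≡ 0#
      middle = trans (sum-cong-≗ (λ i → trans (·ᵤ≡· (P C k i) (x ^ᴱ k i * y ^ᴱ (P ℕ.∸ k i))) (nCk≡0 (k i) _ (ℕ.s≤s ℕ.z≤n)
          (ℕ.s≤s (subst (ℕ._< n) (sym (Fin.toℕ-inject₁ i)) (Fin.toℕ<n i)))))) (sum-replicate-zero n)

-- The characteristic

module Characteristic {N : ℕ} (K : FiniteField N) {p m : ℕ} (pp : Prime p) (N≡p^m : N ≡ p ℕ.^ m) where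
  open FiniteField K
  open FieldProperties K
  open Freshman K

  ·1-^ : ∀ a k → (a ℕ.^ k) · 1# ≡ (a · 1#) ^ k
  ·1-^ a zero = refl
  ·1-^ a (suc k) = trans (×1-homo-* a (a ℕ.^ k)) (cong (a · 1# *_) (·1-^ a k))

  -- `N·1≡0` reads (p · 1)^m = 0, and a field has no nilpotent element other than 0.
  p·1≡0 : p · 1# ≡ 0#
  p·1≡0 with p · 1# ≟ 0#
  ... | yes e = e
  ... | no ne = contradiction (trans (sym (·1-^ p m)) (trans (cong (_· 1#) (sym N≡p^m)) N·1≡0)) (^≢0 m ne)

  ∣⇒·≡0 : ∀ {a} x → p ∣ a → a · x ≡ 0#
  ∣⇒·≡0 x (divides b refl) = begin
    (b ℕ.* p) · x ≡⟨ cong ((b ℕ.* p) ·_) (sym (*-identityˡ x)) ⟩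
    (b ℕ.* p) · (1# * x) ≡⟨ sym (·-assoc (b ℕ.* p) 1# x) ⟩
    (b ℕ.* p) · 1# * x ≡⟨ cong (_* x) (×1-homo-* b p) ⟩
    (b · 1# * p · 1#) * x ≡⟨ cong (λ z → (b · 1# * z) * x) p·1≡0 ⟩
    (b · 1# * 0#) * x ≡⟨ trans (cong (_* x) (zeroʳ _)) (zeroˡ x) ⟩
    0# ∎
    where
    open ≡-Reasoning
    ·-assoc : ∀ n x y → (n · x) * y ≡ n · (x * y)
    ·-assoc zero x y = zeroˡ y
    ·-assoc (suc n) x y = trans (cong (_* y) (·-suc n x)) (trans (distribʳ _ _ _)
      (trans (cong (x * y +_) (·-assoc n x y)) (sym (·-suc n (x * y)))))

  private
    ·0 : ∀ y {a} → a · 1# ≡ 0# → (y ℕ.* a) · 1# ≡ 0#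
    ·0 y {a} e = trans (×1-homo-* y a) (trans (cong (y · 1# *_) e) (zeroʳ _))

    diff : ∀ {a b} → a ℕ.< b → b · 1# ≡ a · 1# → (b ℕ.∸ a) · 1# ≡ 0#
    diff {a} {b} a<b e = +-cancelʳ (a · 1#) (trans (sym (×-homo-+ 1# (b ℕ.∸ a) a))
      (trans (cong (_· 1#) (ℕ.m∸n+n≡m (ℕ.<⇒≤ a<b))) (trans e (sym (+-identityˡ _)))))

  -- A Bézout relation between d and p turns d · 1 = 0 and p · 1 = 0 into 1 = 0.
  ·1≢0 : ∀ d → 0 ℕ.< d → d ℕ.< p → d · 1# ≢ 0#
  ·1≢0 (suc d) _ d<p e with coprime-Bézout (prime⇒coprime pp d<p)
  ... | Bézout.+- x y eq = 1≢0 (trans (sym (trans (cong (1# +_) (·0 y e)) (+-identityʳ 1#)))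
      (trans (sym (×-homo-+ 1# 1 (y ℕ.* suc d))) (trans (cong (_· 1#) eq) (·0 x p·1≡0))))
  ... | Bézout.-+ x y eq = 1≢0 (trans (sym (trans (cong (1# +_) (·0 x p·1≡0)) (+-identityʳ 1#)))
      (trans (sym (×-homo-+ 1# 1 (x ℕ.* p))) (trans (cong (_· 1#) eq) (·0 y e))))

  -- Allows `conjugates` to recover base p digits from their images in the prime field.
  ·1-injective : ∀ {a b} → a ℕ.< p → b ℕ.< p → a · 1# ≡ b · 1# → a ≡ b
  ·1-injective {a} {b} a<p b<p e with ℕ.<-cmp a b
  ... | tri≈ _ eq _ = eq
  ... | tri< a<b _ _ = contradiction (diff a<b (sym e)) (·1≢0 (b ℕ.∸ a) (ℕ.m<n⇒0<n∸m a<b) (ℕ.≤-<-trans (ℕ.m∸n≤m b a) b<p))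
  ... | tri> _ _ b<a = contradiction (diff b<a e) (·1≢0 (a ℕ.∸ b) (ℕ.m<n⇒0<n∸m b<a) (ℕ.≤-<-trans (ℕ.m∸n≤m a b) a<p))

  frobenius-+ : ∀ x y → (x + y) ^ p ≡ x ^ p + y ^ p
  frobenius-+ = freshman p (ℕ.>-nonZero⁻¹ p {{prime⇒nonZero pp}}) (λ k x 0<k k<p → ∣⇒·≡0 x (p∣pCk pp 0<k k<p))

-- Roots of polynomials and conjugates under automorphisms

module Polynomials {N : ℕ} (K : FiniteField N) where
  open FiniteField K
  open FieldProperties K
  open import Data.List.Membership.DecPropositional _≟_ using (_∈?_)

  elements : List F
  elements = List.tabulate (Inverse.from enum)

  elements-unique : Unique elements
  elements-unique = tabulate⁺ (λ {i} {j} e → trans (sym (Inverse.strictlyInverseˡ enum i))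
    (trans (cong (Inverse.to enum) e) (Inverse.strictlyInverseˡ enum j)))

  ∈-elements : ∀ x → x ∈ elements
  ∈-elements x = subst (_∈ elements) (Inverse.strictlyInverseʳ enum x) (∈-tabulate⁺ (Inverse.to enum x))

  -- The source of all elements found by counting: if every element were listed, the position of an
  -- occurrence would inject `Fin N` into a shorter list.
  exists-∉ : ∀ (xs : List F) → List.length xs ℕ.< N → ∃[ x ] x ∉ xs
  exists-∉ xs len<N with Fin.any? (λ i → ¬? (Inverse.from enum i ∈? xs))
  ... | yes (i , ni) = Inverse.from enum i , ni
  ... | no none = contradiction (Fin.injective⇒≤ {f = index-of} index-of-injective) (ℕ.<⇒≱ len<N)
    where
    all-in : ∀ i → Inverse.from enum i ∈ xs
    all-in i = decidable-stable (Inverse.from enum i ∈? xs) (λ n → none (i , n))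
    index-of : Fin N → Fin (List.length xs)
    index-of i = Any.index (all-in i)
    index-of-injective : ∀ {i j} → index-of i ≡ index-of j → i ≡ j
    index-of-injective {i} {j} e = trans (sym (Inverse.strictlyInverseˡ enum i))
      (trans (cong (Inverse.to enum) (trans (lookup-index (all-in i))
        (trans (cong (List.lookup xs) e) (sym (lookup-index (all-in j)))))) (Inverse.strictlyInverseˡ enum j))

  -- The vector c₀ ∷ … ∷ c_{d-1} stands for the monic polynomial X^d + c_{d-1} X^{d-1} + … + c₀.
  eval : ∀ {d} → Vec F d → F → F
  eval [] x = 1#
  eval (c ∷ cs) x = c + x * eval cs x

  private
    add-multiple : ∀ {d} → Vec F (suc d) → F → Vec F d → Vec F (suc d)
    add-multiple (c ∷ []) a [] = (c + a) ∷ []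
    add-multiple (c ∷ c′ ∷ cs) a (q ∷ qs) = (c + a * q) ∷ add-multiple (c′ ∷ cs) a qs

    eval-add-multiple : ∀ {d} (cs : Vec F (suc d)) a qs x →
                        eval (add-multiple cs a qs) x ≡ eval cs x + a * eval qs x
    eval-add-multiple (c ∷ []) a [] x = solve 3 (λ c a x → (c :+ a) :+ x :* :1 := (c :+ x :* :1) :+ a :* :1) refl c a x
    eval-add-multiple (c ∷ c′ ∷ cs) a (q ∷ qs) x = trans
      (cong (λ z → (c + a * q) + x * z) (eval-add-multiple (c′ ∷ cs) a qs x))
      (solve 6 (λ c a q x e f → (c :+ a :* q) :+ x :* (e :+ a :* f) := (c :+ x :* e) :+ a :* (q :+ x :* f)) refl
        c a q x (eval (c′ ∷ cs) x) (eval qs x))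

    -- Synthetic division by X - a: if Q is the quotient of P, that of c + X P is P + a Q. This
    -- stays monic since P has larger degree than Q.
    quotient : ∀ {d} → F → Vec F (suc d) → Vec F d
    quotient a (c ∷ []) = []
    quotient a (c ∷ c′ ∷ cs) = add-multiple (c′ ∷ cs) a (quotient a (c′ ∷ cs))

    eval-quotient : ∀ {d} a (cs : Vec F (suc d)) x →
                    eval cs x + - eval cs a ≡ (x + - a) * eval (quotient a cs) x
    eval-quotient a (c ∷ []) x = solve 3 (λ a c x → (c :+ x :* :1) :+ :- (c :+ a :* :1) := (x :+ :- a) :* :1) refl a c x
    eval-quotient a (c ∷ c′ ∷ cs) x = begin
      (c + x * e) + - (c + a * f)
        ≡⟨ solve 5 (λ a c x e f → (c :+ x :* e) :+ :- (c :+ a :* f) := (x :+ :- a) :* e :+ a :* (e :+ :- f)) refl a c x e f ⟩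
      (x + - a) * e + a * (e + - f) ≡⟨ cong (λ z → (x + - a) * e + a * z) (eval-quotient a (c′ ∷ cs) x) ⟩
      (x + - a) * e + a * ((x + - a) * g)
        ≡⟨ solve 4 (λ a x e g → (x :+ :- a) :* e :+ a :* ((x :+ :- a) :* g) := (x :+ :- a) :* (e :+ a :* g)) refl a x e g ⟩
      (x + - a) * (e + a * g) ≡⟨ cong ((x + - a) *_) (sym (eval-add-multiple (c′ ∷ cs) a _ x)) ⟩
      (x + - a) * eval (quotient a (c ∷ c′ ∷ cs)) x ∎
      where
      open ≡-Reasoning
      e = eval (c′ ∷ cs) x
      f = eval (c′ ∷ cs) a
      g = eval (quotient a (c′ ∷ cs)) x

  root-bound : ∀ {d} (cs : Vec F d) (xs : List F) → Unique xs → All (λ x → eval cs x ≡ 0#) xs → List.length xs ℕ.≤ d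
  root-bound cs [] _ _ = ℕ.z≤n
  root-bound [] (x ∷ xs) _ (e ∷ _) = contradiction e 1≢0
  root-bound (c ∷ cs) (x ∷ xs) (x≢ ∷ u) (e ∷ es) =
    ℕ.s≤s (root-bound (quotient x (c ∷ cs)) xs u (All.zipWith (λ (ne , e′) → quotient-root ne e′) (x≢ , es)))
    where
    quotient-root : ∀ {y} → x ≢ y → eval (c ∷ cs) y ≡ 0# → eval (quotient x (c ∷ cs)) y ≡ 0#
    quotient-root {y} ne e′ = *≡0 (trans (sym (eval-quotient x (c ∷ cs) y))
      (trans (cong₂ (λ a b → a + - b) e′ e) (-‿inverseʳ 0#))) (λ z → ne (sym (x-y≡0⇒x≡y z)))

  ^-solutions-bound : ∀ d y (xs : List F) → Unique xs → All (λ x → x ^ suc d ≡ y) xs → List.length xs ℕ.≤ suc d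
  ^-solutions-bound d y xs u all = root-bound ((- y) ∷ Vec.replicate d 0#) xs u (All.map (λ {x} e → root x e) all)
    where
    eval-0s : ∀ d x → eval (Vec.replicate d 0#) x ≡ x ^ d
    eval-0s zero x = refl
    eval-0s (suc d) x = trans (+-identityˡ _) (cong (x *_) (eval-0s d x))
    root : ∀ x → x ^ suc d ≡ y → (- y) + x * eval (Vec.replicate d 0#) x ≡ 0#
    root x e = trans (cong (λ z → (- y) + x * z) (eval-0s d x)) (trans (cong ((- y) +_) e) (-‿inverseˡ y))

  ^-solutions : ℕ → F → List F
  ^-solutions d y = List.filter (λ x → x ^ d ≟ y) elements

  length-^-solutions : ∀ d y → 0 ℕ.< d → List.length (^-solutions d y) ℕ.≤ d
  length-^-solutions (suc d) y _ = ^-solutions-bound d y _ (filter⁺ _ elements-unique) (all-filter _ elements)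

  ∈-^-solutions : ∀ d {x y} → x ^ d ≡ y → x ∈ ^-solutions d y
  ∈-^-solutions d {x} {y} e = ∈-filter⁺ (λ x → x ^ d ≟ y) (∈-elements x) e

  private
    poly : ∀ {l} → Vec F l → F → F
    poly [] x = 0#
    poly (c ∷ cs) x = c + x * poly cs x

    -- Strips vanishing leading coefficients and divides by the first nonzero one, because
    -- `root-bound` is about monic polynomials. The bound `d ℕ.< l` becomes the bound on the number
    -- of conjugates.
    zero-or-monic : ∀ {l} (cs : Vec F l) → (∀ i → Vec.lookup cs i ≡ 0#) ⊎
      (∃[ d ] (d ℕ.< l × Σ (Vec F d) λ v → ∃[ c ] (c ≢ 0# × (∀ x → poly cs x ≡ c * eval v x))))
    zero-or-monic [] = inj₁ (λ ())
    zero-or-monic (c ∷ cs) with zero-or-monic cs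
    ... | inj₂ (d , d<l , v , a , a≢0 , e) = inj₂ (suc d , ℕ.s≤s d<l , inv a * c ∷ v , a , a≢0 , λ x → begin
        c + x * poly cs x ≡⟨ cong₂ (λ c z → c + x * z) (sym (trans (sym (*-assoc a (inv a) c)) (trans (cong (_* c) (inv-r a a≢0)) (*-identityˡ c)))) (e x) ⟩
        a * (inv a * c) + x * (a * eval v x) ≡⟨ solve 4 (λ a b x e → a :* b :+ x :* (a :* e) := a :* (b :+ x :* e)) refl a (inv a * c) x (eval v x) ⟩
        a * (inv a * c + x * eval v x) ∎)
      where open ≡-Reasoning
    ... | inj₁ z with c ≟ 0#
    ...   | yes c≡0 = inj₁ (λ { Fin.zero → c≡0 ; (Fin.suc i) → z i })
    ...   | no c≢0 = inj₂ (0 , ℕ.s≤s ℕ.z≤n , [] , c , c≢0 , λ x → trans (cong (λ w → c + x * w) (poly-0 cs z x))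
              (solve 2 (λ c x → c :+ x :* :0 := c :* :1) refl c x))
      where
      poly-0 : ∀ {l} (cs : Vec F l) → (∀ i → Vec.lookup cs i ≡ 0#) → ∀ x → poly cs x ≡ 0#
      poly-0 [] _ x = refl
      poly-0 (c ∷ cs) z x = trans (cong₂ (λ c w → c + x * w) (z Fin.zero) (poly-0 cs (λ i → z (Fin.suc i)) x))
        (trans (+-identityˡ _) (zeroʳ x))

  module _ {p m : ℕ} (pp : Prime p) (N≡p^m : N ≡ p ℕ.^ m) where
    open Characteristic K {p} {m} pp N≡p^m

    private
      -- Natural coefficients lie in the prime field, which every automorphism fixes; hence
      -- evaluation commutes with automorphisms in `σ-ℕpoly`.
      ℕpoly : ∀ {l} → (Fin l → ℕ) → F → F
      ℕpoly {zero} a x = 0#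
      ℕpoly {suc l} a x = a Fin.zero · 1# + x * ℕpoly (a ∘ Fin.suc) x

      module _ (σ : Automorphism) where
        open Automorphism σ renaming (σ to s)
        open AutomorphismProperties σ using (σ-0)

        σ-·1 : ∀ n → s (n · 1#) ≡ n · 1#
        σ-·1 zero = σ-0
        σ-·1 (suc n) = trans (cong s (·-suc n 1#)) (trans (σ-+ _ _) (trans (cong₂ _+_ σ-1 (σ-·1 n)) (sym (·-suc n 1#))))

        σ-ℕpoly : ∀ {l} (a : Fin l → ℕ) x → s (ℕpoly a x) ≡ ℕpoly a (s x)
        σ-ℕpoly {zero} a x = σ-0
        σ-ℕpoly {suc l} a x = trans (σ-+ _ _) (cong₂ _+_ (σ-·1 (a Fin.zero)) (trans (σ-* _ _) (cong (s x *_) (σ-ℕpoly (a ∘ Fin.suc) x))))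

      difference : ∀ {l} → (Fin l → ℕ) → (Fin l → ℕ) → Vec F l
      difference a b = Vec.tabulate (λ i → a i · 1# + - (b i · 1#))

      poly-difference : ∀ {l} (a b : Fin l → ℕ) x → poly (difference a b) x ≡ ℕpoly a x + - ℕpoly b x
      poly-difference {zero} a b x = sym (-‿inverseʳ 0#)
      poly-difference {suc l} a b x = trans (cong (λ z → (a₀ + - b₀) + x * z) (poly-difference (a ∘ Fin.suc) (b ∘ Fin.suc) x))
        (solve 5 (λ a b x p q → (a :+ :- b) :+ x :* (p :+ :- q) := (a :+ x :* p) :+ :- (b :+ x :* q)) refl
          a₀ b₀ x (ℕpoly (a ∘ Fin.suc) x) (ℕpoly (b ∘ Fin.suc) x))
        where
        a₀ = a Fin.zero · 1#
        b₀ = b Fin.zero · 1#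

      funToFin-cong : ∀ {l k} {f g : Fin l → Fin k} → (∀ i → f i ≡ g i) → Fin.funToFin f ≡ Fin.funToFin g
      funToFin-cong {zero} e = refl
      funToFin-cong {suc l} e = cong₂ Fin.combine (e Fin.zero) (funToFin-cong (e ∘ Fin.suc))

    private
      coeffs : Fin (p ℕ.^ suc m) → Fin (suc m) → ℕ
      coeffs c i = Fin.toℕ (Fin.finToFun {p} {suc m} c i)

    abstract
      -- By the pigeonhole principle two of the p^{m+1} combinations of 1, h, …, h^m with coefficients in
      -- {0, …, p-1} agree, so h is a root of a nonzero polynomial of degree at most m over the prime field.
      conjugates : ∀ h → Σ (List F) λ zs → List.length zs ℕ.≤ m × (∀ σ → Automorphism.σ σ h ∈ zs)
      conjugates h with Fin.pigeonhole {N} {p ℕ.^ suc m} N<p^[1+m] (λ c → Inverse.to enum (ℕpoly (coeffs c) h))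
        where
        N<p^[1+m] : N ℕ.< p ℕ.^ suc m
        N<p^[1+m] = subst (ℕ._< p ℕ.^ suc m) (sym N≡p^m) (ℕ.^-monoʳ-< p (ℕ.nonTrivial⇒n>1 p {{prime⇒nonTrivial pp}}) (ℕ.n<1+n m))
      ... | i , j , i<j , collision with zero-or-monic (difference (coeffs i) (coeffs j))
      ...   | inj₁ z = contradiction (cong Fin.toℕ (trans (sym (Fin.funToFin-finToFin {suc m} {p} i))
                (trans (funToFin-cong same) (Fin.funToFin-finToFin {suc m} {p} j)))) (ℕ.<⇒≢ i<j)
        where
        same : ∀ k → Fin.finToFun {p} {suc m} i k ≡ Fin.finToFun {p} {suc m} j k
        same k = Fin.toℕ-injective (·1-injective (Fin.toℕ<n _) (Fin.toℕ<n _)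
          (x-y≡0⇒x≡y (trans (sym (Vec.lookup∘tabulate (λ k → coeffs i k · 1# + - (coeffs j k · 1#)) k)) (z k))))
      ...   | inj₂ (d , d<1+m , v , c , c≢0 , e) = List.filter (λ x → eval v x ≟ 0#) elements ,
              ℕ.≤-trans (root-bound v _ (filter⁺ _ elements-unique) (all-filter _ elements)) (ℕ.≤-pred d<1+m) ,
              λ σ → ∈-filter⁺ (λ x → eval v x ≟ 0#) (∈-elements _) (root σ)
        where
        root : ∀ σ → eval v (Automorphism.σ σ h) ≡ 0#
        root σ = *≡0 (begin
          c * eval v σh ≡⟨ sym (e σh) ⟩
          poly (difference (coeffs i) (coeffs j)) σh ≡⟨ poly-difference (coeffs i) (coeffs j) σh ⟩
          ℕpoly (coeffs i) σh + - ℕpoly (coeffs j) σh ≡⟨ cong₂ (λ a b → a + - b) (sym (σ-ℕpoly σ (coeffs i) h)) (sym (σ-ℕpoly σ (coeffs j) h)) ⟩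
          s (ℕpoly (coeffs i) h) + - s (ℕpoly (coeffs j) h) ≡⟨ cong (λ z → s z + - s (ℕpoly (coeffs j) h)) same-value ⟩
          s (ℕpoly (coeffs j) h) + - s (ℕpoly (coeffs j) h) ≡⟨ -‿inverseʳ _ ⟩
          0# ∎) c≢0
          where
          open ≡-Reasoning
          s : F → F
          s = Automorphism.σ σ
          σh : F
          σh = s h
          same-value : ℕpoly (coeffs i) h ≡ ℕpoly (coeffs j) h
          same-value = trans (sym (Inverse.strictlyInverseʳ enum _)) (trans (cong (Inverse.from enum) collision) (Inverse.strictlyInverseʳ enum _))

-- Uniqueness of sums of powers of q

module PowerEquations {q : ℕ} (3≤q : 3 ℕ.≤ q) where
  private
    instance
      q-nonZero : ℕ.NonZero q
      q-nonZero = ℕ.>-nonZero (ℕ.<-≤-trans (ℕ.s≤s ℕ.z≤n) 3≤q)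

    1<q : 1 ℕ.< q
    1<q = ℕ.<-≤-trans (ℕ.s≤s (ℕ.s≤s ℕ.z≤n)) 3≤q

    ∣q^[1+a] : ∀ a → q ∣ q ℕ.^ suc a
    ∣q^[1+a] a = divides (q ℕ.^ a) (ℕ.*-comm q _)

    q∤1 : ¬ q ∣ 1
    q∤1 = >⇒∤ 1<q

    q∤2 : ¬ q ∣ 2
    q∤2 = >⇒∤ 3≤q

  q^-injective : ∀ {a b} → q ℕ.^ a ≡ q ℕ.^ b → a ≡ b
  q^-injective {a} {b} e with ℕ.<-cmp a b
  ... | tri< a<b _ _ = contradiction e (ℕ.<⇒≢ (ℕ.^-monoʳ-< q 1<q a<b))
  ... | tri≈ _ eq _ = eq
  ... | tri> _ _ b<a = contradiction (sym e) (ℕ.<⇒≢ (ℕ.^-monoʳ-< q 1<q b<a))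

  -- Divisibility by q detects an exponent 0: the right side is not divisible by q, so one of the
  -- exponents on the left must vanish.
  two-powers : ∀ {a b i} → 0 ℕ.< i → q ℕ.^ a ℕ.+ q ℕ.^ b ≡ 1 ℕ.+ q ℕ.^ i → (a ≡ 0 × b ≡ i) ⊎ (a ≡ i × b ≡ 0)
  two-powers {zero} 0<i e = inj₁ (refl , q^-injective (ℕ.suc-injective e))
  two-powers {suc a} {zero} 0<i e = inj₂ (q^-injective (ℕ.suc-injective (trans (ℕ.+-comm 1 _) e)) , refl)
  two-powers {suc a} {suc b} {suc i} 0<i e = contradiction
    (∣m+n∣m⇒∣n (subst (q ∣_) (trans e (ℕ.+-comm 1 _)) (∣m∣n⇒∣m+n (∣q^[1+a] a) (∣q^[1+a] b))) (∣q^[1+a] i)) q∤1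

  -- An exponent 0 on the left is excluded by divisibility; if both are 0 this uses that q does not
  -- divide 2, whence q ≥ 3. Dividing by q then reduces to `two-powers`.
  two-positive-powers : ∀ {b c j} → 1 ℕ.< j → q ℕ.^ b ℕ.+ q ℕ.^ c ≡ q ℕ.^ 1 ℕ.+ q ℕ.^ j → (b ≡ 1 × c ≡ j) ⊎ (b ≡ j × c ≡ 1)
  two-positive-powers {b} {c} {suc j} (ℕ.s≤s 0<j) e with b | c
  ... | zero | zero = contradiction (subst (q ∣_) (sym e) (∣m∣n⇒∣m+n (∣q^[1+a] 0) (∣q^[1+a] j))) q∤2
  ... | zero | suc c′ = contradiction (∣m+n∣m⇒∣n (subst (q ∣_) (trans (sym e) (ℕ.+-comm 1 _)) (∣m∣n⇒∣m+n (∣q^[1+a] 0) (∣q^[1+a] j))) (∣q^[1+a] c′)) q∤1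
  ... | suc b′ | zero = contradiction (∣m+n∣m⇒∣n (subst (q ∣_) (sym e) (∣m∣n⇒∣m+n (∣q^[1+a] 0) (∣q^[1+a] j))) (∣q^[1+a] b′)) q∤1
  ... | suc b′ | suc c′ with two-powers {b′} {c′} {j} 0<j (ℕ.*-cancelˡ-≡ _ _ q
        (trans (ℕ.*-distribˡ-+ q (q ℕ.^ b′) (q ℕ.^ c′)) (trans e (sym (ℕ.*-distribˡ-+ q 1 (q ℕ.^ j))))))
  ...   | inj₁ (x , y) = inj₁ (cong suc x , cong suc y)
  ...   | inj₂ (x , y) = inj₂ (cong suc x , cong suc y)

  -- Indexed by the permuted triple, so that matching on the permutation identifies all three
  -- exponents at once.
  data Arrangement (u v w : ℕ) : ℕ → ℕ → ℕ → Set where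
    uvw : Arrangement u v w u v w
    uwv : Arrangement u v w u w v
    vuw : Arrangement u v w v u w
    vwu : Arrangement u v w v w u
    wuv : Arrangement u v w w u v
    wvu : Arrangement u v w w v u

  three-powers : ∀ {a b c j} → 1 ℕ.< j → q ℕ.^ a ℕ.+ q ℕ.^ b ℕ.+ q ℕ.^ c ≡ 1 ℕ.+ q ℕ.^ 1 ℕ.+ q ℕ.^ j → Arrangement 0 1 j a b c
  three-powers {zero} {b} {c} 1<j e with two-positive-powers {b} {c} 1<j (ℕ.suc-injective e)
  ... | inj₁ (refl , refl) = uvw
  ... | inj₂ (refl , refl) = uwv
  three-powers {suc a} {zero} {c} 1<j e with two-positive-powers {suc a} {c} 1<j
      (ℕ.suc-injective (trans (cong (ℕ._+ q ℕ.^ c) (ℕ.+-comm 1 (q ℕ.^ suc a))) e))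
  ... | inj₁ (refl , refl) = vuw
  ... | inj₂ (refl , refl) = wuv
  three-powers {suc a} {suc b} {zero} 1<j e with two-positive-powers {suc a} {suc b} 1<j (ℕ.suc-injective (trans (ℕ.+-comm 1 _) e))
  ... | inj₁ (refl , refl) = vwu
  ... | inj₂ (refl , refl) = wvu
  three-powers {suc a} {suc b} {suc c} {suc j} 1<j e = contradiction
    (∣m+n∣m⇒∣n (subst (q ∣_) (trans e (trans (ℕ.+-assoc 1 (q ℕ.^ 1) (q ℕ.^ suc j)) (ℕ.+-comm 1 _)))
      (∣m∣n⇒∣m+n (∣m∣n⇒∣m+n (∣q^[1+a] a) (∣q^[1+a] b)) (∣q^[1+a] c)))
      (∣m∣n⇒∣m+n (∣q^[1+a] 0) (∣q^[1+a] j))) q∤1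

-- Powers of the Frobenius map

module Frobenius {N : ℕ} (K : FiniteField N) {p r n : ℕ} (pp : Prime p) (N≡[p^r]^n : N ≡ (p ℕ.^ r) ℕ.^ n) where
  open FiniteField K
  open FieldProperties K

  q : ℕ
  q = p ℕ.^ r

  open Characteristic K {p} {r ℕ.* n} pp (trans N≡[p^r]^n (ℕ.^-*-assoc p r n)) using (frobenius-+)

  abstract
    -- Kept opaque so that the power q^i is never unfolded: what matters below is that `φ i` is a
    -- field homomorphism and that indices add modulo n.
    φ : ℕ → F → F
    φ i x = x ^ (q ℕ.^ i)

    φ-def : ∀ i x → φ i x ≡ x ^ (q ℕ.^ i)
    φ-def i x = refl

  private
    0<q^ : ∀ i → 0 ℕ.< q ℕ.^ i
    0<q^ i = ℕ.m^n>0 q {{ℕ.m^n≢0 p r {{prime⇒nonZero pp}}}} i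

    p^-+ : ∀ k x y → (x + y) ^ (p ℕ.^ k) ≡ x ^ (p ℕ.^ k) + y ^ (p ℕ.^ k)
    p^-+ zero x y = solve 2 (λ x y → (x :+ y) :* :1 := x :* :1 :+ y :* :1) refl x y
    p^-+ (suc k) x y = begin
      (x + y) ^ (p ℕ.* p ℕ.^ k) ≡⟨ ^-* (x + y) p (p ℕ.^ k) ⟩
      ((x + y) ^ p) ^ (p ℕ.^ k) ≡⟨ cong (_^ (p ℕ.^ k)) (frobenius-+ x y) ⟩
      (x ^ p + y ^ p) ^ (p ℕ.^ k) ≡⟨ p^-+ k (x ^ p) (y ^ p) ⟩
      (x ^ p) ^ (p ℕ.^ k) + (y ^ p) ^ (p ℕ.^ k) ≡⟨ cong₂ _+_ (sym (^-* x p (p ℕ.^ k))) (sym (^-* y p (p ℕ.^ k))) ⟩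
      x ^ (p ℕ.* p ℕ.^ k) + y ^ (p ℕ.* p ℕ.^ k) ∎
      where open ≡-Reasoning

  abstract
    φ-+ : ∀ i x y → φ i (x + y) ≡ φ i x + φ i y
    φ-+ i x y = subst (λ e → (x + y) ^ e ≡ x ^ e + y ^ e) (sym (ℕ.^-*-assoc p r i)) (p^-+ (r ℕ.* i) x y)

    φ-* : ∀ i x y → φ i (x * y) ≡ φ i x * φ i y
    φ-* i x y = *-^ x y (q ℕ.^ i)

    φ-0 : ∀ i → φ i 0# ≡ 0#
    φ-0 i = 0^ (0<q^ i)

    φ-1 : ∀ i → φ i 1# ≡ 1#
    φ-1 i = 1^ (q ℕ.^ i)

    φ-inv : ∀ i x → φ i (inv x) ≡ inv (φ i x)
    φ-inv i x = sym (inv-^ x (q ℕ.^ i))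

    φ-φ : ∀ i j x → φ i (φ j x) ≡ φ (i ℕ.+ j) x
    φ-φ i j x = trans (sym (^-* x (q ℕ.^ j) (q ℕ.^ i))) (cong (x ^_) (trans (ℕ.*-comm (q ℕ.^ j) (q ℕ.^ i)) (sym (ℕ.^-distribˡ-+-* q i j))))

    φ-id : ∀ x → φ 0 x ≡ x
    φ-id = ^-1

    φ-n : ∀ x → φ n x ≡ x
    φ-n x = trans (cong (x ^_) (sym N≡[p^r]^n)) (fermat x)

    φ≢0 : ∀ i {x} → x ≢ 0# → φ i x ≢ 0#
    φ≢0 i = ^≢0 (q ℕ.^ i)

  φ-neg : ∀ i x → φ i (- x) ≡ - φ i x
  φ-neg i x = x-y≡0⇒x≡y (trans (solve 2 (λ a b → a :+ :- (:- b) := a :+ b) refl (φ i (- x)) (φ i x))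
    (trans (sym (φ-+ i (- x) x)) (trans (cong (φ i) (-‿inverseˡ x)) (φ-0 i))))

  φ-+n : ∀ i x → φ (i ℕ.+ n) x ≡ φ i x
  φ-+n i x = trans (sym (φ-φ i n x)) (cong (φ i) (φ-n x))

  φ-+kn : ∀ i k x → φ (i ℕ.+ k ℕ.* n) x ≡ φ i x
  φ-+kn i zero x = cong (λ j → φ j x) (ℕ.+-identityʳ i)
  φ-+kn i (suc k) x = trans (cong (λ j → φ j x) (trans (cong (i ℕ.+_) (ℕ.+-comm n (k ℕ.* n))) (sym (ℕ.+-assoc i (k ℕ.* n) n))))
    (trans (φ-+n (i ℕ.+ k ℕ.* n) x) (φ-+kn i k x))

  φ-% : .{{_ : ℕ.NonZero n}} → ∀ i x → φ i x ≡ φ (i ℕ.% n) x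
  φ-% i x = trans (cong (λ j → φ j x) (m≡m%n+[m/n]*n i n)) (φ-+kn (i ℕ.% n) (i ℕ./ n) x)

  φ-injective : ∀ i {x y} → φ i x ≡ φ i y → x ≡ y
  φ-injective i {x} {y} e = x-y≡0⇒x≡y (decidable-stable (x + - y ≟ 0#) (λ ne → φ≢0 i ne
    (trans (φ-+ i x (- y)) (trans (cong₂ _+_ e (φ-neg i y)) (-‿inverseʳ _)))))

-- Character sums and coefficients of linearized polynomials

module PowerSums {N : ℕ} (K : FiniteField N) {p r n : ℕ} (pp : Prime p) (N≡[p^r]^n : N ≡ (p ℕ.^ r) ℕ.^ n)
                 (3≤q : 3 ℕ.≤ p ℕ.^ r) (0<n : 0 ℕ.< n) where
  open FiniteField K
  open FieldProperties K
  open Polynomials K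
  open Frobenius K {p} {r} {n} pp N≡[p^r]^n public
  open PowerEquations 3≤q

  private
    instance
      n-nonZero : ℕ.NonZero n
      n-nonZero = ℕ.>-nonZero 0<n

    1≤q^ : ∀ i → 1 ℕ.≤ q ℕ.^ i
    1≤q^ i = ℕ.m^n>0 q {{ℕ.>-nonZero (ℕ.<-≤-trans (ℕ.s≤s ℕ.z≤n) 3≤q)}} i

    3q^≤N : ∀ {a} → a ℕ.< n → 3 ℕ.* q ℕ.^ a ℕ.≤ N
    3q^≤N {a} a<n = subst (3 ℕ.* q ℕ.^ a ℕ.≤_) (sym N≡[p^r]^n)
      (ℕ.≤-trans (ℕ.*-monoˡ-≤ (q ℕ.^ a) 3≤q) (ℕ.^-monoʳ-≤ q {{ℕ.>-nonZero (ℕ.<-≤-trans (ℕ.s≤s ℕ.z≤n) 3≤q)}} a<n))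

    -- As q ≥ 3, each power q^a with a < n is at most N / 3.
    three-mono : ∀ {a b c} → a ℕ.< n → b ℕ.< n → c ℕ.< n → q ℕ.^ a ℕ.+ q ℕ.^ b ℕ.+ q ℕ.^ c ℕ.≤ N
    three-mono {a} {b} {c} a<n b<n c<n = ℕ.*-cancelˡ-≤ 3 (subst (ℕ._≤ 3 ℕ.* N) (sym three*) bound)
      where
      bound : 3 ℕ.* q ℕ.^ a ℕ.+ 3 ℕ.* q ℕ.^ b ℕ.+ 3 ℕ.* q ℕ.^ c ℕ.≤ 3 ℕ.* N
      bound = ℕ.≤-trans (ℕ.+-mono-≤ (ℕ.+-mono-≤ (3q^≤N a<n) (3q^≤N b<n)) (3q^≤N c<n))
        (ℕ.≤-reflexive (trans (ℕ.+-assoc N N N) (cong (λ z → N ℕ.+ (N ℕ.+ z)) (sym (ℕ.+-identityʳ N)))))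
      three* : 3 ℕ.* (q ℕ.^ a ℕ.+ q ℕ.^ b ℕ.+ q ℕ.^ c) ≡ 3 ℕ.* q ℕ.^ a ℕ.+ 3 ℕ.* q ℕ.^ b ℕ.+ 3 ℕ.* q ℕ.^ c
      three* = trans (ℕ.*-distribˡ-+ 3 (q ℕ.^ a ℕ.+ q ℕ.^ b) (q ℕ.^ c)) (cong (ℕ._+ 3 ℕ.* q ℕ.^ c) (ℕ.*-distribˡ-+ 3 (q ℕ.^ a) (q ℕ.^ b)))

  private
    -- With d = e₂ - e₁, the equation y^d = 1 has at most d solutions; together with 0 these do not
    -- exhaust K because d + 1 < N.
    separating-ordered : ∀ e₁ e₂ → e₁ ℕ.< e₂ → suc e₂ ℕ.< e₁ ℕ.+ N → ∃[ y ] (y ≢ 0# × y ^ e₁ ≢ y ^ e₂)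
    separating-ordered e₁ e₂ lt l₂ = y , y≢0 , λ e → y∉ (Any.there (∈-^-solutions d (*-cancelˡ (^≢0 e₁ y≢0)
        (trans (sym (^-+ y e₁ d)) (trans (cong (y ^_) (ℕ.m+[n∸m]≡n (ℕ.<⇒≤ lt))) (trans (sym e) (sym (*-identityʳ _))))))))
      where
      d = e₂ ℕ.∸ e₁
      found = exists-∉ (0# ∷ ^-solutions d 1#) (ℕ.≤-<-trans (ℕ.s≤s (length-^-solutions d 1# (ℕ.m<n⇒0<n∸m lt)))
        (ℕ.+-cancelˡ-< e₁ _ _ (subst (ℕ._< e₁ ℕ.+ N) (trans (cong suc (sym (ℕ.m+[n∸m]≡n (ℕ.<⇒≤ lt)))) (sym (ℕ.+-suc e₁ d))) l₂)))
      y = proj₁ found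
      y∉ = proj₂ found
      y≢0 : y ≢ 0#
      y≢0 e = y∉ (Any.here e)

  separating-element : ∀ e₁ e₂ → e₁ ≢ e₂ → suc e₁ ℕ.< e₂ ℕ.+ N → suc e₂ ℕ.< e₁ ℕ.+ N → ∃[ y ] (y ≢ 0# × y ^ e₁ ≢ y ^ e₂)
  separating-element e₁ e₂ ne l₁ l₂ with ℕ.<-cmp e₁ e₂
  ... | tri≈ _ e _ = contradiction e ne
  ... | tri< lt _ _ = separating-ordered e₁ e₂ lt l₂
  ... | tri> _ _ gt with y , y≢0 , e ← separating-ordered e₂ e₁ gt l₁ = y , y≢0 , λ e′ → e (sym e′)

  -- The summand is the indicator of x ≠ 0, since the positive exponent makes it vanish at 0; adding
  -- the indicator of 0 gives the constant 1, whose sum is N · 1 = 0.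
  ∑-character-trivial : ∀ e → - ∑ (λ x → x ^ suc e * inv (x ^ suc e)) ≡ 1#
  ∑-character-trivial e = x-y≡0⇒x≡y (begin
      - S + - 1# ≡⟨ solve 1 (λ s → :- s :+ :- :1 := :- (s :+ :1)) refl S ⟩
      - (S + 1#) ≡⟨ cong (λ z → - (S + z)) (sym one) ⟩
      - (S + ∑ (λ x → ite (x ≟ 0#) 1# 0#)) ≡⟨ cong -_ (sym (∑-+ _ _)) ⟩
      - ∑ (λ x → x ^ suc e * inv (x ^ suc e) + ite (x ≟ 0#) 1# 0#) ≡⟨ cong -_ (∑-cong all-1) ⟩
      - ∑ (λ _ → 1#) ≡⟨ cong -_ (trans (∑-const 1#) (trans (·ᵤ≡· N 1#) N·1≡0)) ⟩
      - 0# ≡⟨ RP.-0#≈0# ⟩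
      0# ∎)
    where
    open ≡-Reasoning
    S = ∑ (λ x → x ^ suc e * inv (x ^ suc e))
    one : ∑ (λ x → ite (x ≟ 0#) 1# 0#) ≡ 1#
    one = trans (∑-single _ 0# (λ x → ite-no (x ≟ 0#))) (ite-yes (0# ≟ 0#) refl)
    all-1 : ∀ x → x ^ suc e * inv (x ^ suc e) + ite (x ≟ 0#) 1# 0# ≡ 1#
    all-1 x with x ≟ 0#
    ... | yes refl = trans (cong (_+ 1#) (trans (cong (_* inv (0# ^ suc e)) (zeroˡ (0# ^ e))) (zeroˡ _))) (+-identityˡ 1#)
    ... | no ne = trans (+-identityʳ _) (inv-r _ (^≢0 (suc e) ne))

  -- Orthogonality: replacing x by y x multiplies the sum by the value of the character at y, which
  -- for a separating y is not 1.
  ∑-character-nontrivial : ∀ e₁ e₂ → e₁ ≢ e₂ → suc e₁ ℕ.< e₂ ℕ.+ N → suc e₂ ℕ.< e₁ ℕ.+ N → ∑ (λ x → x ^ e₁ * inv (x ^ e₂)) ≡ 0#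
  ∑-character-nontrivial e₁ e₂ ne l₁ l₂ with separating-element e₁ e₂ ne l₁ l₂
  ... | y , y≢0 , sep = decidable-stable (S ≟ 0#) (λ S≢0 → sep (χy≡1⇒≡ (*-cancelʳ S≢0 (trans χS≡S (sym (*-identityˡ S))))))
    where
    open ≡-Reasoning
    χ : F → F
    χ x = x ^ e₁ * inv (x ^ e₂)
    S = ∑ χ
    χ-* : ∀ x → χ (y * x) ≡ χ y * χ x
    χ-* x = trans (cong₂ _*_ (*-^ y x e₁) (trans (cong inv (*-^ y x e₂)) (inv-* _ _)))
      (solve 4 (λ a b c d → (a :* b) :* (c :* d) := (a :* c) :* (b :* d)) refl (y ^ e₁) (x ^ e₁) (inv (y ^ e₂)) (inv (x ^ e₂)))
    χS≡S : χ y * S ≡ S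
    χS≡S = trans (∑-*ˡ (χ y) χ) (trans (∑-cong (λ x → sym (χ-* x))) (sym (∑-reindex χ (y *_) (inv y *_)
      (λ x → trans (sym (*-assoc _ _ _)) (trans (cong (_* x) (inv-r y y≢0)) (*-identityˡ x)))
      (λ x → trans (sym (*-assoc _ _ _)) (trans (cong (_* x) (inv-l y y≢0)) (*-identityˡ x))))))
    χy≡1⇒≡ : χ y ≡ 1# → y ^ e₁ ≡ y ^ e₂
    χy≡1⇒≡ e = *-cancelʳ (inv≢0 (^≢0 e₂ y≢0)) (trans e (sym (inv-r _ (^≢0 e₂ y≢0))))

  -- For additive G represented as Σ c_i x^{q^i} (i < n), coef i G is c_i.
  abstract
    coef : ℕ → (F → F) → F
    coef i G = - ∑ (λ x → G x * inv (φ i x))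

    coef-def : ∀ i G → coef i G ≡ - ∑ (λ x → G x * inv (φ i x))
    coef-def i G = refl

    coef-cong : ∀ i {G H} → (∀ x → G x ≡ H x) → coef i G ≡ coef i H
    coef-cong i e = cong -_ (∑-cong (λ x → cong (_* inv (φ i x)) (e x)))

    coef-+ : ∀ i G H → coef i (λ x → G x + H x) ≡ coef i G + coef i H
    coef-+ i G H = trans (cong -_ (trans (∑-cong (λ x → distribʳ _ _ _)) (∑-+ _ _))) (sym (RP.-‿+-comm _ _))

    coef-*ˡ : ∀ i c G → coef i (λ x → c * G x) ≡ c * coef i G
    coef-*ˡ i c G = trans (cong -_ (trans (∑-cong (λ x → *-assoc _ _ _)) (sym (∑-*ˡ c _)))) (RP.-‿distribʳ-* _ _)

    coef-periodic : ∀ i G → coef (i ℕ.+ n) G ≡ coef i G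
    coef-periodic i G = cong -_ (∑-cong (λ x → cong (λ z → G x * inv z) (φ-+n i x)))

    coef-0 : ∀ i {G} → (∀ x → G x ≡ 0#) → coef i G ≡ 0#
    coef-0 i e = trans (cong -_ (trans (∑-cong (λ x → trans (cong (_* inv (φ i x)) (e x)) (zeroˡ _))) ∑-0)) RP.-0#≈0#

    coef-φ∘ : ∀ i j G → coef (i ℕ.+ j) (λ x → φ i (G x)) ≡ φ i (coef j G)
    coef-φ∘ i j G = sym (trans (φ-neg i _) (cong -_ (trans (∑-hom (φ i) (φ-0 i) (φ-+ i) _)
      (∑-cong (λ x → trans (φ-* i _ _) (cong (φ i (G x) *_) (trans (φ-inv i _) (cong inv (φ-φ i j x)))))))))

    φ-surjective : ∀ j x → ∃[ y ] φ j y ≡ x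
    φ-surjective j x = φ (n ℕ.∸ j ℕ.% n) x , trans (φ-% j _) (trans (φ-φ (j ℕ.% n) _ x)
      (trans (cong (λ k → φ k x) (ℕ.m+[n∸m]≡n (ℕ.<⇒≤ (m%n<n j n)))) (φ-n x)))

    coef-∘φ : ∀ i j G → coef (i ℕ.+ j) (λ x → G (φ j x)) ≡ coef i G
    coef-∘φ i j G = cong -_ (trans (∑-cong (λ x → cong (λ z → G (φ j x) * inv z) (sym (φ-φ i j x))))
      (sym (∑-reindex (λ y → G y * inv (φ i y)) (φ j) (λ x → proj₁ (φ-surjective j x))
        (λ x → proj₂ (φ-surjective j x)) (λ x → φ-injective j (proj₂ (φ-surjective j (φ j x)))))))

    -- Reindexing by x ↦ β x when β ≠ 0. For β = 0 the left side sums the constant `G 0#`, hence the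
    -- hypothesis on G.
    coef-∘* : ∀ i β G → G 0# ≡ 0# → coef i (λ x → G (β * x)) ≡ coef i G * φ i β
    coef-∘* i β G G0 with β ≟ 0#
    ... | yes refl = trans (coef-0 i (λ x → trans (cong G (zeroˡ x)) G0)) (sym (trans (cong (coef i G *_) (φ-0 i)) (zeroʳ _)))
    ... | no β≢0 = trans (cong -_ (begin
        ∑ (λ x → G (β * x) * inv (φ i x)) ≡⟨ ∑-cong (λ x → cong (G (β * x) *_) (inv-φ x)) ⟩
        ∑ (λ x → G (β * x) * (inv (φ i (β * x)) * φ i β)) ≡⟨ ∑-cong (λ x → sym (*-assoc _ _ _)) ⟩
        ∑ (λ x → G (β * x) * inv (φ i (β * x)) * φ i β) ≡⟨ sym (∑-*ʳ (φ i β) _) ⟩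
        ∑ (λ x → G (β * x) * inv (φ i (β * x))) * φ i β ≡⟨ cong (_* φ i β) (sym (∑-reindex (λ y → G y * inv (φ i y)) (β *_) (inv β *_)
            (λ x → trans (sym (*-assoc _ _ _)) (trans (cong (_* x) (inv-r β β≢0)) (*-identityˡ x)))
            (λ x → trans (sym (*-assoc _ _ _)) (trans (cong (_* x) (inv-l β β≢0)) (*-identityˡ x))))) ⟩
        ∑ (λ y → G y * inv (φ i y)) * φ i β ∎)) (RP.-‿distribˡ-* _ _)
      where
      open ≡-Reasoning
      inv-φ : ∀ x → inv (φ i x) ≡ inv (φ i (β * x)) * φ i β
      inv-φ x = sym (trans (cong (λ z → inv z * φ i β) (φ-* i β x)) (trans (cong (_* φ i β) (inv-* _ _))
        (trans (solve 3 (λ a b c → (a :* b) :* c := (a :* c) :* b) refl (inv (φ i β)) (inv (φ i x)) (φ i β))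
          (trans (cong (_* inv (φ i x)) (inv-l _ (φ≢0 i β≢0))) (*-identityˡ _)))))

  private
    pair-bound : ∀ {a b} → a ℕ.< n → b ℕ.< n → q ℕ.^ a ℕ.+ q ℕ.^ b ℕ.≤ N
    pair-bound {a} {b} a<n b<n = ℕ.≤-trans (ℕ.m≤m+n _ (q ℕ.^ b)) (three-mono a<n b<n b<n)

    1≤q^-sucpred : ∀ i → ∃[ e ] q ℕ.^ i ≡ suc e
    1≤q^-sucpred i with q ℕ.^ i | 1≤q^ i
    ... | suc e | _ = e , refl

  coef-φ-same : ∀ i → coef i (φ i) ≡ 1#
  coef-φ-same i with 1≤q^-sucpred i
  ... | e , q^i≡ = trans (coef-def i (φ i)) (trans (cong -_ (∑-cong (λ x → cong₂ (λ a b → a * inv b) (eq x) (eq x)))) (∑-character-trivial e))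
    where
    eq : ∀ x → φ i x ≡ x ^ suc e
    eq x = trans (φ-def i x) (cong (x ^_) q^i≡)

  coef-φ-other : ∀ {a i} → a ℕ.< n → i ℕ.< n → a ≢ i → coef i (φ a) ≡ 0#
  coef-φ-other {a} {i} a<n i<n a≢i = trans (coef-def i (φ a)) (trans (cong -_
      (trans (∑-cong (λ x → cong₂ (λ a b → a * inv b) (φ-def a x) (φ-def i x)))
        (∑-character-nontrivial (q ℕ.^ a) (q ℕ.^ i) (λ e → a≢i (q^-injective e)) (bound {a} {i} a<n) (bound {i} {a} i<n)))) RP.-0#≈0#)
    where
    bound : ∀ {a i} → a ℕ.< n → suc (q ℕ.^ a) ℕ.< q ℕ.^ i ℕ.+ N
    bound {a} {i} a<n = ℕ.+-mono-≤ (1≤q^ i) (ℕ.≤-trans (ℕ.≤-trans (ℕ.≤-reflexive (ℕ.+-comm 1 _))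
      (ℕ.+-monoʳ-≤ (q ℕ.^ a) (ℕ.≤-trans (1≤q^ a) (ℕ.m≤m+n _ _)))) (3q^≤N a<n))

  -- The quotient of x^(q^a + q^b) by x^(q^u + q^v), in the factored form in which it arises from
  -- products of linearized monomials.
  character₂ : ℕ → ℕ → ℕ → ℕ → F → F
  character₂ u v a b x = (φ a x * φ b x) * (inv (φ u x) * inv (φ v x))

  character₃ : ℕ → ℕ → ℕ → ℕ → ℕ → ℕ → F → F
  character₃ u v w a b c x = ((φ a x * φ b x) * φ c x) * ((inv (φ u x) * inv (φ v x)) * inv (φ w x))

  private
    φ₂ : ∀ a b x → φ a x * φ b x ≡ x ^ (q ℕ.^ a ℕ.+ q ℕ.^ b)
    φ₂ a b x = trans (cong₂ _*_ (φ-def a x) (φ-def b x)) (sym (^-+ x (q ℕ.^ a) (q ℕ.^ b)))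

    φ₃ : ∀ a b c x → (φ a x * φ b x) * φ c x ≡ x ^ (q ℕ.^ a ℕ.+ q ℕ.^ b ℕ.+ q ℕ.^ c)
    φ₃ a b c x = trans (cong₂ _*_ (φ₂ a b x) (φ-def c x)) (sym (^-+ x (q ℕ.^ a ℕ.+ q ℕ.^ b) (q ℕ.^ c)))

    character₂-^ : ∀ u v a b x → character₂ u v a b x ≡ x ^ (q ℕ.^ a ℕ.+ q ℕ.^ b) * inv (x ^ (q ℕ.^ u ℕ.+ q ℕ.^ v))
    character₂-^ u v a b x = cong₂ _*_ (φ₂ a b x) (trans (sym (inv-* _ _)) (cong inv (φ₂ u v x)))

    character₃-^ : ∀ u v w a b c x → character₃ u v w a b c x ≡
      x ^ (q ℕ.^ a ℕ.+ q ℕ.^ b ℕ.+ q ℕ.^ c) * inv (x ^ (q ℕ.^ u ℕ.+ q ℕ.^ v ℕ.+ q ℕ.^ w))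
    character₃-^ u v w a b c x = cong₂ _*_ (φ₃ a b c x)
      (trans (cong (_* inv (φ w x)) (sym (inv-* _ _))) (trans (sym (inv-* _ _)) (cong inv (φ₃ u v w x))))

    -∑≡1 : ∀ (χ : F → F) e₁ e₂ → 1 ℕ.≤ e₁ → e₁ ≡ e₂ → (∀ x → χ x ≡ x ^ e₁ * inv (x ^ e₂)) → - ∑ χ ≡ 1#
    -∑≡1 χ (suc e) _ _ refl eq = trans (cong -_ (∑-cong eq)) (∑-character-trivial e)

    -∑≡0 : ∀ (χ : F → F) e₁ e₂ → e₁ ≢ e₂ → suc e₁ ℕ.< e₂ ℕ.+ N → suc e₂ ℕ.< e₁ ℕ.+ N → (∀ x → χ x ≡ x ^ e₁ * inv (x ^ e₂)) → - ∑ χ ≡ 0#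
    -∑≡0 χ e₁ e₂ ne l₁ l₂ eq = trans (cong -_ (trans (∑-cong eq) (∑-character-nontrivial e₁ e₂ ne l₁ l₂))) RP.-0#≈0#

  ∑-character₂-trivial : ∀ u v a b → q ℕ.^ a ℕ.+ q ℕ.^ b ≡ q ℕ.^ u ℕ.+ q ℕ.^ v → - ∑ (character₂ u v a b) ≡ 1#
  ∑-character₂-trivial u v a b e = -∑≡1 _ _ _ (ℕ.≤-trans (1≤q^ a) (ℕ.m≤m+n _ _)) e (character₂-^ u v a b)

  ∑-character₂-nontrivial : ∀ u v a b → u ℕ.< n → v ℕ.< n → a ℕ.< n → b ℕ.< n →
    q ℕ.^ a ℕ.+ q ℕ.^ b ≢ q ℕ.^ u ℕ.+ q ℕ.^ v → - ∑ (character₂ u v a b) ≡ 0#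
  ∑-character₂-nontrivial u v a b u<n v<n a<n b<n ne = -∑≡0 _ _ _ ne (bound a b u v a<n b<n) (bound u v a b u<n v<n) (character₂-^ u v a b)
    where
    bound : ∀ a b u v → a ℕ.< n → b ℕ.< n → suc (q ℕ.^ a ℕ.+ q ℕ.^ b) ℕ.< q ℕ.^ u ℕ.+ q ℕ.^ v ℕ.+ N
    bound a b u v a<n b<n = ℕ.+-mono-≤ (ℕ.+-mono-≤ (1≤q^ u) (1≤q^ v)) (pair-bound a<n b<n)

  ∑-character₃-trivial : ∀ u v w a b c → q ℕ.^ a ℕ.+ q ℕ.^ b ℕ.+ q ℕ.^ c ≡ q ℕ.^ u ℕ.+ q ℕ.^ v ℕ.+ q ℕ.^ w → - ∑ (character₃ u v w a b c) ≡ 1#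
  ∑-character₃-trivial u v w a b c e = -∑≡1 _ _ _ (ℕ.≤-trans (1≤q^ c) (ℕ.m≤n+m _ _)) e (character₃-^ u v w a b c)

  ∑-character₃-nontrivial : ∀ u v w a b c → u ℕ.< n → v ℕ.< n → w ℕ.< n → a ℕ.< n → b ℕ.< n → c ℕ.< n →
    q ℕ.^ a ℕ.+ q ℕ.^ b ℕ.+ q ℕ.^ c ≢ q ℕ.^ u ℕ.+ q ℕ.^ v ℕ.+ q ℕ.^ w → - ∑ (character₃ u v w a b c) ≡ 0#
  ∑-character₃-nontrivial u v w a b c u<n v<n w<n a<n b<n c<n ne =
    -∑≡0 _ _ _ ne (bound a b c u v w a<n b<n c<n) (bound u v w a b c u<n v<n w<n) (character₃-^ u v w a b c)
    where
    bound : ∀ a b c u v w → a ℕ.< n → b ℕ.< n → c ℕ.< n → suc (q ℕ.^ a ℕ.+ q ℕ.^ b ℕ.+ q ℕ.^ c) ℕ.< q ℕ.^ u ℕ.+ q ℕ.^ v ℕ.+ q ℕ.^ w ℕ.+ N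
    bound a b c u v w a<n b<n c<n = ℕ.+-mono-≤ (ℕ.≤-trans (ℕ.+-mono-≤ (1≤q^ u) (1≤q^ v)) (ℕ.m≤m+n _ _)) (three-mono a<n b<n c<n)

-- Linearized polynomials

module Linearized {N : ℕ} (K : FiniteField N) {p r n : ℕ} (pp : Prime p) (N≡[p^r]^n : N ≡ (p ℕ.^ r) ℕ.^ n)
                  (3≤q : 3 ℕ.≤ p ℕ.^ r) (0<n : 0 ℕ.< n) where
  open FiniteField K
  open FieldProperties K
  open PowerSums K {p} {r} {n} pp N≡[p^r]^n 3≤q 0<n public
  open PowerEquations 3≤q

  private
    instance
      n-nonZero : ℕ.NonZero n
      n-nonZero = ℕ.>-nonZero 0<n

  -- An inductive predicate on functions rather than a coefficient vector: identities linear in G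
  -- are checked on monomials and extended through `plus`. The equations in the constructors make it
  -- invariant under pointwise equality.
  data Lin : (F → F) → Set where
    mono : ∀ {G} β a → a ℕ.< n → (∀ x → G x ≡ β * φ a x) → Lin G
    plus : ∀ {G H I} → Lin G → Lin H → (∀ x → I x ≡ G x + H x) → Lin I

  lin-cong : ∀ {G H} → Lin G → (∀ x → H x ≡ G x) → Lin H
  lin-cong (mono β a a<n e) e′ = mono β a a<n (λ x → trans (e′ x) (e x))
  lin-cong (plus g h e) e′ = plus g h (λ x → trans (e′ x) (e x))

  lin-mono : ∀ β a → Lin (λ x → β * φ a x)
  lin-mono β a = mono β (a ℕ.% n) (m%n<n a n) (λ x → cong (β *_) (φ-% a x))

  lin-*ˡ : ∀ {G} c → Lin G → Lin (λ x → c * G x)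
  lin-*ˡ c (mono β a a<n e) = mono (c * β) a a<n (λ x → trans (cong (c *_) (e x)) (sym (*-assoc _ _ _)))
  lin-*ˡ c (plus g h e) = plus (lin-*ˡ c g) (lin-*ˡ c h) (λ x → trans (cong (c *_) (e x)) (distribˡ _ _ _))

  lin-+ : ∀ {G H} → Lin G → Lin H → Lin (λ x → G x + H x)
  lin-+ g h = plus g h (λ _ → refl)

  lin-φ : ∀ i {G} → Lin G → Lin (λ x → φ i (G x))
  lin-φ i (mono β a _ e) = lin-cong (lin-mono (φ i β) (i ℕ.+ a))
    (λ x → trans (cong (φ i) (e x)) (trans (φ-* i _ _) (cong (φ i β *_) (φ-φ i a x))))
  lin-φ i (plus g h e) = plus (lin-φ i g) (lin-φ i h) (λ x → trans (cong (φ i) (e x)) (φ-+ i _ _))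

  lin-∘ : ∀ {G H} → Lin G → Lin H → Lin (λ x → G (H x))
  lin-∘ (mono β a _ e) h = lin-cong (lin-*ˡ β (lin-φ a h)) (λ x → e _)
  lin-∘ (plus g₁ g₂ e) h = plus (lin-∘ g₁ h) (lin-∘ g₂ h) (λ x → e _)

  lin-additive : ∀ {G} → Lin G → ∀ x y → G (x + y) ≡ G x + G y
  lin-additive (mono β a _ e) x y = trans (e _) (trans (cong (β *_) (φ-+ a x y)) (trans (distribˡ _ _ _) (sym (cong₂ _+_ (e x) (e y)))))
  lin-additive (plus {G} {H} g h e) x y = trans (e _) (trans (cong₂ _+_ (lin-additive g x y) (lin-additive h x y))
    (trans (solve 4 (λ a b c d → (a :+ b) :+ (c :+ d) := (a :+ c) :+ (b :+ d)) refl (G x) (G y) (H x) (H y)) (sym (cong₂ _+_ (e x) (e y)))))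

  lin-0 : ∀ {G} → Lin G → G 0# ≡ 0#
  lin-0 {G} g = RP.+-cancelʳ (G 0#) _ _ (trans (sym (lin-additive g 0# 0#)) (trans (cong G (+-identityˡ 0#)) (sym (+-identityˡ _))))

  lin-id : Lin (λ x → x)
  lin-id = mono 1# 0 0<n (λ x → sym (trans (*-identityˡ _) (φ-id x)))

  private
    Σ< : ℕ → (ℕ → F) → F
    Σ< zero f = 0#
    Σ< (suc k) f = Σ< k f + f k

    Σ<-cong : ∀ k {f g} → (∀ i → i ℕ.< k → f i ≡ g i) → Σ< k f ≡ Σ< k g
    Σ<-cong zero e = refl
    Σ<-cong (suc k) e = cong₂ _+_ (Σ<-cong k (λ i i<k → e i (ℕ.m<n⇒m<1+n i<k))) (e k (ℕ.n<1+n k))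

    Σ<-0 : ∀ k {f} → (∀ i → i ℕ.< k → f i ≡ 0#) → Σ< k f ≡ 0#
    Σ<-0 zero z = refl
    Σ<-0 (suc k) z = trans (cong₂ _+_ (Σ<-0 k (λ i i<k → z i (ℕ.m<n⇒m<1+n i<k))) (z k (ℕ.n<1+n k))) (+-identityˡ _)

    Σ<-single : ∀ k f a → a ℕ.< k → (∀ i → i ℕ.< k → i ≢ a → f i ≡ 0#) → Σ< k f ≡ f a
    Σ<-single (suc k) f a a<1+k z with a ℕ.≟ k
    ... | yes refl = trans (cong (_+ f k) (Σ<-0 k (λ i i<k → z i (ℕ.m<n⇒m<1+n i<k) (ℕ.<⇒≢ i<k)))) (+-identityˡ _)
    ... | no a≢k = trans (cong₂ _+_ (Σ<-single k f a (ℕ.≤∧≢⇒< (ℕ.≤-pred a<1+k) a≢k) (λ i i<k → z i (ℕ.m<n⇒m<1+n i<k)))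
        (z k (ℕ.n<1+n k) (λ e → a≢k (sym e)))) (+-identityʳ _)

    Σ<-+ : ∀ k f g → Σ< k (λ i → f i + g i) ≡ Σ< k f + Σ< k g
    Σ<-+ zero f g = sym (+-identityˡ _)
    Σ<-+ (suc k) f g = trans (cong (_+ (f k + g k)) (Σ<-+ k f g))
      (solve 4 (λ a b c d → (a :+ b) :+ (c :+ d) := (a :+ c) :+ (b :+ d)) refl (Σ< k f) (Σ< k g) (f k) (g k))

  -- By orthogonality of the monomials `φ a` for a < n with respect to `coef`. Consequently the n
  -- coefficients determine the map, which is `lin-ext`.
  lin-expansion : ∀ {G} → Lin G → ∀ x → G x ≡ Σ< n (λ i → coef i G * φ i x)
  lin-expansion {G} (mono β a a<n e) x = trans (e x) (sym (trans (Σ<-single n (λ i → coef i G * φ i x) a a<n vanish) (cong (_* φ a x) at-a)))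
    where
    coef-G : ∀ i → coef i G ≡ β * coef i (φ a)
    coef-G i = trans (coef-cong i e) (coef-*ˡ i β (φ a))
    at-a : coef a G ≡ β
    at-a = trans (coef-G a) (trans (cong (β *_) (coef-φ-same a)) (*-identityʳ β))
    vanish : ∀ i → i ℕ.< n → i ≢ a → coef i G * φ i x ≡ 0#
    vanish i i<n i≢a = trans (cong (_* φ i x) (trans (coef-G i) (trans (cong (β *_) (coef-φ-other a<n i<n (λ z → i≢a (sym z)))) (zeroʳ β)))) (zeroˡ _)
  lin-expansion {I} (plus {G} {H} g h e) x = trans (e x) (trans (cong₂ _+_ (lin-expansion g x) (lin-expansion h x))
    (trans (sym (Σ<-+ n _ _)) (Σ<-cong n (λ i _ → trans (sym (distribʳ _ _ _)) (cong (_* φ i x) (sym (trans (coef-cong i e) (coef-+ i G H))))))))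

  lin-ext : ∀ {G H} → Lin G → Lin H → (∀ i → i ℕ.< n → coef i G ≡ coef i H) → ∀ x → G x ≡ H x
  lin-ext g h e x = trans (lin-expansion g x) (trans (Σ<-cong n (λ i i<n → cong (_* φ i x) (e i i<n))) (sym (lin-expansion h x)))

  private
    iterate : (F → F) → ℕ → F → F
    iterate u zero x = x
    iterate u (suc k) x = iterate u k (u x)

    lin-iterate : ∀ {u} → Lin u → ∀ k → Lin (iterate u k)
    lin-iterate lu zero = lin-id
    lin-iterate lu (suc k) = lin-∘ (lin-iterate lu k) lu

    iterate-+ : ∀ u k l x → iterate u (k ℕ.+ l) x ≡ iterate u l (iterate u k x)
    iterate-+ u zero l x = refl
    iterate-+ u (suc k) l x = iterate-+ u k l (u x)

    iterate-injective : ∀ u → (∀ {x y} → u x ≡ u y → x ≡ y) → ∀ k {x y} → iterate u k x ≡ iterate u k y → x ≡ y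
    iterate-injective u inj zero e = e
    iterate-injective u inj (suc k) e = inj (iterate-injective u inj k e)

    iterate-comm : ∀ u k x → u (iterate u k x) ≡ iterate u k (u x)
    iterate-comm u zero x = refl
    iterate-comm u (suc k) x = iterate-comm u k (u x)

    -- Numbers a map by its n coefficients, to make the linearized maps finite in number for the
    -- pigeonhole argument of `lin-inverse`.
    code : (F → F) → Fin (N ℕ.^ n)
    code G = Fin.funToFin {n} {N} (λ i → Inverse.to enum (coef (Fin.toℕ i) G))

    code-injective : ∀ {G H} → Lin G → Lin H → code G ≡ code H → ∀ x → G x ≡ H x
    code-injective {G} {H} g h e = lin-ext g h same
      where
      dec : (F → F) → Fin n → Fin N
      dec G i = Inverse.to enum (coef (Fin.toℕ i) G)
      same-code : ∀ i → dec G i ≡ dec H i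
      same-code i = trans (sym (Fin.finToFun-funToFin (dec G) i)) (trans (cong (λ c → Fin.finToFun {N} {n} c i) e) (Fin.finToFun-funToFin (dec H) i))
      same : ∀ i → i ℕ.< n → coef i G ≡ coef i H
      same i i<n = subst (λ k → coef k G ≡ coef k H) (Fin.toℕ-fromℕ< i<n)
        (trans (sym (Inverse.strictlyInverseʳ enum _)) (trans (cong (Inverse.from enum) (same-code (Fin.fromℕ< i<n))) (Inverse.strictlyInverseʳ enum _)))

  -- Only finitely many maps are linearized, so two iterates of u coincide and u⁻¹ is an iterate of u.
  lin-inverse : ∀ {u} → Lin u → (∀ {x y} → u x ≡ u y → x ≡ y) → Σ (F → F) λ v → Lin v × (∀ x → v (u x) ≡ x) × (∀ x → u (v x) ≡ x)
  lin-inverse {u} lu inj with Fin.pigeonhole (ℕ.n<1+n (N ℕ.^ n)) (λ k → code (iterate u (Fin.toℕ k)))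
  ... | i , j , i<j , same = iterate u k , lin-iterate lu k , left , λ x → trans (iterate-comm u k x) (left x)
    where
    open ≡-Reasoning
    k = Fin.toℕ j ℕ.∸ suc (Fin.toℕ i)
    left : ∀ x → iterate u k (u x) ≡ x
    left x = iterate-injective u inj (Fin.toℕ i) (begin
        iterate u (Fin.toℕ i) (iterate u (suc k) x) ≡⟨ sym (iterate-+ u (suc k) (Fin.toℕ i) x) ⟩
        iterate u (suc k ℕ.+ Fin.toℕ i) x ≡⟨ cong (λ l → iterate u l x) (trans (cong suc (ℕ.+-comm k (Fin.toℕ i))) (ℕ.m+[n∸m]≡n i<j)) ⟩
        iterate u (Fin.toℕ j) x ≡⟨ sym (code-injective (lin-iterate lu (Fin.toℕ i)) (lin-iterate lu (Fin.toℕ j)) same x) ⟩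
        iterate u (Fin.toℕ i) x ∎)

-- Power sums of products of linearized polynomials

module PowerSumIdentities {N : ℕ} (K : FiniteField N) {p r n : ℕ} (pp : Prime p) (N≡[p^r]^n : N ≡ (p ℕ.^ r) ℕ.^ n)
                          (3≤q : 3 ℕ.≤ p ℕ.^ r) (0<n : 0 ℕ.< n) where
  open FiniteField K
  open FieldProperties K
  open Linearized K {p} {r} {n} pp N≡[p^r]^n 3≤q 0<n public
  open PowerEquations 3≤q

  private
    δ : ℕ → ℕ → F
    δ a i = coef i (φ a)

    δ-miss : ∀ {a i} → a ℕ.< n → i ℕ.< n → a ≢ i → δ a i ≡ 0#
    δ-miss = coef-φ-other

    δ₂-miss : ∀ {a b i j} → a ℕ.< n → b ℕ.< n → i ℕ.< n → j ℕ.< n → ¬ (a ≡ i × b ≡ j) → δ a i * δ b j ≡ 0#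
    δ₂-miss {a} {b} {i} {j} a<n b<n i<n j<n ne with a ℕ.≟ i
    ... | yes e = trans (cong (δ a i *_) (δ-miss b<n j<n (λ e′ → ne (e , e′)))) (zeroʳ _)
    ... | no a≢i = trans (cong (_* δ b j) (δ-miss a<n i<n a≢i)) (zeroˡ _)

    δ₃-miss : ∀ {a b c i j k} → a ℕ.< n → b ℕ.< n → c ℕ.< n → i ℕ.< n → j ℕ.< n → k ℕ.< n →
              ¬ (a ≡ i × b ≡ j × c ≡ k) → (δ a i * δ b j) * δ c k ≡ 0#
    δ₃-miss {a} {b} {c} {i} {j} {k} a<n b<n c<n i<n j<n k<n ne with c ℕ.≟ k
    ... | yes e = trans (cong (_* δ c k) (δ₂-miss a<n b<n i<n j<n (λ (x , y) → ne (x , y , e)))) (zeroˡ _)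
    ... | no c≢k = trans (cong ((δ a i * δ b j) *_) (δ-miss c<n k<n c≢k)) (zeroʳ _)

    δ₂-hit : ∀ i j → δ i i * δ j j ≡ 1#
    δ₂-hit i j = trans (cong₂ _*_ (coef-φ-same i) (coef-φ-same j)) (*-identityˡ _)

    δ₃-hit : ∀ i j k → (δ i i * δ j j) * δ k k ≡ 1#
    δ₃-hit i j k = trans (cong₂ _*_ (δ₂-hit i j) (coef-φ-same k)) (*-identityˡ _)

  -- The permanent of the matrix of coefficients of G and H at the q-degrees 0 and i. It is the
  -- coefficient of x^(1 + q^i) in G H, each factor supplying one of the two degrees. `perm₃` is the
  -- analogue for the degrees 0, 1, j.
  perm₂ : ℕ → (F → F) → (F → F) → F
  perm₂ i G H = coef 0 G * coef i H + coef i G * coef 0 H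

  perm₃ : ℕ → (F → F) → (F → F) → (F → F) → F
  perm₃ j G H I = ((coef 0 G * coef 1 H) * coef j I + (coef 0 G * coef j H) * coef 1 I)
    + (((coef 1 G * coef 0 H) * coef j I + (coef 1 G * coef j H) * coef 0 I)
      + ((coef j G * coef 0 H) * coef 1 I + (coef j G * coef 1 H) * coef 0 I))

  private
    sum₂ : ℕ → (F → F) → (F → F) → F
    sum₂ i G H = - ∑ (λ x → (G x * H x) * (inv (φ 0 x) * inv (φ i x)))

    sum₃ : ℕ → (F → F) → (F → F) → (F → F) → F
    sum₃ j G H I = - ∑ (λ x → ((G x * H x) * I x) * ((inv (φ 0 x) * inv (φ 1 x)) * inv (φ j x)))

    sum₂-φ : ∀ i a b → 0 ℕ.< i → i ℕ.< n → a ℕ.< n → b ℕ.< n → sum₂ i (φ a) (φ b) ≡ perm₂ i (φ a) (φ b)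
    sum₂-φ i a b 0<i i<n a<n b<n with q ℕ.^ a ℕ.+ q ℕ.^ b ℕ.≟ q ℕ.^ 0 ℕ.+ q ℕ.^ i
    ... | no ne = trans (∑-character₂-nontrivial 0 i a b 0<n i<n a<n b<n ne)
        (sym (trans (cong₂ _+_ (δ₂-miss a<n b<n 0<n i<n (λ { (refl , refl) → ne refl }))
                               (δ₂-miss a<n b<n i<n 0<n (λ { (refl , refl) → ne (ℕ.+-comm (q ℕ.^ i) 1) }))) (+-identityˡ _)))
    ... | yes e with two-powers {a} {b} {i} 0<i e
    ...   | inj₁ (refl , refl) = trans (∑-character₂-trivial 0 i 0 i e)
        (sym (trans (cong₂ _+_ (δ₂-hit 0 i) (δ₂-miss a<n b<n i<n 0<n (λ (x , _) → ℕ.<⇒≢ 0<i x))) (+-identityʳ _)))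
    ...   | inj₂ (refl , refl) = trans (∑-character₂-trivial 0 i i 0 e)
        (sym (trans (cong₂ _+_ (δ₂-miss a<n b<n 0<n i<n (λ (_ , x) → ℕ.<⇒≢ 0<i x)) (δ₂-hit i 0)) (+-identityˡ _)))

    six : ∀ {a b c d e f a′ b′ c′ d′ e′ f′ s} → a ≡ a′ → b ≡ b′ → c ≡ c′ → d ≡ d′ → e ≡ e′ → f ≡ f′ →
          (a′ + b′) + ((c′ + d′) + (e′ + f′)) ≡ s → (a + b) + ((c + d) + (e + f)) ≡ s
    six refl refl refl refl refl refl x = x

    -- On monomials the power sum is 1 if a, b, c are 0, 1, j in some order and 0 otherwise. As 0,
    -- 1, j are distinct, exactly one of the six products in the permanent is then 1; in the other
    -- case none is.
    sum₃-φ : ∀ j a b c → 1 ℕ.< j → j ℕ.< n → a ℕ.< n → b ℕ.< n → c ℕ.< n → sum₃ j (φ a) (φ b) (φ c) ≡ perm₃ j (φ a) (φ b) (φ c)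
    sum₃-φ j a b c 1<j j<n a<n b<n c<n with q ℕ.^ a ℕ.+ q ℕ.^ b ℕ.+ q ℕ.^ c ℕ.≟ q ℕ.^ 0 ℕ.+ q ℕ.^ 1 ℕ.+ q ℕ.^ j
    ... | no ne = trans (∑-character₃-nontrivial 0 1 j a b c 0<n 1<n j<n a<n b<n c<n ne)
        (sym (six (miss 0<n 1<n j<n λ { (refl , refl , refl) → ne refl })
                  (miss 0<n j<n 1<n λ { (refl , refl , refl) → ne (ex 1 Q J) })
                  (miss 1<n 0<n j<n λ { (refl , refl , refl) → ne (cong (ℕ._+ J) (ℕ.+-comm Q 1)) })
                  (miss 1<n j<n 0<n λ { (refl , refl , refl) → ne (trans (ex Q 1 J) (cong (ℕ._+ J) (ℕ.+-comm Q 1))) })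
                  (miss j<n 0<n 1<n λ { (refl , refl , refl) → ne (trans (cong (ℕ._+ Q) (ℕ.+-comm J 1)) (ex 1 Q J)) })
                  (miss j<n 1<n 0<n λ { (refl , refl , refl) → ne (trans (cong (ℕ._+ 1) (ℕ.+-comm J Q)) (trans (ex Q 1 J) (cong (ℕ._+ J) (ℕ.+-comm Q 1)))) })
                  (solve 0 ((:0 :+ :0) :+ ((:0 :+ :0) :+ (:0 :+ :0)) := :0) refl)))
      where
      1<n : 1 ℕ.< n
      1<n = ℕ.<-trans 1<j j<n
      Q J : ℕ
      Q = q ℕ.^ 1
      J = q ℕ.^ j
      ex : ∀ u v w → u ℕ.+ w ℕ.+ v ≡ u ℕ.+ v ℕ.+ w
      ex u v w = trans (ℕ.+-assoc u w v) (trans (cong (u ℕ.+_) (ℕ.+-comm w v)) (sym (ℕ.+-assoc u v w)))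
      miss : ∀ {i k l} → i ℕ.< n → k ℕ.< n → l ℕ.< n → ¬ (a ≡ i × b ≡ k × c ≡ l) → (δ a i * δ b k) * δ c l ≡ 0#
      miss = δ₃-miss a<n b<n c<n
    ... | yes e = trans (∑-character₃-trivial 0 1 j a b c e) (sym (arranged (three-powers {a} {b} {c} {j} 1<j e) a<n b<n c<n))
      where
      1<n : 1 ℕ.< n
      1<n = ℕ.<-trans 1<j j<n
      0≢j : 0 ≢ j
      0≢j = ℕ.<⇒≢ (ℕ.<-trans (ℕ.s≤s ℕ.z≤n) 1<j)
      1≢j : 1 ≢ j
      1≢j = ℕ.<⇒≢ 1<j
      arranged : ∀ {a b c} → Arrangement 0 1 j a b c → a ℕ.< n → b ℕ.< n → c ℕ.< n → perm₃ j (φ a) (φ b) (φ c) ≡ 1#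
      arranged uvw a<n b<n c<n = six (δ₃-hit 0 1 j)
        (δ₃-miss a<n b<n c<n 0<n j<n 1<n (λ (_ , x , _) → 1≢j x)) (δ₃-miss a<n b<n c<n 1<n 0<n j<n (λ ()))
        (δ₃-miss a<n b<n c<n 1<n j<n 0<n (λ ())) (δ₃-miss a<n b<n c<n j<n 0<n 1<n (λ (x , _) → 0≢j x))
        (δ₃-miss a<n b<n c<n j<n 1<n 0<n (λ (x , _) → 0≢j x)) (solve 0 ((:1 :+ :0) :+ ((:0 :+ :0) :+ (:0 :+ :0)) := :1) refl)
      arranged uwv a<n b<n c<n = six (δ₃-miss a<n b<n c<n 0<n 1<n j<n (λ (_ , _ , x) → 1≢j x)) (δ₃-hit 0 j 1)
        (δ₃-miss a<n b<n c<n 1<n 0<n j<n (λ ())) (δ₃-miss a<n b<n c<n 1<n j<n 0<n (λ ()))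
        (δ₃-miss a<n b<n c<n j<n 0<n 1<n (λ (x , _) → 0≢j x)) (δ₃-miss a<n b<n c<n j<n 1<n 0<n (λ (x , _) → 0≢j x))
        (solve 0 ((:0 :+ :1) :+ ((:0 :+ :0) :+ (:0 :+ :0)) := :1) refl)
      arranged vuw a<n b<n c<n = six (δ₃-miss a<n b<n c<n 0<n 1<n j<n (λ ())) (δ₃-miss a<n b<n c<n 0<n j<n 1<n (λ ()))
        (δ₃-hit 1 0 j) (δ₃-miss a<n b<n c<n 1<n j<n 0<n (λ (_ , x , _) → 0≢j x))
        (δ₃-miss a<n b<n c<n j<n 0<n 1<n (λ (x , _) → 1≢j x)) (δ₃-miss a<n b<n c<n j<n 1<n 0<n (λ (x , _) → 1≢j x))
        (solve 0 ((:0 :+ :0) :+ ((:1 :+ :0) :+ (:0 :+ :0)) := :1) refl)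
      arranged vwu a<n b<n c<n = six (δ₃-miss a<n b<n c<n 0<n 1<n j<n (λ ())) (δ₃-miss a<n b<n c<n 0<n j<n 1<n (λ ()))
        (δ₃-miss a<n b<n c<n 1<n 0<n j<n (λ (_ , _ , x) → 0≢j x)) (δ₃-hit 1 j 0)
        (δ₃-miss a<n b<n c<n j<n 0<n 1<n (λ (x , _) → 1≢j x)) (δ₃-miss a<n b<n c<n j<n 1<n 0<n (λ (x , _) → 1≢j x))
        (solve 0 ((:0 :+ :0) :+ ((:0 :+ :1) :+ (:0 :+ :0)) := :1) refl)
      arranged wuv a<n b<n c<n = six (δ₃-miss a<n b<n c<n 0<n 1<n j<n (λ (x , _) → 0≢j (sym x))) (δ₃-miss a<n b<n c<n 0<n j<n 1<n (λ (x , _) → 0≢j (sym x)))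
        (δ₃-miss a<n b<n c<n 1<n 0<n j<n (λ (x , _) → 1≢j (sym x))) (δ₃-miss a<n b<n c<n 1<n j<n 0<n (λ (x , _) → 1≢j (sym x)))
        (δ₃-hit j 0 1) (δ₃-miss a<n b<n c<n j<n 1<n 0<n (λ ()))
        (solve 0 ((:0 :+ :0) :+ ((:0 :+ :0) :+ (:1 :+ :0)) := :1) refl)
      arranged wvu a<n b<n c<n = six (δ₃-miss a<n b<n c<n 0<n 1<n j<n (λ (x , _) → 0≢j (sym x))) (δ₃-miss a<n b<n c<n 0<n j<n 1<n (λ (x , _) → 0≢j (sym x)))
        (δ₃-miss a<n b<n c<n 1<n 0<n j<n (λ (x , _) → 1≢j (sym x))) (δ₃-miss a<n b<n c<n 1<n j<n 0<n (λ (x , _) → 1≢j (sym x)))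
        (δ₃-miss a<n b<n c<n j<n 0<n 1<n (λ ())) (δ₃-hit j 1 0)
        (solve 0 ((:0 :+ :0) :+ ((:0 :+ :0) :+ (:0 :+ :1)) := :1) refl)

    record Functional (Λ : (F → F) → F) : Set where
      field
        Λ-cong : ∀ {G H} → (∀ x → G x ≡ H x) → Λ G ≡ Λ H
        Λ-+ : ∀ G H → Λ (λ x → G x + H x) ≡ Λ G + Λ H
        Λ-* : ∀ c G → Λ (λ x → c * G x) ≡ c * Λ G

    -- Linear functionals are determined by the monomials. Multilinear identities follow by using
    -- this once for each argument, with the others fixed.
    agree : ∀ {Λ M} → Functional Λ → Functional M → (∀ a → a ℕ.< n → Λ (φ a) ≡ M (φ a)) → ∀ {G} → Lin G → Λ G ≡ M G
    agree Λf Mf e (mono β a a<n eq) = trans (Λ-cong Λf eq) (trans (Λ-* Λf β (φ a)) (trans (cong (β *_) (e a a<n)) (sym (trans (Λ-cong Mf eq) (Λ-* Mf β (φ a))))))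
      where open Functional
    agree Λf Mf e (plus {G} {H} g h eq) = trans (Λ-cong Λf eq) (trans (Λ-+ Λf G H) (trans (cong₂ _+_ (agree Λf Mf e g) (agree Λf Mf e h)) (sym (trans (Λ-cong Mf eq) (Λ-+ Mf G H)))))
      where open Functional

    weighted : ∀ (Λ : (F → F) → F) (w : F → F) → (∀ G → Λ G ≡ - ∑ (λ x → G x * w x)) → Functional Λ
    weighted Λ w e = record
      { Λ-cong = λ {G} {H} eq → trans (e G) (trans (cong -_ (∑-cong (λ x → cong (_* w x) (eq x)))) (sym (e H)))
      ; Λ-+ = λ G H → trans (e _) (trans (cong -_ (trans (∑-cong (λ x → distribʳ _ _ _)) (∑-+ _ _))) (trans (sym (RP.-‿+-comm _ _)) (cong₂ _+_ (sym (e G)) (sym (e H)))))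
      ; Λ-* = λ c G → trans (e _) (trans (cong -_ (trans (∑-cong (λ x → *-assoc _ _ _)) (sym (∑-*ˡ c _)))) (trans (RP.-‿distribʳ-* _ _) (cong (c *_) (sym (e G)))))
      }

    functional-coef : ∀ i → Functional (coef i)
    functional-coef i = record { Λ-cong = coef-cong i ; Λ-+ = coef-+ i ; Λ-* = coef-*ˡ i }

    functional-*ʳ : ∀ {Λ} c → Functional Λ → Functional (λ G → Λ G * c)
    functional-*ʳ c f = record { Λ-cong = λ e → cong (_* c) (Λ-cong e)
      ; Λ-+ = λ G H → trans (cong (_* c) (Λ-+ G H)) (distribʳ _ _ _)
      ; Λ-* = λ a G → trans (cong (_* c) (Λ-* a G)) (*-assoc _ _ _) }
      where open Functional f

    functional-*ˡ : ∀ {Λ} c → Functional Λ → Functional (λ G → c * Λ G)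
    functional-*ˡ c f = record { Λ-cong = λ e → cong (c *_) (Λ-cong e)
      ; Λ-+ = λ G H → trans (cong (c *_) (Λ-+ G H)) (distribˡ _ _ _)
      ; Λ-* = λ a G → trans (cong (c *_) (Λ-* a G)) (solve 3 (λ c a g → c :* (a :* g) := a :* (c :* g)) refl c a _) }
      where open Functional f

    functional-+ : ∀ {Λ M} → Functional Λ → Functional M → Functional (λ G → Λ G + M G)
    functional-+ f g = record { Λ-cong = λ e → cong₂ _+_ (Λ-cong f e) (Λ-cong g e)
      ; Λ-+ = λ G H → trans (cong₂ _+_ (Λ-+ f G H) (Λ-+ g G H)) (solve 4 (λ a b c d → (a :+ b) :+ (c :+ d) := (a :+ c) :+ (b :+ d)) refl _ _ _ _)
      ; Λ-* = λ a G → trans (cong₂ _+_ (Λ-* f a G) (Λ-* g a G)) (sym (distribˡ _ _ _)) }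
      where open Functional

  -- Both sides are bilinear, so `sum₂-φ` on pairs of monomials suffices.
  sum₂≡perm₂ : ∀ i → 0 ℕ.< i → i ℕ.< n → ∀ {G H} → Lin G → Lin H → sum₂ i G H ≡ perm₂ i G H
  sum₂≡perm₂ i 0<i i<n {G} {H} lG lH = agree (sum₂ˡ H) (perm₂ˡ H) (λ a a<n → agree (sum₂ʳ (φ a)) (perm₂ʳ (φ a)) (λ b b<n → sum₂-φ i a b 0<i i<n a<n b<n) lH) lG
    where
    W : F → F
    W x = inv (φ 0 x) * inv (φ i x)
    sum₂ˡ : ∀ H → Functional (λ G → sum₂ i G H)
    sum₂ˡ H = weighted _ (λ x → H x * W x) (λ G → cong -_ (∑-cong (λ x → *-assoc _ _ _)))
    sum₂ʳ : ∀ G → Functional (sum₂ i G)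
    sum₂ʳ G = weighted _ (λ x → G x * W x) (λ H → cong -_ (∑-cong (λ x → solve 3 (λ a b c → (a :* b) :* c := b :* (a :* c)) refl (G x) (H x) (W x))))
    perm₂ˡ : ∀ H → Functional (λ G → perm₂ i G H)
    perm₂ˡ H = functional-+ (functional-*ʳ _ (functional-coef 0)) (functional-*ʳ _ (functional-coef i))
    perm₂ʳ : ∀ G → Functional (perm₂ i G)
    perm₂ʳ G = functional-+ (functional-*ˡ _ (functional-coef i)) (functional-*ˡ _ (functional-coef 0))

  sum₃≡perm₃ : ∀ j → 1 ℕ.< j → j ℕ.< n → ∀ {G H I} → Lin G → Lin H → Lin I → sum₃ j G H I ≡ perm₃ j G H I
  sum₃≡perm₃ j 1<j j<n {G} {H} {I} lG lH lI =
    agree (sum₁ H I) (perm₁ H I) (λ a a<n → agree (sum₂′ (φ a) I) (perm₂′ (φ a) I)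
      (λ b b<n → agree (sum₃′ (φ a) (φ b)) (perm₃′ (φ a) (φ b)) (λ c c<n → sum₃-φ j a b c 1<j j<n a<n b<n c<n) lI) lH) lG
    where
    W : F → F
    W x = (inv (φ 0 x) * inv (φ 1 x)) * inv (φ j x)
    fc = functional-coef
    sum₁ : ∀ H I → Functional (λ G → sum₃ j G H I)
    sum₁ H I = weighted _ (λ x → (H x * I x) * W x) (λ G → cong -_ (∑-cong (λ x →
      solve 4 (λ a b c w → ((a :* b) :* c) :* w := a :* ((b :* c) :* w)) refl (G x) (H x) (I x) (W x))))
    sum₂′ : ∀ G I → Functional (λ H → sum₃ j G H I)
    sum₂′ G I = weighted _ (λ x → (G x * I x) * W x) (λ H → cong -_ (∑-cong (λ x →
      solve 4 (λ a b c w → ((a :* b) :* c) :* w := b :* ((a :* c) :* w)) refl (G x) (H x) (I x) (W x))))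
    sum₃′ : ∀ G H → Functional (λ I → sum₃ j G H I)
    sum₃′ G H = weighted _ (λ x → (G x * H x) * W x) (λ I → cong -_ (∑-cong (λ x →
      solve 4 (λ a b c w → ((a :* b) :* c) :* w := c :* ((a :* b) :* w)) refl (G x) (H x) (I x) (W x))))
    perm₁ : ∀ H I → Functional (λ G → perm₃ j G H I)
    perm₁ H I = functional-+ (functional-+ (t 0) (t 0)) (functional-+ (functional-+ (t 1) (t 1)) (functional-+ (t j) (t j)))
      where
      t : ∀ i {b c} → Functional (λ G → (coef i G * b) * c)
      t i = functional-*ʳ _ (functional-*ʳ _ (fc i))
    perm₂′ : ∀ G I → Functional (λ H → perm₃ j G H I)
    perm₂′ G I = functional-+ (functional-+ (t 1) (t j)) (functional-+ (functional-+ (t 0) (t j)) (functional-+ (t 0) (t 1)))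
      where
      t : ∀ i {a c} → Functional (λ G → (a * coef i G) * c)
      t i = functional-*ʳ _ (functional-*ˡ _ (fc i))
    perm₃′ : ∀ G H → Functional (λ I → perm₃ j G H I)
    perm₃′ G H = functional-+ (functional-+ (t j) (t 1)) (functional-+ (functional-+ (t j) (t 0)) (functional-+ (t 1) (t 0)))
      where
      t : ∀ i {a} → Functional (λ I → a * coef i I)
      t i = functional-*ˡ _ (fc i)

-- Maps with the same set of slopes

module Slopes {N : ℕ} (K : FiniteField N) {p r n : ℕ} (pp : Prime p) (N≡[p^r]^n : N ≡ (p ℕ.^ r) ℕ.^ n)
              (3≤q : 3 ℕ.≤ p ℕ.^ r) (0<n : 0 ℕ.< n) where
  open FiniteField K
  open FieldProperties K
  open PowerSumIdentities K {p} {r} {n} pp N≡[p^r]^n 3≤q 0<n public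

  -- slope G 0# is the junk value 0#.
  slope : (F → F) → F → F
  slope G x = G x * inv x

  -- The slope 0 is left out, being also the default value at x = 0. In return, `∑-slopes` sums only
  -- functions Φ with Φ(0) = 0.
  SlopesIn : (F → F) → (F → F) → Set
  SlopesIn G H = ∀ x → slope G x ≢ 0# → ∃[ y ] slope H y ≡ slope G x

  private
    any-F? : {P : F → Set} → (∀ x → Dec (P x)) → Dec (∃[ x ] P x)
    any-F? {P} P? with Fin.any? (λ i → P? (Inverse.from enum i))
    ... | yes (i , Pi) = yes (Inverse.from enum i , Pi)
    ... | no none = no (λ (x , Px) → none (Inverse.to enum x , subst P (sym (Inverse.strictlyInverseʳ enum x)) Px))

    -- Counted in K, hence only modulo p; this makes the value independent of how many x have the
    -- slope.
    multiplicity : (F → F) → F → F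
    multiplicity G s = ∑ (λ x → ite (slope G x ≟ s) 1# 0#)

    -- The x with G x = s x form an additive group; translating the sum of its elements by one of them
    -- shows that its order is 0 in K.
    multiplicity-hit : ∀ {G} → Lin G → ∀ {s} → s ≢ 0# → ∀ x₀ → slope G x₀ ≡ s → multiplicity G s ≡ - 1#
    multiplicity-hit {G} lG {s} s≢0 x₀ e₀ = x-y≡0⇒x≡y (begin
        multiplicity G s + - - 1# ≡⟨ cong (multiplicity G s +_) (trans (RP.-‿involutive 1#) (sym one)) ⟩
        multiplicity G s + ∑ (λ x → ite (x ≟ 0#) 1# 0#) ≡⟨ sym (∑-+ _ _) ⟩
        ∑ (λ x → ite (slope G x ≟ s) 1# 0# + ite (x ≟ 0#) 1# 0#) ≡⟨ ∑-cong split ⟩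
        ∑ w ≡⟨ *≡0 x₀∑w≡0 x₀≢0 ⟩
        0# ∎)
      where
      open ≡-Reasoning
      w : F → F
      w x = ite (G x ≟ s * x) 1# 0#
      one : ∑ (λ x → ite (x ≟ 0#) 1# 0#) ≡ 1#
      one = trans (∑-single _ 0# (λ x → ite-no (x ≟ 0#))) (ite-yes (0# ≟ 0#) refl)
      slope-0 : slope G 0# ≡ 0#
      slope-0 = trans (cong (G 0# *_) inv-0) (zeroʳ _)
      x₀≢0 : x₀ ≢ 0#
      x₀≢0 refl = s≢0 (trans (sym e₀) slope-0)
      split : ∀ x → ite (slope G x ≟ s) 1# 0# + ite (x ≟ 0#) 1# 0# ≡ w x
      split x with x ≟ 0#
      ... | yes refl = trans (cong (_+ 1#) (ite-no (slope G 0# ≟ s) (λ e → s≢0 (trans (sym e) slope-0))))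
              (trans (+-identityˡ 1#) (sym (ite-yes (G 0# ≟ s * 0#) (trans (lin-0 lG) (sym (zeroʳ s))))))
      ... | no x≢0 with G x ≟ s * x
      ...   | yes e = trans (+-identityʳ _) (ite-yes (slope G x ≟ s)
                (trans (cong (_* inv x) e) (trans (*-assoc _ _ _) (trans (cong (s *_) (inv-r x x≢0)) (*-identityʳ s)))))
      ...   | no ne = trans (+-identityʳ _) (ite-no (slope G x ≟ s) (λ e → ne
                (trans (sym (*-identityʳ _)) (trans (cong (G x *_) (sym (inv-l x x≢0))) (trans (sym (*-assoc _ _ _)) (cong (_* x) e))))))
      Gx₀ : G x₀ ≡ s * x₀
      Gx₀ = trans (sym (*-identityʳ _)) (trans (cong (G x₀ *_) (sym (inv-l x₀ x₀≢0))) (trans (sym (*-assoc _ _ _)) (cong (_* x₀) e₀)))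
      w-shift : ∀ x → w (x + x₀) ≡ w x
      w-shift x with G x ≟ s * x
      ... | yes e = ite-yes (G (x + x₀) ≟ s * (x + x₀)) (trans (lin-additive lG x x₀) (trans (cong₂ _+_ e Gx₀) (sym (distribˡ _ _ _))))
      ... | no ne = ite-no (G (x + x₀) ≟ s * (x + x₀)) (λ e → ne (+-cancelʳ (s * x₀)
              (trans (cong (G x +_) (sym Gx₀)) (trans (sym (lin-additive lG x x₀)) (trans e (distribˡ _ _ _))))))
      T : F
      T = ∑ (λ x → x * w x)
      x₀∑w≡0 : x₀ * ∑ w ≡ 0#
      x₀∑w≡0 = sym (RP.+-cancelˡ T _ _ (begin
        T + 0# ≡⟨ +-identityʳ T ⟩
        T ≡⟨ ∑-reindex (λ x → x * w x) (_+ x₀) (_+ - x₀)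
             (λ x → solve 2 (λ x y → (x :+ :- y) :+ y := x) refl x x₀) (λ x → solve 2 (λ x y → (x :+ y) :+ :- y := x) refl x x₀) ⟩
        ∑ (λ x → (x + x₀) * w (x + x₀)) ≡⟨ ∑-cong (λ x → trans (cong ((x + x₀) *_) (w-shift x)) (distribʳ _ _ _)) ⟩
        ∑ (λ x → x * w x + x₀ * w x) ≡⟨ ∑-+ _ _ ⟩
        T + ∑ (λ x → x₀ * w x) ≡⟨ cong (T +_) (sym (∑-*ˡ x₀ w)) ⟩
        T + x₀ * ∑ w ∎))

    multiplicity-miss : ∀ G s → ¬ (∃[ x ] slope G x ≡ s) → multiplicity G s ≡ 0#
    multiplicity-miss G s none = trans (∑-cong (λ x → ite-no (slope G x ≟ s) (λ e → none (x , e)))) ∑-0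

    ∑-by-slope : ∀ (Φ : F → F) G → ∑ (λ x → Φ (slope G x)) ≡ ∑ (λ s → Φ s * multiplicity G s)
    ∑-by-slope Φ G = begin
      ∑ (λ x → Φ (slope G x)) ≡⟨ ∑-cong (λ x → sym (trans (∑-single _ (slope G x) (off x)) (on x))) ⟩
      ∑ (λ x → ∑ (λ s → Φ s * ite (slope G x ≟ s) 1# 0#)) ≡⟨ ∑-swap _ ⟩
      ∑ (λ s → ∑ (λ x → Φ s * ite (slope G x ≟ s) 1# 0#)) ≡⟨ ∑-cong (λ s → sym (∑-*ˡ (Φ s) _)) ⟩
      ∑ (λ s → Φ s * multiplicity G s) ∎
      where
      open ≡-Reasoning
      off : ∀ x s → s ≢ slope G x → Φ s * ite (slope G x ≟ s) 1# 0# ≡ 0#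
      off x s ne = trans (cong (Φ s *_) (ite-no (slope G x ≟ s) (λ e → ne (sym e)))) (zeroʳ _)
      on : ∀ x → Φ (slope G x) * ite (slope G x ≟ slope G x) 1# 0# ≡ Φ (slope G x)
      on x = trans (cong (Φ (slope G x) *_) (ite-yes (slope G x ≟ slope G x) refl)) (*-identityʳ _)

  ∑-slopes : ∀ {G H} → Lin G → Lin H → SlopesIn G H → SlopesIn H G → ∀ Φ → Φ 0# ≡ 0# →
             ∑ (λ x → Φ (slope G x)) ≡ ∑ (λ x → Φ (slope H x))
  ∑-slopes {G} {H} lG lH GH HG Φ Φ0 = trans (∑-by-slope Φ G) (trans (∑-cong same) (sym (∑-by-slope Φ H)))
    where
    same : ∀ s → Φ s * multiplicity G s ≡ Φ s * multiplicity H s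
    same s with s ≟ 0# | any-F? (λ x → slope G x ≟ s) | any-F? (λ x → slope H x ≟ s)
    ... | yes refl | _ | _ = trans (cong (_* multiplicity G 0#) Φ0) (trans (zeroˡ _) (sym (trans (cong (_* multiplicity H 0#) Φ0) (zeroˡ _))))
    ... | no s≢0 | yes (x , e) | yes (y , e′) = cong (Φ s *_) (trans (multiplicity-hit lG s≢0 x e) (sym (multiplicity-hit lH s≢0 y e′)))
    ... | no s≢0 | no ng | no nh = cong (Φ s *_) (trans (multiplicity-miss G s ng) (sym (multiplicity-miss H s nh)))
    ... | no s≢0 | yes (x , refl) | no nh = contradiction (GH x s≢0) nh
    ... | no s≢0 | no ng | yes (y , refl) = contradiction (HG y s≢0) ng

  coef-φ∘′ : ∀ i k {l} G → i ℕ.+ k ≡ l ℕ.+ n → coef l (λ x → φ i (G x)) ≡ φ i (coef k G)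
  coef-φ∘′ i k {l} G e = trans (sym (coef-periodic l _)) (trans (cong (λ m → coef m (λ x → φ i (G x))) (sym e)) (coef-φ∘ i k G))

  module SameSlopes {G H} (lG : Lin G) (lH : Lin H) (GH : SlopesIn G H) (HG : SlopesIn H G) (H₀≡0 : coef 0 H ≡ 0#) where
    open ≡-Reasoning

    private
      moments : ∀ Φ → Φ 0# ≡ 0# → - ∑ (λ x → Φ (slope G x)) ≡ - ∑ (λ x → Φ (slope H x))
      moments Φ Φ0 = cong -_ (∑-slopes lG lH GH HG Φ Φ0)

      coef-0-slope : ∀ G → coef 0 G ≡ - ∑ (slope G)
      coef-0-slope G = trans (coef-def 0 G) (cong -_ (∑-cong (λ x → cong (λ z → G x * inv z) (φ-id x))))

      φ-slope : ∀ i G x → φ i (slope G x) ≡ φ i (G x) * inv (φ i x)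
      φ-slope i G x = trans (φ-* i _ _) (cong (φ i (G x) *_) (φ-inv i x))

      slope-φ₀ : ∀ G x → slope G x ≡ G x * inv (φ 0 x)
      slope-φ₀ G x = cong (λ z → G x * inv z) (sym (φ-id x))

    coef-0≡0 : coef 0 G ≡ 0#
    coef-0≡0 = trans (coef-0-slope G) (trans (moments (λ s → s) refl) (trans (sym (coef-0-slope H)) H₀≡0))

    -- The power sum with exponent 1 + q^i. Since the coefficient at 0 vanishes, one product of the
    -- permanent survives; its second factor is the coefficient of `φ i` ∘ G at 0, which comes from
    -- the degree k = -i of G.
    coef-pair : ∀ i k → 0 ℕ.< i → i ℕ.< n → i ℕ.+ k ≡ n → coef i G * φ i (coef k G) ≡ coef i H * φ i (coef k H)
    coef-pair i k 0<i i<n i+k≡n = trans (sym (perm-pair lG coef-0≡0)) (trans (moments (λ s → s * φ i s) (zeroˡ _)) (perm-pair lH H₀≡0))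
      where
      perm-pair : ∀ {G} → Lin G → coef 0 G ≡ 0# → - ∑ (λ x → slope G x * φ i (slope G x)) ≡ coef i G * φ i (coef k G)
      perm-pair {G} lG G₀≡0 = begin
        - ∑ (λ x → slope G x * φ i (slope G x)) ≡⟨ cong -_ (∑-cong (λ x → trans (cong₂ _*_ (slope-φ₀ G x) (φ-slope i G x))
            (solve 4 (λ a b c d → (a :* b) :* (c :* d) := (a :* c) :* (b :* d)) refl (G x) (inv (φ 0 x)) (φ i (G x)) (inv (φ i x))))) ⟩
        - ∑ (λ x → (G x * φ i (G x)) * (inv (φ 0 x) * inv (φ i x))) ≡⟨ sum₂≡perm₂ i 0<i i<n lG (lin-φ i lG) ⟩
        coef 0 G * coef i (λ x → φ i (G x)) + coef i G * coef 0 (λ x → φ i (G x))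
          ≡⟨ cong₂ _+_ (trans (cong (_* coef i (λ x → φ i (G x))) G₀≡0) (zeroˡ _)) (cong (coef i G *_) (coef-φ∘′ i k G i+k≡n)) ⟩
        0# + coef i G * φ i (coef k G) ≡⟨ +-identityˡ _ ⟩
        coef i G * φ i (coef k G) ∎

    -- The power sum with exponent 1 + q + q^j. Four of the six products contain a conjugate of the
    -- coefficient of G at 0. The indices a, b, c, d stand for j - 1, -j, 1 - j, -1 modulo n.
    coef-triple : ∀ j {a b c d} → 1 ℕ.< j → j ℕ.< n → 1 ℕ.+ a ≡ j → j ℕ.+ b ≡ n → 1 ℕ.+ d ≡ n → j ℕ.+ c ≡ 1 ℕ.+ n →
      (coef 1 G * φ 1 (coef a G)) * φ j (coef b G) + (coef j G * φ 1 (coef d G)) * φ j (coef c G) ≡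
      (coef 1 H * φ 1 (coef a H)) * φ j (coef b H) + (coef j H * φ 1 (coef d H)) * φ j (coef c H)
    coef-triple j {a} {b} {c} {d} 1<j j<n 1+a≡j j+b≡n 1+d≡n j+c≡1+n =
      trans (sym (perm-triple lG coef-0≡0)) (trans (moments (λ s → (s * φ 1 s) * φ j s) (trans (cong (_* φ j 0#) (zeroˡ (φ 1 0#))) (zeroˡ _))) (perm-triple lH H₀≡0))
      where
      perm-triple : ∀ {G} → Lin G → coef 0 G ≡ 0# → - ∑ (λ x → (slope G x * φ 1 (slope G x)) * φ j (slope G x)) ≡
        (coef 1 G * φ 1 (coef a G)) * φ j (coef b G) + (coef j G * φ 1 (coef d G)) * φ j (coef c G)
      perm-triple {G} lG G₀≡0 = begin
        - ∑ (λ x → (slope G x * φ 1 (slope G x)) * φ j (slope G x))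
          ≡⟨ cong -_ (∑-cong (λ x → trans (cong₂ _*_ (cong₂ _*_ (slope-φ₀ G x) (φ-slope 1 G x)) (φ-slope j G x))
            (solve 6 (λ a b c d e f → ((a :* b) :* (c :* d)) :* (e :* f) := ((a :* c) :* e) :* ((b :* d) :* f)) refl
              (G x) (inv (φ 0 x)) (φ 1 (G x)) (inv (φ 1 x)) (φ j (G x)) (inv (φ j x))))) ⟩
        - ∑ (λ x → ((G x * G¹ x) * Gʲ x) * ((inv (φ 0 x) * inv (φ 1 x)) * inv (φ j x)))
          ≡⟨ sum₃≡perm₃ j 1<j j<n lG (lin-φ 1 lG) (lin-φ j lG) ⟩
        perm₃ j G G¹ Gʲ ≡⟨ cong₂ _+_ (cong₂ _+_ (cong (_* coef j Gʲ) (cong (_* coef 1 G¹) G₀≡0)) (cong (_* coef 1 Gʲ) (cong (_* coef j G¹) G₀≡0)))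
            (cong₂ _+_ (cong₂ _+_ (cong ((coef 1 G * coef 0 G¹) *_) Gʲⱼ≡0) refl) (cong₂ _+_ refl (cong (_* coef 0 Gʲ) (cong (coef j G *_) G¹₁≡0)))) ⟩
        ((0# * coef 1 G¹) * coef j Gʲ + (0# * coef j G¹) * coef 1 Gʲ)
          + (((coef 1 G * coef 0 G¹) * 0# + (coef 1 G * coef j G¹) * coef 0 Gʲ) + ((coef j G * coef 0 G¹) * coef 1 Gʲ + (coef j G * 0#) * coef 0 Gʲ))
          ≡⟨ solve 8 (λ a b c d e f g h → ((:0 :* a) :* b :+ (:0 :* c) :* d) :+ (((e :* f) :* :0 :+ (e :* c) :* g) :+ ((h :* f) :* d :+ (h :* :0) :* g))
               := (e :* c) :* g :+ (h :* f) :* d) refl (coef 1 G¹) (coef j Gʲ) (coef j G¹) (coef 1 Gʲ) (coef 1 G) (coef 0 G¹) (coef 0 Gʲ) (coef j G) ⟩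
        (coef 1 G * coef j G¹) * coef 0 Gʲ + (coef j G * coef 0 G¹) * coef 1 Gʲ
          ≡⟨ cong₂ _+_ (cong₂ _*_ (cong (coef 1 G *_) coefj-G¹) (coef-φ∘′ j b G j+b≡n))
                       (cong₂ _*_ (cong (coef j G *_) (coef-φ∘′ 1 d G 1+d≡n)) (coef-φ∘′ j c G j+c≡1+n)) ⟩
        (coef 1 G * φ 1 (coef a G)) * φ j (coef b G) + (coef j G * φ 1 (coef d G)) * φ j (coef c G) ∎
        where
        G¹ Gʲ : F → F
        G¹ x = φ 1 (G x)
        Gʲ x = φ j (G x)
        coefj-G¹ : coef j G¹ ≡ φ 1 (coef a G)
        coefj-G¹ = trans (cong (λ k → coef k G¹) (sym 1+a≡j)) (coef-φ∘ 1 a G)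
        Gʲⱼ≡0 : coef j Gʲ ≡ 0#
        Gʲⱼ≡0 = trans (cong (λ k → coef k Gʲ) (sym (ℕ.+-identityʳ j))) (trans (coef-φ∘ j 0 G) (trans (cong (φ j) G₀≡0) (φ-0 j)))
        G¹₁≡0 : coef 1 G¹ ≡ 0#
        G¹₁≡0 = trans (coef-φ∘ 1 0 G) (trans (cong (φ 1) G₀≡0) (φ-0 1))

-- The relevant q-degrees

module Positions (t′ : ℕ) where
  -- Writing t = 5 + t′ and n with t′ + t′ makes many index identities modulo n hold by computation;
  -- `t+` and `n+` supply others.
  t-2 t-1 t t+1 t+2 2t-2 2t-1 n : ℕ
  t-2 = 3 ℕ.+ t′
  t-1 = 4 ℕ.+ t′
  t = 5 ℕ.+ t′
  t+1 = 6 ℕ.+ t′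
  t+2 = 7 ℕ.+ t′
  2t-2 = 8 ℕ.+ (t′ ℕ.+ t′)
  2t-1 = 9 ℕ.+ (t′ ℕ.+ t′)
  n = 10 ℕ.+ (t′ ℕ.+ t′)

  -- Increasing, so that comparing two degrees reduces to comparing their places in the list, which
  -- is decided by evaluation. For t = 4 the degrees 2 and t - 2 would coincide, and so would t + 2
  -- and 2t - 2: here t > 4 enters.
  positions : Vec ℕ 11
  positions = 0 ∷ 1 ∷ 2 ∷ t-2 ∷ t-1 ∷ t ∷ t+1 ∷ t+2 ∷ 2t-2 ∷ 2t-1 ∷ n ∷ []

  position : Fin 11 → ℕ
  position = Vec.lookup positions

  private
    +t-mono : ∀ {a b} → a ℕ.≤ b → a ℕ.+ t′ ℕ.≤ b ℕ.+ (t′ ℕ.+ t′)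
    +t-mono a≤b = ℕ.+-mono-≤ a≤b (ℕ.m≤m+n t′ t′)

    Ascending : ∀ {k} → Vec ℕ k → Set
    Ascending [] = ⊤
    Ascending (x ∷ []) = ⊤
    Ascending (x ∷ y ∷ ys) = x ℕ.< y × Ascending (y ∷ ys)

    head-< : ∀ {k} x (xs : Vec ℕ k) → Ascending (x ∷ xs) → ∀ i → x ℕ.< Vec.lookup xs i
    head-< x (y ∷ ys) (x<y , _) Fin.zero = x<y
    head-< x (y ∷ ys) (x<y , asc) (Fin.suc i) = ℕ.<-trans x<y (head-< y ys asc i)

    tail-asc : ∀ {k} x (xs : Vec ℕ k) → Ascending (x ∷ xs) → Ascending xs
    tail-asc x [] _ = tt
    tail-asc x (y ∷ ys) (_ , asc) = asc

    lookup-mono : ∀ {k} (xs : Vec ℕ k) → Ascending xs → ∀ {i j} → i Fin.< j → Vec.lookup xs i ℕ.< Vec.lookup xs j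
    lookup-mono (x ∷ xs) asc {Fin.zero} {Fin.suc j} _ = head-< x xs asc j
    lookup-mono (x ∷ xs) asc {Fin.suc i} {Fin.suc j} (ℕ.s≤s i<j) = lookup-mono xs (tail-asc x xs asc) i<j

    ascending : Ascending positions
    ascending = ℕ.≤-refl , ℕ.≤-refl , ℕ.s≤s (ℕ.s≤s (ℕ.s≤s ℕ.z≤n)) , ℕ.≤-refl , ℕ.≤-refl , ℕ.≤-refl , ℕ.≤-refl ,
      +t-mono (from-yes (8 ℕ.≤? 8)) , ℕ.≤-refl , ℕ.≤-refl , tt

  position-< : ∀ i j → {True (i Fin.<? j)} → position i ℕ.< position j
  position-< i j {w} = lookup-mono positions ascending (toWitness w)

  position-≢ : ∀ i j → {False (i Fin.≟ j)} → position i ≢ position j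
  position-≢ i j {w} e with Fin.<-cmp i j
  ... | tri< lt _ _ = ℕ.<⇒≢ (lookup-mono positions ascending lt) e
  ... | tri≈ _ eq _ = toWitnessFalse w eq
  ... | tri> _ _ gt = ℕ.<⇒≢ (lookup-mono positions ascending gt) (sym e)

  pattern 0ᵖ = Fin.zero
  pattern 1ᵖ = Fin.suc 0ᵖ
  pattern 2ᵖ = Fin.suc 1ᵖ
  pattern [t-2] = Fin.suc 2ᵖ
  pattern [t-1] = Fin.suc [t-2]
  pattern [t] = Fin.suc [t-1]
  pattern [t+1] = Fin.suc [t]
  pattern [t+2] = Fin.suc [t+1]
  pattern [2t-2] = Fin.suc [t+2]
  pattern [2t-1] = Fin.suc [2t-2]

  top : Fin 11
  top = Fin.suc [2t-1]

  t+ : ∀ a b → (a ℕ.+ t′) ℕ.+ (b ℕ.+ t′) ≡ (a ℕ.+ b) ℕ.+ (t′ ℕ.+ t′)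
  t+ a b = interchange a t′ b t′
    where open import Algebra.Properties.CommutativeSemigroup ℕ.+-commutativeSemigroup using (interchange)

  n+ : ∀ a → 2t-1 ℕ.+ suc a ≡ a ℕ.+ n
  n+ a = trans (ℕ.+-comm 2t-1 (suc a)) (sym (ℕ.+-suc a 2t-1))

-- The maps ψ_h and comparison of coefficients

module Core {N : ℕ} (K : FiniteField N) {p r t′ : ℕ} (pp : Prime p) (N≡[p^r]^n : N ≡ (p ℕ.^ r) ℕ.^ Positions.n t′)
            (3≤q : 3 ℕ.≤ p ℕ.^ r) (1≢-1 : ¬ (FiniteField.1# K ≡ FiniteField.-_ K (FiniteField.1# K))) where
  open FiniteField K
  open Positions t′
  open FieldProperties K
  open Slopes K {p} {r} {n} pp N≡[p^r]^n 3≤q (ℕ.s≤s ℕ.z≤n) public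

  Admissible′ : F → Set
  Admissible′ h = h * φ t h ≡ - 1#

  -1≢0 : - 1# ≢ 0#
  -1≢0 e = 1≢0 (trans (sym (RP.-‿involutive 1#)) (trans (cong -_ e) RP.-0#≈0#))

  admissible≢0 : ∀ {h} → Admissible′ h → h ≢ 0#
  admissible≢0 adm = *≢0ˡ (λ e → -1≢0 (trans (sym adm) e))

  -- a_ h = - h^{1-q^{t+1}} and b_ h = h^{1-q^{2t-1}}, the two coefficients of ψ_{h,t} that depend on h
  a_ b_ : F → F
  a_ h = - (h * inv (φ t+1 h))
  b_ h = h * inv (φ 2t-1 h)

  four : F → F → F → F → F → F
  four c₁ c₂ c₃ c₄ x = ((c₁ * φ 1 x + c₂ * φ t-1 x) + c₃ * φ t+1 x) + c₄ * φ 2t-1 x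

  f : F → F → F
  f h = four 1# 1# (a_ h) (b_ h)

  -- Up to scaling of argument and value this is the inverse of `f h`; see `f-θ-f⁻-θ`.
  f⁻ : F → F → F
  f⁻ h = four 1# (- 1#) (- (a_ h)) (b_ h)

  four-lin : ∀ c₁ c₂ c₃ c₄ → Lin (four c₁ c₂ c₃ c₄)
  four-lin c₁ c₂ c₃ c₄ = lin-+ (lin-+ (lin-+ (lin-mono c₁ 1) (lin-mono c₂ t-1)) (lin-mono c₃ t+1)) (lin-mono c₄ 2t-1)

  coef-four : ∀ i c₁ c₂ c₃ c₄ → coef i (four c₁ c₂ c₃ c₄) ≡
    ((c₁ * coef i (φ 1) + c₂ * coef i (φ t-1)) + c₃ * coef i (φ t+1)) + c₄ * coef i (φ 2t-1)
  coef-four i c₁ c₂ c₃ c₄ = trans (coef-+ i _ _) (cong₂ _+_ (trans (coef-+ i _ _) (cong₂ _+_ (trans (coef-+ i _ _)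
    (cong₂ _+_ (coef-*ˡ i c₁ (φ 1)) (coef-*ˡ i c₂ (φ t-1)))) (coef-*ˡ i c₃ (φ t+1)))) (coef-*ˡ i c₄ (φ 2t-1)))

  private
    δ-≢ : ∀ i j → {True (i Fin.<? top)} → {True (j Fin.<? top)} → {False (i Fin.≟ j)} → coef (position j) (φ (position i)) ≡ 0#
    δ-≢ i j {w} {w′} {w″} = coef-φ-other (position-< i top {w}) (position-< j top {w′}) (position-≢ i j {w″})

    four-values : ∀ {a b c d a′ b′ c′ d′ s : F} c₁ c₂ c₃ c₄ → a ≡ a′ → b ≡ b′ → c ≡ c′ → d ≡ d′ →
      ((c₁ * a′ + c₂ * b′) + c₃ * c′) + c₄ * d′ ≡ s → ((c₁ * a + c₂ * b) + c₃ * c) + c₄ * d ≡ s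
    four-values c₁ c₂ c₃ c₄ refl refl refl refl e = e

  coef-four-1 : ∀ c₁ c₂ c₃ c₄ → coef 1 (four c₁ c₂ c₃ c₄) ≡ c₁
  coef-four-1 c₁ c₂ c₃ c₄ = trans (coef-four 1 c₁ c₂ c₃ c₄) (four-values c₁ c₂ c₃ c₄ (coef-φ-same 1) (δ-≢ [t-1] 1ᵖ) (δ-≢ [t+1] 1ᵖ) (δ-≢ [2t-1] 1ᵖ)
    (solve 4 (λ a b c d → ((a :* :1 :+ b :* :0) :+ c :* :0) :+ d :* :0 := a) refl c₁ c₂ c₃ c₄))

  coef-four-t-1 : ∀ c₁ c₂ c₃ c₄ → coef t-1 (four c₁ c₂ c₃ c₄) ≡ c₂
  coef-four-t-1 c₁ c₂ c₃ c₄ = trans (coef-four t-1 c₁ c₂ c₃ c₄) (four-values c₁ c₂ c₃ c₄ (δ-≢ 1ᵖ [t-1]) (coef-φ-same t-1) (δ-≢ [t+1] [t-1]) (δ-≢ [2t-1] [t-1])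
    (solve 4 (λ a b c d → ((a :* :0 :+ b :* :1) :+ c :* :0) :+ d :* :0 := b) refl c₁ c₂ c₃ c₄))

  coef-four-t+1 : ∀ c₁ c₂ c₃ c₄ → coef t+1 (four c₁ c₂ c₃ c₄) ≡ c₃
  coef-four-t+1 c₁ c₂ c₃ c₄ = trans (coef-four t+1 c₁ c₂ c₃ c₄) (four-values c₁ c₂ c₃ c₄ (δ-≢ 1ᵖ [t+1]) (δ-≢ [t-1] [t+1]) (coef-φ-same t+1) (δ-≢ [2t-1] [t+1])
    (solve 4 (λ a b c d → ((a :* :0 :+ b :* :0) :+ c :* :1) :+ d :* :0 := c) refl c₁ c₂ c₃ c₄))

  coef-four-2t-1 : ∀ c₁ c₂ c₃ c₄ → coef 2t-1 (four c₁ c₂ c₃ c₄) ≡ c₄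
  coef-four-2t-1 c₁ c₂ c₃ c₄ = trans (coef-four 2t-1 c₁ c₂ c₃ c₄) (four-values c₁ c₂ c₃ c₄ (δ-≢ 1ᵖ [2t-1]) (δ-≢ [t-1] [2t-1]) (δ-≢ [t+1] [2t-1]) (coef-φ-same 2t-1)
    (solve 4 (λ a b c d → ((a :* :0 :+ b :* :0) :+ c :* :0) :+ d :* :1 := d) refl c₁ c₂ c₃ c₄))

  coef-four-other : ∀ i c₁ c₂ c₃ c₄ → {True (i Fin.<? top)} → {False (1ᵖ Fin.≟ i)} → {False ([t-1] Fin.≟ i)} →
    {False ([t+1] Fin.≟ i)} → {False ([2t-1] Fin.≟ i)} → coef (position i) (four c₁ c₂ c₃ c₄) ≡ 0#
  coef-four-other i c₁ c₂ c₃ c₄ {w} {w₁} {w₂} {w₃} {w₄} = trans (coef-four (position i) c₁ c₂ c₃ c₄) (four-values c₁ c₂ c₃ c₄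
    (δ-≢ 1ᵖ i {tt} {w} {w₁}) (δ-≢ [t-1] i {tt} {w} {w₂}) (δ-≢ [t+1] i {tt} {w} {w₃}) (δ-≢ [2t-1] i {tt} {w} {w₄})
    (solve 4 (λ a b c d → ((a :* :0 :+ b :* :0) :+ c :* :0) :+ d :* :0 := :0) refl c₁ c₂ c₃ c₄))

  record Sparse (G : F → F) : Set where
    field
      at-0 : coef 0 G ≡ 0#
      at-2 : coef 2 G ≡ 0#
      at-t-2 : coef t-2 G ≡ 0#
      at-t : coef t G ≡ 0#
      at-t+2 : coef t+2 G ≡ 0#
      at-2t-2 : coef 2t-2 G ≡ 0#

  private
    coef-shift : ∀ {G} → Lin G → ∀ i k {e} β → i ℕ.+ k ≡ e ⊎ i ℕ.+ k ≡ e ℕ.+ n → coef e (λ x → G (β * φ k x)) ≡ coef i G * φ i β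
    coef-shift {G} lG i k {e} β ek = trans (unshift ek) (trans (coef-∘φ i k (λ y → G (β * y))) (coef-∘* i β G (lin-0 lG)))
      where
      unshift : i ℕ.+ k ≡ e ⊎ i ℕ.+ k ≡ e ℕ.+ n → coef e (λ x → G (β * φ k x)) ≡ coef (i ℕ.+ k) (λ x → G (β * φ k x))
      unshift (inj₁ refl) = refl
      unshift (inj₂ eq) = trans (sym (coef-periodic e _)) (cong (λ l → coef l (λ x → G (β * φ k x))) (sym eq))

  -- At degree e the summand G(b f_h(x)) only involves the coefficients of G at e minus 1, t - 1, t
  -- + 1, 2t - 1 modulo n, the indices i₁ to i₄. If these vanish, b drops out; c drops out because e
  -- is not 0.
  coefficient-equation : ∀ {G} → Lin G → ∀ h a b c d → (∀ x → G (a * x + b * f h x) ≡ c * x + d * f h x) →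
    ∀ e {i₁ i₂ i₃ i₄} → {True (Fin.zero {10} Fin.<? e)} → {True (e Fin.<? top)} →
    coef i₁ G ≡ 0# → coef i₂ G ≡ 0# → coef i₃ G ≡ 0# → coef i₄ G ≡ 0# →
    i₁ ℕ.+ 1 ≡ position e ⊎ i₁ ℕ.+ 1 ≡ position e ℕ.+ n →
    i₂ ℕ.+ t-1 ≡ position e ⊎ i₂ ℕ.+ t-1 ≡ position e ℕ.+ n →
    i₃ ℕ.+ t+1 ≡ position e ⊎ i₃ ℕ.+ t+1 ≡ position e ℕ.+ n →
    i₄ ℕ.+ 2t-1 ≡ position e ⊎ i₄ ℕ.+ 2t-1 ≡ position e ℕ.+ n →
    coef (position e) G * φ (position e) a ≡ d * coef (position e) (f h)
  coefficient-equation {G} lG h a b c d Gu≡w e {i₁} {i₂} {i₃} {i₄} {0<e} {e<n} z₁ z₂ z₃ z₄ s₁ s₂ s₃ s₄ = begin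
    coef E G * φ E a ≡⟨ sym (coef-∘* E a G (lin-0 lG)) ⟩
    coef E (λ x → G (a * x)) ≡⟨ solve 1 (λ x → x := x :+ (((:0 :+ :0) :+ :0) :+ :0)) refl _ ⟩
    coef E (λ x → G (a * x)) + (((0# + 0#) + 0#) + 0#)
      ≡⟨ cong (coef E (λ x → G (a * x)) +_) (sym (cong₂ _+_ (cong₂ _+_ (cong₂ _+_ (term i₁ 1 s₁ z₁) (term i₂ t-1 s₂ z₂)) (term i₃ t+1 s₃ z₃)) (term i₄ 2t-1 s₄ z₄))) ⟩
    coef E (λ x → G (a * x)) + (((coef E (T 1# 1) + coef E (T 1# t-1)) + coef E (T (a_ h) t+1)) + coef E (T (b_ h) 2t-1))
      ≡⟨ cong (coef E (λ x → G (a * x)) +_) (sym (trans (coef-+ E _ _) (cong (_+ coef E (T (b_ h) 2t-1)) (trans (coef-+ E _ _) (cong (_+ coef E (T (a_ h) t+1)) (coef-+ E _ _)))))) ⟩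
    coef E (λ x → G (a * x)) + coef E (λ x → ((T 1# 1 x + T 1# t-1 x) + T (a_ h) t+1 x) + T (b_ h) 2t-1 x)
      ≡⟨ sym (coef-+ E _ _) ⟩
    coef E (λ x → G (a * x) + (((T 1# 1 x + T 1# t-1 x) + T (a_ h) t+1 x) + T (b_ h) 2t-1 x))
      ≡⟨ coef-cong E (λ x → trans (sym (expand x)) (Gu≡w x)) ⟩
    coef E (λ x → c * x + d * f h x) ≡⟨ coef-+ E _ _ ⟩
    coef E (λ x → c * x) + coef E (λ x → d * f h x)
      ≡⟨ cong₂ _+_ (trans (coef-*ˡ E c (λ x → x)) (trans (cong (c *_) (trans (coef-cong E (λ x → sym (φ-id x)))
           (coef-φ-other (position-< 0ᵖ top) (position-< e top {e<n}) (ℕ.<⇒≢ (position-< 0ᵖ e {0<e}))))) (zeroʳ c))) (coef-*ˡ E d (f h)) ⟩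
    0# + d * coef E (f h) ≡⟨ +-identityˡ _ ⟩
    d * coef E (f h) ∎
    where
    open ≡-Reasoning
    E : ℕ
    E = position e
    T : F → ℕ → F → F
    T γ k x = G ((b * γ) * φ k x)
    term : ∀ {γ} i k → i ℕ.+ k ≡ E ⊎ i ℕ.+ k ≡ E ℕ.+ n → coef i G ≡ 0# → coef E (T γ k) ≡ 0#
    term {γ} i k s z = trans (coef-shift lG i k (b * γ) s) (trans (cong (_* φ i (b * γ)) z) (zeroˡ _))
    expand : ∀ x → G (a * x + b * f h x) ≡ G (a * x) + (((T 1# 1 x + T 1# t-1 x) + T (a_ h) t+1 x) + T (b_ h) 2t-1 x)
    expand x = trans (lin-additive lG _ _) (cong (G (a * x) +_) (trans (cong G (solve 9
        (λ b u v w z x₁ x₂ x₃ x₄ → b :* (((u :* x₁ :+ v :* x₂) :+ w :* x₃) :+ z :* x₄) :=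
          (((b :* u) :* x₁ :+ (b :* v) :* x₂) :+ (b :* w) :* x₃) :+ (b :* z) :* x₄) refl
        b 1# 1# (a_ h) (b_ h) (φ 1 x) (φ t-1 x) (φ t+1 x) (φ 2t-1 x)))
      (trans (lin-additive lG _ _) (cong (_+ T (b_ h) 2t-1 x) (trans (lin-additive lG _ _) (cong (_+ T (a_ h) t+1 x) (lin-additive lG _ _)))))))

-- The equation for the ratio k / h

module Ratio {N : ℕ} (K : FiniteField N) {p r t′ : ℕ} (pp : Prime p) (N≡[p^r]^n : N ≡ (p ℕ.^ r) ℕ.^ Positions.n t′)
             (3≤q : 3 ℕ.≤ p ℕ.^ r) (1≢-1 : ¬ (FiniteField.1# K ≡ FiniteField.-_ K (FiniteField.1# K))) where
  open FiniteField K
  open Positions t′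
  open FieldProperties K
  open Core K {p} {r} {t′} pp N≡[p^r]^n 3≤q 1≢-1 public

  φφ : ∀ i j k x → i ℕ.+ j ≡ k → φ i (φ j x) ≡ φ k x
  φφ i j k x e = trans (φ-φ i j x) (cong (λ l → φ l x) e)

  φφ-n : ∀ i j k x → i ℕ.+ j ≡ k ℕ.+ n → φ i (φ j x) ≡ φ k x
  φφ-n i j k x e = trans (φφ i j (k ℕ.+ n) x e) (φ-+n k x)

  φφ-id : ∀ i j x → i ℕ.+ j ≡ n → φ i (φ j x) ≡ x
  φφ-id i j x e = trans (φφ-n i j 0 x e) (φ-id x)

  φ-b : ∀ h → φ 1 (b_ h) ≡ φ 1 h * inv h
  φ-b h = trans (φ-* 1 _ _) (cong (φ 1 h *_) (trans (φ-inv 1 _) (cong inv (φφ-id 1 2t-1 h refl))))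

  φ-a : ∀ h → φ t-1 (a_ h) ≡ - (φ t-1 h * inv h)
  φ-a h = trans (φ-neg t-1 _) (cong -_ (trans (φ-* t-1 _ _) (cong (φ t-1 h *_) (trans (φ-inv t-1 _) (cong inv (φφ-id t-1 t+1 h (t+ 4 6)))))))

  neg-injective : ∀ {x y} → - x ≡ - y → x ≡ y
  neg-injective {x} {y} e = trans (sym (RP.-‿involutive x)) (trans (cong -_ e) (RP.-‿involutive y))

  -- With m = k / h and ρ = κ λ the hypotheses read ρ ρ^q m = m^q and ρ ρ^{q^{t-1}} m = m^{q^{t-1}}; the exponents
  -- of ρ are then eliminated using m^{q^t+1} = 1.
  ratio-equation : ∀ {h k} → Admissible′ h → Admissible′ k → ∀ κ λ′ →
    (κ * φ 1 λ′) * φ 1 ((κ * φ 2t-1 λ′) * b_ h) ≡ φ 1 (b_ k) →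
    (κ * φ t-1 λ′) * φ t-1 ((κ * φ t+1 λ′) * a_ h) ≡ φ t-1 (a_ k) →
    let m = k * inv h in (m * m) * (φ 2 m * φ 2 m) ≡ 1#
  ratio-equation {h} {k} adm-h adm-k κ λ′ E₁ E₂ = *-cancelˡ m≢0 (sym (begin
      m * 1# ≡⟨ *-identityʳ m ⟩
      m ≡⟨ sym τρτsρsm ⟩
      (τρ * τsρ) * sm ≡⟨ eq ⟩
      m * ((m * m) * (s²m * s²m)) ∎))
    where
    open ≡-Reasoning
    h≢0 : h ≢ 0#
    h≢0 = admissible≢0 adm-h
    m ρ : F
    m = k * inv h
    ρ = κ * λ′
    sm = φ 1 m
    s²m = φ 2 m
    sρ = φ 1 ρ
    τρ = φ t ρ
    τsρ = φ t+1 ρ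
    mh≡k : m * h ≡ k
    mh≡k = trans (*-assoc _ _ _) (trans (cong (k *_) (inv-l h h≢0)) (*-identityʳ k))
    m≢0 : m ≢ 0#
    m≢0 = *≢0 (admissible≢0 adm-k) (inv≢0 h≢0)
    -- The hypothesis equates ρ ρ^(q^i) with the quotient of k^(q^i - 1) by h^(q^i - 1), which is
    -- m^(q^i - 1).
    cleared : ∀ i → (ρ * φ i ρ) * (φ i h * inv h) ≡ φ i k * inv k → (ρ * φ i ρ) * m ≡ φ i m
    cleared i e = *-cancelʳ (*≢0 (φ≢0 i h≢0) h≢0) (begin
      ((ρ * φ i ρ) * m) * (φ i h * h) ≡⟨ solve 4 (λ a m h′ h → (a :* m) :* (h′ :* h) := (a :* h′) :* (m :* h)) refl (ρ * φ i ρ) m (φ i h) h ⟩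
      ((ρ * φ i ρ) * φ i h) * (m * h) ≡⟨ cong (((ρ * φ i ρ) * φ i h) *_) mh≡k ⟩
      ((ρ * φ i ρ) * φ i h) * k ≡⟨ cong (_* k) (sym (trans (cong (((ρ * φ i ρ) * φ i h) *_) (inv-l h h≢0)) (*-identityʳ _))) ⟩
      (((ρ * φ i ρ) * φ i h) * (inv h * h)) * k ≡⟨ solve 5 (λ a h′ h⁻ h k → ((a :* h′) :* (h⁻ :* h)) :* k := (a :* (h′ :* h⁻)) :* (h :* k)) refl (ρ * φ i ρ) (φ i h) (inv h) h k ⟩
      ((ρ * φ i ρ) * (φ i h * inv h)) * (h * k) ≡⟨ cong (_* (h * k)) e ⟩
      (φ i k * inv k) * (h * k) ≡⟨ solve 4 (λ k′ k⁻ h k → (k′ :* k⁻) :* (h :* k) := (k′ :* h) :* (k⁻ :* k)) refl (φ i k) (inv k) h k ⟩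
      (φ i k * h) * (inv k * k) ≡⟨ trans (cong ((φ i k * h) *_) (inv-l k (admissible≢0 adm-k))) (*-identityʳ _) ⟩
      φ i k * h ≡⟨ cong (_* h) (trans (cong (φ i) (sym mh≡k)) (φ-* i m h)) ⟩
      (φ i m * φ i h) * h ≡⟨ *-assoc _ _ _ ⟩
      φ i m * (φ i h * h) ∎)
    eq₁ : (ρ * sρ) * m ≡ sm
    eq₁ = cleared 1 (begin
      (ρ * sρ) * (φ 1 h * inv h) ≡⟨ cong (λ z → (ρ * z) * (φ 1 h * inv h)) (φ-* 1 κ λ′) ⟩
      ((κ * λ′) * (φ 1 κ * φ 1 λ′)) * (φ 1 h * inv h)
        ≡⟨ solve 5 (λ κ l κ′ l′ b → ((κ :* l) :* (κ′ :* l′)) :* b := (κ :* l′) :* ((κ′ :* l) :* b)) refl κ λ′ (φ 1 κ) (φ 1 λ′) (φ 1 h * inv h) ⟩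
      (κ * φ 1 λ′) * ((φ 1 κ * λ′) * (φ 1 h * inv h)) ≡⟨ cong ((κ * φ 1 λ′) *_) (sym (trans (φ-* 1 _ _) (cong₂ _*_ (trans (φ-* 1 _ _) (cong (φ 1 κ *_) (φφ-id 1 2t-1 λ′ refl))) (φ-b h)))) ⟩
      (κ * φ 1 λ′) * φ 1 ((κ * φ 2t-1 λ′) * b_ h) ≡⟨ trans E₁ (φ-b k) ⟩
      φ 1 k * inv k ∎)
    eq₂ : (ρ * φ t-1 ρ) * m ≡ φ t-1 m
    eq₂ = cleared t-1 (neg-injective (begin
      - ((ρ * φ t-1 ρ) * (φ t-1 h * inv h)) ≡⟨ cong (λ z → - ((ρ * z) * (φ t-1 h * inv h))) (φ-* t-1 κ λ′) ⟩
      - (((κ * λ′) * (φ t-1 κ * φ t-1 λ′)) * (φ t-1 h * inv h))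
        ≡⟨ solve 5 (λ κ l κ′ l′ b → :- (((κ :* l) :* (κ′ :* l′)) :* b) := (κ :* l′) :* ((κ′ :* l) :* (:- b))) refl κ λ′ (φ t-1 κ) (φ t-1 λ′) (φ t-1 h * inv h) ⟩
      (κ * φ t-1 λ′) * ((φ t-1 κ * λ′) * - (φ t-1 h * inv h)) ≡⟨ cong ((κ * φ t-1 λ′) *_) (sym (trans (φ-* t-1 _ _) (cong₂ _*_ (trans (φ-* t-1 _ _) (cong (φ t-1 κ *_) (φφ-id t-1 t+1 λ′ (t+ 4 6)))) (φ-a h)))) ⟩
      (κ * φ t-1 λ′) * φ t-1 ((κ * φ t+1 λ′) * a_ h) ≡⟨ trans E₂ (φ-a k) ⟩
      - (φ t-1 k * inv k) ∎))
    mτm : m * φ t m ≡ 1#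
    mτm = *-cancelʳ -1≢0 (begin
      (m * φ t m) * - 1# ≡⟨ cong ((m * φ t m) *_) (sym adm-h) ⟩
      (m * φ t m) * (h * φ t h) ≡⟨ solve 4 (λ a b c d → (a :* b) :* (c :* d) := (a :* c) :* (b :* d)) refl m (φ t m) h (φ t h) ⟩
      (m * h) * (φ t m * φ t h) ≡⟨ cong₂ _*_ mh≡k (trans (sym (φ-* t m h)) (cong (φ t) mh≡k)) ⟩
      k * φ t k ≡⟨ trans adm-k (sym (*-identityˡ _)) ⟩
      1# * - 1# ∎)
    smτsm : sm * φ t+1 m ≡ 1#
    smτsm = trans (cong (sm *_) (sym (φφ 1 t t+1 m refl))) (trans (sym (φ-* 1 m (φ t m))) (trans (cong (φ 1) mτm) (φ-1 1)))
    -- The q-th power of `eq₂`, whose right side m^(q^t) is the inverse of m by `mτm`.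
    eq₂′ : (sρ * τρ) * (sm * m) ≡ 1#
    eq₂′ = begin
      (sρ * τρ) * (sm * m) ≡⟨ sym (*-assoc _ _ _) ⟩
      ((sρ * τρ) * sm) * m ≡⟨ cong (λ z → ((sρ * z) * sm) * m) (sym (φφ 1 t-1 t ρ refl)) ⟩
      ((sρ * φ 1 (φ t-1 ρ)) * sm) * m ≡⟨ cong (_* m) (sym (trans (φ-* 1 _ _) (cong (_* sm) (φ-* 1 _ _)))) ⟩
      φ 1 ((ρ * φ t-1 ρ) * m) * m ≡⟨ cong (λ z → φ 1 z * m) eq₂ ⟩
      φ 1 (φ t-1 m) * m ≡⟨ cong (_* m) (φφ 1 t-1 t m refl) ⟩
      φ t m * m ≡⟨ trans (*-comm _ _) mτm ⟩
      1# ∎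
    sρ≢0 : sρ ≢ 0#
    sρ≢0 = *≢0ˡ (*≢0ˡ (λ e → 1≢0 (trans (sym eq₂′) e)))
    -- Comparing `eq₁` with `eq₂′` eliminates ρ^q.
    ρ-τρ : ρ ≡ τρ * (sm * sm)
    ρ-τρ = *-cancelʳ (*≢0 sρ≢0 m≢0) (begin
      ρ * (sρ * m) ≡⟨ trans (sym (*-assoc _ _ _)) eq₁ ⟩
      sm ≡⟨ sym (*-identityˡ sm) ⟩
      1# * sm ≡⟨ cong (_* sm) (sym eq₂′) ⟩
      ((sρ * τρ) * (sm * m)) * sm ≡⟨ solve 4 (λ a b c d → ((a :* b) :* (c :* d)) :* c := (b :* (c :* c)) :* (a :* d)) refl sρ τρ sm m ⟩
      (τρ * (sm * sm)) * (sρ * m) ∎)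
    sρ-τsρ : sρ ≡ τsρ * (s²m * s²m)
    sρ-τsρ = trans (cong (φ 1) ρ-τρ) (trans (φ-* 1 _ _) (cong₂ _*_ (φφ 1 t t+1 ρ refl) (trans (φ-* 1 _ _) (cong₂ _*_ (φφ 1 1 2 m refl) (φφ 1 1 2 m refl)))))
    -- The conjugate of `eq₁` under q^t, rewritten with the norm relations for m and m^q.
    τρτsρsm : (τρ * τsρ) * sm ≡ m
    τρτsρsm = begin
      (τρ * τsρ) * sm ≡⟨ solve 2 (λ a b → a :* b := a :* :1 :* b) refl (τρ * τsρ) sm ⟩
      ((τρ * τsρ) * 1#) * sm ≡⟨ cong (λ z → ((τρ * τsρ) * z) * sm) (sym (trans (*-comm _ _) mτm)) ⟩
      ((τρ * τsρ) * (φ t m * m)) * sm ≡⟨ solve 4 (λ a b c d → (a :* (b :* c)) :* d := (a :* b) :* (c :* d)) refl (τρ * τsρ) (φ t m) m sm ⟩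
      ((τρ * τsρ) * φ t m) * (m * sm) ≡⟨ cong (λ z → ((τρ * z) * φ t m) * (m * sm)) (sym (φφ t 1 t+1 ρ (ℕ.+-comm t 1))) ⟩
      ((τρ * φ t sρ) * φ t m) * (m * sm) ≡⟨ cong (_* (m * sm)) (sym (trans (φ-* t _ _) (cong (_* φ t m) (φ-* t _ _)))) ⟩
      φ t ((ρ * sρ) * m) * (m * sm) ≡⟨ cong (λ z → φ t z * (m * sm)) eq₁ ⟩
      φ t sm * (m * sm) ≡⟨ cong (_* (m * sm)) (φφ t 1 t+1 m (ℕ.+-comm t 1)) ⟩
      φ t+1 m * (m * sm) ≡⟨ solve 3 (λ a b c → a :* (b :* c) := b :* (c :* a)) refl (φ t+1 m) m sm ⟩
      m * (sm * φ t+1 m) ≡⟨ trans (cong (m *_) smτsm) (*-identityʳ m) ⟩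
      m ∎
    -- A second evaluation of the product in `τρτsρsm`: the factor m^q is expanded by `eq₁`, and ρ
    -- and ρ^q are replaced through their conjugates, so that the square of the same product
    -- reappears.
    eq : (τρ * τsρ) * sm ≡ m * ((m * m) * (s²m * s²m))
    eq = begin
      (τρ * τsρ) * sm ≡⟨ cong ((τρ * τsρ) *_) (sym eq₁) ⟩
      (τρ * τsρ) * ((ρ * sρ) * m) ≡⟨ cong₂ (λ a b → (τρ * τsρ) * ((a * b) * m)) ρ-τρ sρ-τsρ ⟩
      (τρ * τsρ) * (((τρ * (sm * sm)) * (τsρ * (s²m * s²m))) * m)
        ≡⟨ solve 5 (λ a b c d e → (a :* b) :* (((a :* (c :* c)) :* (b :* (d :* d))) :* e) := e :* ((((a :* b) :* c) :* ((a :* b) :* c)) :* (d :* d))) refl τρ τsρ sm s²m m ⟩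
      m * ((((τρ * τsρ) * sm) * ((τρ * τsρ) * sm)) * (s²m * s²m)) ≡⟨ cong (λ z → m * ((z * z) * (s²m * s²m))) τρτsρsm ⟩
      m * ((m * m) * (s²m * s²m)) ∎

-- The inverse of ψ_h

-- Throughout u = h^{1/q}, D = h^q u - 1 and θ = u / D.
module Inversion {N : ℕ} (K : FiniteField N) {p r t′ : ℕ} (pp : Prime p) (N≡[p^r]^n : N ≡ (p ℕ.^ r) ℕ.^ Positions.n t′)
                 (3≤q : 3 ℕ.≤ p ℕ.^ r) (1≢-1 : ¬ (FiniteField.1# K ≡ FiniteField.-_ K (FiniteField.1# K)))
                 {h : FiniteField.F K} (adm : Core.Admissible′ K {p} {r} {t′} pp N≡[p^r]^n 3≤q 1≢-1 h) where
  open FiniteField K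
  open Positions t′
  open FieldProperties K
  open Ratio K {p} {r} {t′} pp N≡[p^r]^n 3≤q 1≢-1 public

  private
    h≢0 : h ≢ 0#
    h≢0 = admissible≢0 adm

    u w P H₂ D : F
    u = φ 2t-1 h
    w = φ 2t-2 h
    P = φ 1 h
    H₂ = φ 2 h
    D = P * u + - 1#

    u≢0 : u ≢ 0#
    u≢0 = φ≢0 2t-1 h≢0
    w≢0 : w ≢ 0#
    w≢0 = φ≢0 2t-2 h≢0
    P≢0 : P ≢ 0#
    P≢0 = φ≢0 1 h≢0
    H₂≢0 : H₂ ≢ 0#
    H₂≢0 = φ≢0 2 h≢0

    φ1u : φ 1 u ≡ h
    φ1u = φφ-id 1 2t-1 h refl
    φ1P : φ 1 P ≡ H₂
    φ1P = φφ 1 1 2 h refl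
    φ2t-1u : φ 2t-1 u ≡ w
    φ2t-1u = φφ-n 2t-1 2t-1 2t-2 h (n+ 2t-2)
    φ2t-1P : φ 2t-1 P ≡ h
    φ2t-1P = φφ-id 2t-1 1 h (ℕ.+-comm 2t-1 1)

    τ : F → F
    τ = φ t

    conj : ∀ i → φ i h * φ (i ℕ.+ t) h ≡ - 1#
    conj i = trans (cong (φ i h *_) (sym (φ-φ i t h))) (trans (sym (φ-* i h (τ h))) (trans (cong (φ i) adm) (trans (φ-neg i 1#) (cong -_ (φ-1 i)))))

    -inv : ∀ {x y} → x * y ≡ - 1# → y ≡ - inv x
    -inv {x} {y} e = trans (sym (RP.-‿involutive y)) (cong -_ (inv-unique (trans (sym (RP.-‿distribʳ-* x y)) (trans (cong -_ e) (RP.-‿involutive 1#)))))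

    -- Admissibility, conjugated: a shift by t inverts a conjugate of h up to sign. Hence every
    -- conjugate of h met below is expressed by `h`, `u`, `w`, `P`, `H₂` and their inverses.
    φt+ : ∀ i k → k ≡ i ℕ.+ t → φ k h ≡ - inv (φ i h)
    φt+ i k refl = -inv (conj i)

    φth : φ t h ≡ - inv h
    φth = -inv adm
    φt+1h : φ t+1 h ≡ - inv P
    φt+1h = φt+ 1 t+1 refl
    φt+2h : φ t+2 h ≡ - inv H₂
    φt+2h = φt+ 2 t+2 refl
    φt-1h : φ t-1 h ≡ - inv u
    φt-1h = trans (sym (φ-+n t-1 h)) (φt+ 2t-1 (t-1 ℕ.+ n) (sym (n+ t-1)))
    φt-2h : φ t-2 h ≡ - inv w
    φt-2h = trans (sym (φ-+n t-2 h)) (φt+ 2t-2 (t-2 ℕ.+ n) (trans (sym (n+ t-2)) (sym (ℕ.+-suc 2t-2 t-1))))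

  inv-neg : ∀ x → inv (- x) ≡ - inv x
  inv-neg x with x ≟ 0#
  ... | yes refl = trans (cong inv RP.-0#≈0#) (trans inv-0 (sym (trans (cong -_ inv-0) RP.-0#≈0#)))
  ... | no ne = sym (inv-unique (trans (solve 2 (λ x y → (:- x) :* (:- y) := x :* y) refl x (inv x)) (inv-r x ne)))

  inv-inv : ∀ {x} → x ≢ 0# → inv (inv x) ≡ x
  inv-inv {x} ne = sym (inv-unique (inv-l x ne))

  private
    a≡hP : a_ h ≡ h * P
    a≡hP = trans (cong (λ z → - (h * z)) (trans (cong inv φt+1h) (trans (inv-neg _) (cong -_ (inv-inv P≢0)))))
      (solve 2 (λ h P → :- (h :* (:- P)) := h :* P) refl h P)

    f-expand : ∀ x → f h x ≡ ((φ 1 x + φ t-1 x) + (h * P) * φ t+1 x) + (h * inv u) * φ 2t-1 x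
    f-expand x = cong (_+ (h * inv u) * φ 2t-1 x) (cong₂ _+_ (cong₂ _+_ (*-identityˡ _) (*-identityˡ _)) (cong (_* φ t+1 x) a≡hP))

    f⁻-expand : ∀ x → f⁻ h x ≡ ((φ 1 x + - φ t-1 x) + - ((h * P) * φ t+1 x)) + (h * inv u) * φ 2t-1 x
    f⁻-expand x = cong (_+ (h * inv u) * φ 2t-1 x) (cong₂ _+_ (cong₂ _+_ (*-identityˡ _)
      (solve 1 (λ x → (:- :1) :* x := :- x) refl (φ t-1 x)))
      (trans (cong (λ z → (- z) * φ t+1 x) a≡hP) (sym (RP.-‿distribˡ-* _ _))))

    φ-f⁻ : ∀ i {v₁ v₂ v₃ v₄ A B} x → φ i (φ 1 x) ≡ v₁ → φ i (φ t-1 x) ≡ v₂ → φ i (φ t+1 x) ≡ v₃ → φ i (φ 2t-1 x) ≡ v₄ →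
      φ i (h * P) ≡ A → φ i (h * inv u) ≡ B → φ i (f⁻ h x) ≡ ((v₁ + - v₂) + - (A * v₃)) + B * v₄
    φ-f⁻ i x e₁ e₂ e₃ e₄ eA eB = trans (cong (φ i) (f⁻-expand x)) (trans (φ-+ i _ _) (cong₂ _+_
      (trans (φ-+ i _ _) (cong₂ _+_ (trans (φ-+ i _ _) (cong₂ _+_ e₁ (trans (φ-neg i _) (cong -_ e₂))))
        (trans (φ-neg i _) (cong -_ (trans (φ-* i _ _) (cong₂ _*_ eA e₃))))))
      (trans (φ-* i _ _) (cong₂ _*_ eB e₄))))

    φ-hP : ∀ i {x y} → φ i h ≡ x → φ (i ℕ.+ 1) h ≡ y → φ i (h * P) ≡ x * y
    φ-hP i ex ey = trans (φ-* i h P) (cong₂ _*_ ex (trans (φ-φ i 1 h) ey))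

    φ-h/u : ∀ i {x y} → φ i h ≡ x → φ i u ≡ y → φ i (h * inv u) ≡ x * inv y
    φ-h/u i ex ey = trans (φ-* i h (inv u)) (cong₂ _*_ ex (trans (φ-inv i u) (cong inv ey)))

    φ1-f⁻ : ∀ x → φ 1 (f⁻ h x) ≡ ((φ 2 x + - φ t x) + - ((P * H₂) * φ t+2 x)) + (P * inv h) * x
    φ1-f⁻ x = trans (φ-f⁻ 1 x (φφ 1 1 2 x refl) (φφ 1 t-1 t x refl) (φφ 1 t+1 t+2 x refl) (trans (φφ-n 1 2t-1 0 x refl) (φ-id x))
      (φ-hP 1 refl refl) (φ-h/u 1 refl φ1u)) refl

    φt+1-f⁻ : ∀ x → φ t+1 (f⁻ h x) ≡ ((φ t+2 x + - x) + - ((inv P * inv H₂) * φ 2 x)) + (inv P * h) * φ t x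
    φt+1-f⁻ x = trans (φ-f⁻ t+1 x (φφ t+1 1 t+2 x (ℕ.+-comm t+1 1)) (trans (φφ-n t+1 t-1 0 x (t+ 6 4)) (φ-id x))
      (φφ-n t+1 t+1 2 x (t+ 6 6)) (φφ-n t+1 2t-1 t x (trans (ℕ.+-comm t+1 2t-1) (n+ t)))
      (trans (φ-hP t+1 φt+1h (trans (cong (λ k → φ k h) (ℕ.+-comm t+1 1)) φt+2h)) (solve 2 (λ a b → (:- a) :* (:- b) := a :* b) refl (inv P) (inv H₂)))
      (trans (φ-h/u t+1 φt+1h (trans (φφ-n t+1 2t-1 t h (trans (ℕ.+-comm t+1 2t-1) (n+ t))) φth))
        (trans (cong (- inv P *_) (trans (inv-neg _) (cong -_ (inv-inv h≢0)))) (solve 2 (λ a b → (:- a) :* (:- b) := a :* b) refl (inv P) h)))) refl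

    φt-1-f⁻ : ∀ x → φ t-1 (f⁻ h x) ≡ ((φ t x + - φ 2t-2 x) + - ((inv u * inv h) * x)) + (inv u * w) * φ t-2 x
    φt-1-f⁻ x = trans (φ-f⁻ t-1 x (φφ t-1 1 t x (ℕ.+-comm t-1 1)) (φφ t-1 t-1 2t-2 x (t+ 4 4))
      (trans (φφ-n t-1 t+1 0 x (t+ 4 6)) (φ-id x)) (φφ-n t-1 2t-1 t-2 x (trans (ℕ.+-comm t-1 2t-1) (n+ t-2)))
      (trans (φ-hP t-1 φt-1h (trans (cong (λ k → φ k h) (ℕ.+-comm t-1 1)) φth)) (solve 2 (λ a b → (:- a) :* (:- b) := a :* b) refl (inv u) (inv h)))
      (trans (φ-h/u t-1 φt-1h (trans (φφ-n t-1 2t-1 t-2 h (trans (ℕ.+-comm t-1 2t-1) (n+ t-2))) φt-2h))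
        (trans (cong (- inv u *_) (trans (inv-neg _) (cong -_ (inv-inv w≢0)))) (solve 2 (λ a b → (:- a) :* (:- b) := a :* b) refl (inv u) w)))) refl

    φ2t-1-f⁻ : ∀ x → φ 2t-1 (f⁻ h x) ≡ ((x + - φ t-2 x) + - ((u * h) * φ t x)) + (u * inv w) * φ 2t-2 x
    φ2t-1-f⁻ x = trans (φ-f⁻ 2t-1 x (trans (φφ-n 2t-1 1 0 x (n+ 0)) (φ-id x)) (φφ-n 2t-1 t-1 t-2 x (n+ t-2))
      (φφ-n 2t-1 t+1 t x (n+ t)) (φφ-n 2t-1 2t-1 2t-2 x (n+ 2t-2)) (φ-hP 2t-1 refl (trans (cong (λ k → φ k h) (n+ 0)) (φ-n h)))
      (φ-h/u 2t-1 refl φ2t-1u)) refl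

  -- If D = 0 then z - h u z^{q^t} is in the kernel of f_h for every z.
  D≢0 : (∀ {x} → f h x ≡ 0# → x ≡ 0#) → φ 1 h * φ 2t-1 h + - 1# ≢ 0#
  D≢0 f-injective D≡0 = 1≢-1 (begin
      1# ≡⟨ sym hu≡1 ⟩
      h * u ≡⟨ cong (h *_) (trans u≡h (trans (z≡huτz h) (trans (cong (_* τ h) hu≡1) (*-identityˡ _)))) ⟩
      h * τ h ≡⟨ adm ⟩
      - 1# ∎)
    where
    open ≡-Reasoning
    Pu≡1 : P * u ≡ 1#
    Pu≡1 = x-y≡0⇒x≡y D≡0
    hw≡1 : h * w ≡ 1#
    hw≡1 = trans (cong₂ _*_ (sym φ2t-1P) (sym φ2t-1u)) (trans (sym (φ-* 2t-1 P u)) (trans (cong (φ 2t-1) Pu≡1) (φ-1 2t-1)))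
    z≡huτz : ∀ z → z ≡ (h * u) * τ z
    z≡huτz z = x-y≡0⇒x≡y (f-injective (begin
      f h X ≡⟨ f-expand X ⟩
      ((φ 1 X + φ t-1 X) + (h * P) * φ t+1 X) + (h * inv u) * φ 2t-1 X
        ≡⟨ cong₂ _+_ (cong₂ _+_ (cong₂ _+_ (φX 1 φ1hu refl) (φX t-1 φt-1hu refl)) (cong ((h * P) *_) (φX t+1 φt+1hu (sym (φφ-n t+1 t 1 z (t+ 6 5)) )))) (cong ((h * inv u) *_) (φX 2t-1 φ2t-1hu (sym (φφ-n 2t-1 t t-1 z (n+ t-1))))) ⟩
      _ ≡⟨ cong₂ (λ a b → ((((φ 1 z + - ((P * h) * a)) + (φ t-1 z + - ((inv u * inv w) * b)))
             + (h * P) * (φ t+1 z + - ((inv P * inv h) * φ 1 z))) + (h * inv u) * (φ 2t-1 z + - ((u * w) * φ t-1 z)))) (φφ 1 t t+1 z refl) (φφ t-1 t 2t-1 z (t+ 4 5)) ⟩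
      _ ≡⟨ solve 12 (λ h P u w h⁻ P⁻ u⁻ w⁻ z₁ z₂ z₃ z₄ → (((z₁ :+ :- ((P :* h) :* z₃)) :+ (z₂ :+ :- ((u⁻ :* w⁻) :* z₄)))
             :+ (h :* P) :* (z₃ :+ :- ((P⁻ :* h⁻) :* z₁))) :+ (h :* u⁻) :* (z₄ :+ :- ((u :* w) :* z₂))
             := (z₁ :+ :- (((h :* h⁻) :* (P :* P⁻)) :* z₁)) :+ ((z₂ :+ :- (((u :* u⁻) :* (h :* w)) :* z₂)) :+ (:- (w⁻ :* z₄) :+ h :* z₄) :* u⁻)) refl
             h P u w (inv h) (inv P) (inv u) (inv w) (φ 1 z) (φ t-1 z) (φ t+1 z) (φ 2t-1 z) ⟩
      (φ 1 z + - (((h * inv h) * (P * inv P)) * φ 1 z)) + ((φ t-1 z + - (((u * inv u) * (h * w)) * φ t-1 z)) + (- (inv w * φ 2t-1 z) + h * φ 2t-1 z) * inv u)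
        ≡⟨ cong₂ _+_ (cong (λ c → φ 1 z + - (c * φ 1 z)) (trans (cong₂ _*_ (inv-r h h≢0) (inv-r P P≢0)) (*-identityˡ _)))
             (cong₂ _+_ (cong (λ c → φ t-1 z + - (c * φ t-1 z)) (trans (cong₂ _*_ (inv-r u u≢0) hw≡1) (*-identityˡ _)))
               (cong (λ c → (- (c * φ 2t-1 z) + h * φ 2t-1 z) * inv u) (sym (inv-unique (trans (*-comm w h) hw≡1))))) ⟩
      _ ≡⟨ solve 5 (λ a b c h u⁻ → (a :+ :- (:1 :* a)) :+ ((b :+ :- (:1 :* b)) :+ (:- (h :* c) :+ h :* c) :* u⁻) := :0) refl (φ 1 z) (φ t-1 z) (φ 2t-1 z) h (inv u) ⟩
      0# ∎))
      where
      X : F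
      X = z + - ((h * u) * τ z)
      φX : ∀ i {A B} → φ i (h * u) ≡ A → B ≡ φ i (τ z) → φ i X ≡ φ i z + - (A * B)
      φX i eA eB = trans (φ-+ i _ _) (cong (φ i z +_) (trans (φ-neg i _) (cong -_ (trans (φ-* i _ _) (cong₂ _*_ eA (sym eB))))))
      φ1hu : φ 1 (h * u) ≡ P * h
      φ1hu = trans (φ-* 1 h u) (cong (P *_) φ1u)
      φt-1hu : φ t-1 (h * u) ≡ inv u * inv w
      φt-1hu = trans (φ-* t-1 h u) (trans (cong₂ _*_ φt-1h (trans (φφ-n t-1 2t-1 t-2 h (trans (ℕ.+-comm t-1 2t-1) (n+ t-2))) φt-2h))
        (solve 2 (λ a b → (:- a) :* (:- b) := a :* b) refl (inv u) (inv w)))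
      φt+1hu : φ t+1 (h * u) ≡ inv P * inv h
      φt+1hu = trans (φ-* t+1 h u) (trans (cong₂ _*_ φt+1h (trans (φφ-n t+1 2t-1 t h (trans (ℕ.+-comm t+1 2t-1) (n+ t))) φth))
        (solve 2 (λ a b → (:- a) :* (:- b) := a :* b) refl (inv P) (inv h)))
      φ2t-1hu : φ 2t-1 (h * u) ≡ u * w
      φ2t-1hu = trans (φ-* 2t-1 h u) (cong (u *_) φ2t-1u)
    -- Take z = 1. With `Pu≡1` this forces h^q = h, so u = h; then z = h gives h^(q^t) = h, and the
    -- norm of h would be 1 instead of -1.
    hu≡1 : h * u ≡ 1#
    hu≡1 = sym (trans (z≡huτz 1#) (trans (cong ((h * u) *_) (φ-1 t)) (*-identityʳ _)))
    h≡P : h ≡ P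
    h≡P = *-cancelʳ u≢0 (trans hu≡1 (sym Pu≡1))
    u≡h : u ≡ h
    u≡h = φ-injective 1 (trans φ1u h≡P)

  θ : F
  θ = φ 2t-1 h * inv (φ 1 h * φ 2t-1 h + - 1#)

  -- The terms of the outer `f h` are paired by degrees that differ by t: 1 with t + 1, and t - 1
  -- with 2t - 1. In each pair everything except multiples of X and X^(q^t) cancels, and the
  -- multiples of X^(q^t) cancel between the pairs.
  f-θ-f⁻-θ : φ 1 h * φ 2t-1 h + - 1# ≢ 0# → ∀ y → f h (θ * f⁻ h (θ * y)) ≡ - y
  f-θ-f⁻-θ D≢0 y = begin
      f h z ≡⟨ f-expand z ⟩
      ((φ 1 z + φ t-1 z) + (h * P) * φ t+1 z) + (h * inv u) * φ 2t-1 z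
        ≡⟨ solve 6 (λ a b c d k l → ((a :+ b) :+ k :* c) :+ l :* d := (a :+ k :* c) :+ (b :+ l :* d)) refl (φ 1 z) (φ t-1 z) (φ t+1 z) (φ 2t-1 z) (h * P) (h * inv u) ⟩
      (φ 1 z + (h * P) * φ t+1 z) + (φ t-1 z + (h * inv u) * φ 2t-1 z) ≡⟨ cong₂ _+_ part₁ part₂ ⟩
      (- (P * X) + h * Xₜ) + (inv u * X + - (h * Xₜ)) ≡⟨ solve 5 (λ P X h X′ u⁻ → (:- (P :* X) :+ h :* X′) :+ (u⁻ :* X :+ :- (h :* X′)) := (u⁻ :+ :- P) :* X) refl P X h Xₜ (inv u) ⟩
      (inv u + - P) * (θ * y) ≡⟨ cong₂ (λ a b → (a + - b) * (θ * y)) (sym (*-identityʳ _)) (sym (trans (cong (P *_) (inv-r u u≢0)) (*-identityʳ P))) ⟩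
      (inv u * 1# + - (P * (u * inv u))) * (θ * y) ≡⟨ solve 5 (λ u⁻ P u θ y → (u⁻ :* :1 :+ :- (P :* (u :* u⁻))) :* (θ :* y) := :- ((u⁻ :* (θ :* (P :* u :+ :- :1))) :* y)) refl (inv u) P u θ y ⟩
      - ((inv u * (θ * D)) * y) ≡⟨ cong (λ z → - ((inv u * z) * y)) θD ⟩
      - ((inv u * u) * y) ≡⟨ cong -_ (trans (cong (_* y) (inv-l u u≢0)) (*-identityˡ y)) ⟩
      - y ∎
    where
    open ≡-Reasoning
    X z Xₜ : F
    X = θ * y
    z = θ * f⁻ h X
    Xₜ = φ t X
    θD : θ * D ≡ u
    θD = trans (*-assoc _ _ _) (trans (cong (u *_) (inv-l D D≢0)) (*-identityʳ u))
    φD : ∀ i {a b} → φ i P ≡ a → φ i u ≡ b → φ i D ≡ a * b + - 1#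
    φD i ea eb = trans (φ-+ i _ _) (cong₂ _+_ (trans (φ-* i P u) (cong₂ _*_ ea eb)) (trans (φ-neg i 1#) (cong -_ (φ-1 i))))
    φθD : ∀ i {a b c} → φ i P ≡ a → φ i u ≡ b → φ i u ≡ c → φ i θ * (a * b + - 1#) ≡ c
    φθD i ea eb ec = trans (cong (φ i θ *_) (sym (φD i ea eb))) (trans (sym (φ-* i θ D)) (trans (cong (φ i) θD) ec))
    -- Follows from the fact that the conjugate of `D` under q^t is -D / (P u). Its conjugates make
    -- the scalars of the two terms in each pair proportional.
    τθu : τ θ * u ≡ θ * P
    τθu = *-cancelʳ D≢0 (begin
      (τ θ * u) * D ≡⟨ cong ((τ θ * u) *_) D-τD ⟩
      (τ θ * u) * - ((P * u) * τD) ≡⟨ solve 4 (λ θ′ u P d → (θ′ :* u) :* (:- ((P :* u) :* d)) := :- ((u :* (P :* u)) :* (θ′ :* d))) refl (τ θ) u P τD ⟩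
      - ((u * (P * u)) * (τ θ * τD)) ≡⟨ cong (λ z → - ((u * (P * u)) * z)) τθτD ⟩
      - ((u * (P * u)) * - inv u) ≡⟨ solve 3 (λ u P u⁻ → :- ((u :* (P :* u)) :* (:- u⁻)) := (u :* P) :* (u :* u⁻)) refl u P (inv u) ⟩
      (u * P) * (u * inv u) ≡⟨ trans (cong ((u * P) *_) (inv-r u u≢0)) (*-identityʳ _) ⟩
      u * P ≡⟨ cong (_* P) (sym θD) ⟩
      (θ * D) * P ≡⟨ solve 3 (λ a b c → (a :* b) :* c := (a :* c) :* b) refl θ D P ⟩
      (θ * P) * D ∎)
      where
      τD : F
      τD = inv P * inv u + - 1#
      τu : τ u ≡ - inv u
      τu = trans (φφ-n t 2t-1 t-1 h (trans (ℕ.+-comm t 2t-1) (n+ t-1))) φt-1h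
      τθτD : τ θ * τD ≡ - inv u
      τθτD = trans (cong (λ z → τ θ * (z + - 1#)) (solve 2 (λ a b → a :* b := (:- a) :* (:- b)) refl (inv P) (inv u)))
        (φθD t (trans (φφ t 1 t+1 h (ℕ.+-comm t 1)) φt+1h) τu τu)
      D-τD : D ≡ - ((P * u) * τD)
      D-τD = begin
        P * u + - 1# ≡⟨ solve 2 (λ P u → P :* u :+ :- :1 := :- ((:1 :* :1) :+ :- (P :* u))) refl P u ⟩
        - (1# * 1# + - (P * u)) ≡⟨ cong₂ (λ a b → - (a * b + - (P * u))) (sym (inv-r P P≢0)) (sym (inv-r u u≢0)) ⟩
        - ((P * inv P) * (u * inv u) + - (P * u)) ≡⟨ solve 4 (λ P P⁻ u u⁻ → :- ((P :* P⁻) :* (u :* u⁻) :+ :- (P :* u)) := :- ((P :* u) :* (P⁻ :* u⁻ :+ :- :1))) refl P (inv P) u (inv u) ⟩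
        - ((P * u) * τD) ∎
    part₁ : φ 1 z + (h * P) * φ t+1 z ≡ - (P * X) + h * Xₜ
    part₁ = begin
      φ 1 z + (h * P) * φ t+1 z ≡⟨ cong₂ (λ a b → a + (h * P) * b) (trans (φ-* 1 θ _) (cong (θ₁ *_) (φ1-f⁻ X))) (trans (φ-* t+1 θ _) (cong (φ t+1 θ *_) (φt+1-f⁻ X))) ⟩
      θ₁ * E₁ + (h * P) * (φ t+1 θ * E₂) ≡⟨ solve 6 (λ a h P b e₁ e₂ → a :* e₁ :+ (h :* P) :* (b :* e₂) := a :* e₁ :+ (P :* (b :* h)) :* e₂) refl θ₁ h P (φ t+1 θ) E₁ E₂ ⟩
      θ₁ * E₁ + (P * (φ t+1 θ * h)) * E₂ ≡⟨ cong (λ z → θ₁ * E₁ + (P * z) * E₂) θₜ₊₁h ⟩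
      θ₁ * E₁ + (P * (θ₁ * H₂)) * E₂
        -- Inverses are independent unknowns for the ring solver. The identity therefore carries
        -- correction terms with factors such as P P⁻ - 1, which vanish in the next steps.
        ≡⟨ solve 11 (λ a P H h P⁻ H⁻ h⁻ x xₜ x₂ y →
             a :* (((x₂ :+ :- xₜ) :+ :- ((P :* H) :* y)) :+ (P :* h⁻) :* x) :+ (P :* (a :* H)) :* (((y :+ :- x) :+ :- ((P⁻ :* H⁻) :* x₂)) :+ (P⁻ :* h) :* xₜ)
             := ((a :* (H :* h :+ :- :1)) :* xₜ :+ :- ((P :* x) :* (h⁻ :* (a :* (H :* h :+ :- :1)))))
                :+ (((a :* x₂) :* (:1 :+ :- ((P :* P⁻) :* (H :* H⁻))) :+ (((a :* H) :* h) :* xₜ) :* (P :* P⁻ :+ :- :1)) :+ (((a :* P) :* H) :* x) :* (h :* h⁻ :+ :- :1)))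
             refl θ₁ P H₂ h (inv P) (inv H₂) (inv h) X Xₜ (φ 2 X) (φ t+2 X) ⟩
      (ϱ * Xₜ + - ((P * X) * (inv h * ϱ)))
        + (((θ₁ * φ 2 X) * (1# + - ((P * inv P) * (H₂ * inv H₂))) + (((θ₁ * H₂) * h) * Xₜ) * (P * inv P + - 1#)) + (((θ₁ * P) * H₂) * X) * (h * inv h + - 1#))
        ≡⟨ simplify (inv-r P P≢0) (inv-r H₂ H₂≢0) (inv-r h h≢0) (trans (cong (inv h *_) ϱ≡h) (inv-l h h≢0)) ⟩
      (ϱ * Xₜ + - ((P * X) * 1#)) + (((θ₁ * φ 2 X) * (1# + - (1# * 1#)) + (((θ₁ * H₂) * h) * Xₜ) * (1# + - 1#)) + (((θ₁ * P) * H₂) * X) * (1# + - 1#))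
        ≡⟨ cong (λ ϱ → (ϱ * Xₜ + - ((P * X) * 1#)) + (((θ₁ * φ 2 X) * (1# + - (1# * 1#)) + (((θ₁ * H₂) * h) * Xₜ) * (1# + - 1#)) + (((θ₁ * P) * H₂) * X) * (1# + - 1#))) ϱ≡h ⟩
      _ ≡⟨ solve 6 (λ h xₜ px a b c → (h :* xₜ :+ :- (px :* :1)) :+ ((a :* (:1 :+ :- (:1 :* :1)) :+ b :* (:1 :+ :- :1)) :+ c :* (:1 :+ :- :1)) := :- px :+ h :* xₜ)
             refl h Xₜ (P * X) (θ₁ * φ 2 X) (((θ₁ * H₂) * h) * Xₜ) (((θ₁ * P) * H₂) * X) ⟩
      - (P * X) + h * Xₜ ∎
      where
      θ₁ ϱ E₁ E₂ : F
      θ₁ = φ 1 θ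
      ϱ = θ₁ * (H₂ * h + - 1#)
      E₁ = ((φ 2 X + - Xₜ) + - ((P * H₂) * φ t+2 X)) + (P * inv h) * X
      E₂ = ((φ t+2 X + - X) + - ((inv P * inv H₂) * φ 2 X)) + (inv P * h) * Xₜ
      ϱ≡h : ϱ ≡ h
      ϱ≡h = φθD 1 φ1P φ1u φ1u
      θₜ₊₁h : φ t+1 θ * h ≡ θ₁ * H₂
      θₜ₊₁h = trans (cong₂ _*_ (sym (φφ 1 t t+1 θ refl)) (sym φ1u)) (trans (sym (φ-* 1 _ _)) (trans (cong (φ 1) τθu) (trans (φ-* 1 _ _) (cong (θ₁ *_) φ1P))))
      simplify : ∀ {c₁ c₂ c₃ c₄ d₁ d₂ d₃ d₄} → c₁ ≡ d₁ → c₂ ≡ d₂ → c₃ ≡ d₃ → c₄ ≡ d₄ →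
        (ϱ * Xₜ + - ((P * X) * c₄)) + (((θ₁ * φ 2 X) * (1# + - (c₁ * c₂)) + (((θ₁ * H₂) * h) * Xₜ) * (c₁ + - 1#)) + (((θ₁ * P) * H₂) * X) * (c₃ + - 1#)) ≡
        (ϱ * Xₜ + - ((P * X) * d₄)) + (((θ₁ * φ 2 X) * (1# + - (d₁ * d₂)) + (((θ₁ * H₂) * h) * Xₜ) * (d₁ + - 1#)) + (((θ₁ * P) * H₂) * X) * (d₃ + - 1#))
      simplify refl refl refl refl = refl
    part₂ : φ t-1 z + (h * inv u) * φ 2t-1 z ≡ inv u * X + - (h * Xₜ)
    part₂ = begin
      φ t-1 z + (h * inv u) * φ 2t-1 z ≡⟨ cong₂ (λ a b → a + (h * inv u) * b) (trans (φ-* t-1 θ _) (cong (a *_) (φt-1-f⁻ X))) (trans (φ-* 2t-1 θ _) (cong (b *_) (φ2t-1-f⁻ X))) ⟩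
      a * E₁ + (h * inv u) * (b * E₂) ≡⟨ solve 6 (λ a h u⁻ b e₁ e₂ → a :* e₁ :+ (h :* u⁻) :* (b :* e₂) := a :* e₁ :+ (u⁻ :* (b :* h)) :* e₂) refl a h (inv u) b E₁ E₂ ⟩
      a * E₁ + (inv u * (b * h)) * E₂ ≡⟨ cong (λ z → a * E₁ + (inv u * z) * E₂) (sym aw≡bh) ⟩
      a * E₁ + (inv u * (a * w)) * E₂
        ≡⟨ solve 11 (λ a u w h u⁻ w⁻ h⁻ x xₜ y z →
             a :* (((xₜ :+ :- z) :+ :- ((u⁻ :* h⁻) :* x)) :+ (u⁻ :* w) :* y) :+ (u⁻ :* (a :* w)) :* (((x :+ :- y) :+ :- ((u :* h) :* xₜ)) :+ (u :* w⁻) :* z)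
             := (:- ((a :* (h :* w :+ :- :1)) :* xₜ) :+ (u⁻ :* x) :* (h⁻ :* (a :* (h :* w :+ :- :1))))
                :+ (((a :* z) :* ((u :* u⁻) :* (w :* w⁻) :+ :- :1) :+ (((a :* w) :* h) :* xₜ) :* (:1 :+ :- (u :* u⁻))) :+ (((u⁻ :* a) :* w) :* x) :* (:1 :+ :- (h :* h⁻))))
             refl a u w h (inv u) (inv w) (inv h) X Xₜ (φ t-2 X) (φ 2t-2 X) ⟩
      (- (ϱ * Xₜ) + (inv u * X) * (inv h * ϱ))
        + (((a * φ 2t-2 X) * ((u * inv u) * (w * inv w) + - 1#) + (((a * w) * h) * Xₜ) * (1# + - (u * inv u))) + (((inv u * a) * w) * X) * (1# + - (h * inv h)))
        ≡⟨ simplify (inv-r u u≢0) (inv-r w w≢0) (inv-r h h≢0) (trans (cong (inv h *_) ϱ≡h) (inv-l h h≢0)) ⟩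
      (- (ϱ * Xₜ) + (inv u * X) * 1#) + (((a * φ 2t-2 X) * (1# * 1# + - 1#) + (((a * w) * h) * Xₜ) * (1# + - 1#)) + (((inv u * a) * w) * X) * (1# + - 1#))
        ≡⟨ cong (λ ϱ → (- (ϱ * Xₜ) + (inv u * X) * 1#) + (((a * φ 2t-2 X) * (1# * 1# + - 1#) + (((a * w) * h) * Xₜ) * (1# + - 1#)) + (((inv u * a) * w) * X) * (1# + - 1#))) ϱ≡h ⟩
      _ ≡⟨ solve 6 (λ h xₜ ux a b c → (:- (h :* xₜ) :+ ux :* :1) :+ ((a :* (:1 :* :1 :+ :- :1) :+ b :* (:1 :+ :- :1)) :+ c :* (:1 :+ :- :1)) := ux :+ :- (h :* xₜ))
             refl h Xₜ (inv u * X) (a * φ 2t-2 X) (((a * w) * h) * Xₜ) (((inv u * a) * w) * X) ⟩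
      inv u * X + - (h * Xₜ) ∎
      where
      a b ϱ E₁ E₂ : F
      a = φ t-1 θ
      b = φ 2t-1 θ
      ϱ = a * (h * w + - 1#)
      E₁ = ((Xₜ + - φ 2t-2 X) + - ((inv u * inv h) * X)) + (inv u * w) * φ t-2 X
      E₂ = ((X + - φ t-2 X) + - ((u * h) * Xₜ)) + (u * inv w) * φ 2t-2 X
      aw≡bh : a * w ≡ b * h
      aw≡bh = trans (cong₂ _*_ (sym (φφ-n 2t-1 t t-1 θ (n+ t-1))) (sym φ2t-1u)) (trans (sym (φ-* 2t-1 _ _)) (trans (cong (φ 2t-1) τθu) (trans (φ-* 2t-1 _ _) (cong (b *_) φ2t-1P))))
      ϱ≡h : ϱ ≡ h
      ϱ≡h = *-cancelʳ w≢0 (begin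
        (a * (h * w + - 1#)) * w ≡⟨ solve 3 (λ a d w → (a :* d) :* w := (a :* w) :* d) refl a (h * w + - 1#) w ⟩
        (a * w) * (h * w + - 1#) ≡⟨ cong (_* (h * w + - 1#)) aw≡bh ⟩
        (b * h) * (h * w + - 1#) ≡⟨ solve 3 (λ b h d → (b :* h) :* d := h :* (b :* d)) refl b h (h * w + - 1#) ⟩
        h * (b * (h * w + - 1#)) ≡⟨ cong (h *_) (φθD 2t-1 φ2t-1P φ2t-1u φ2t-1u) ⟩
        h * w ∎)
      simplify : ∀ {c₁ c₂ c₃ c₄ d₁ d₂ d₃ d₄} → c₁ ≡ d₁ → c₂ ≡ d₂ → c₃ ≡ d₃ → c₄ ≡ d₄ →
        (- (ϱ * Xₜ) + (inv u * X) * c₄) + (((a * φ 2t-2 X) * (c₁ * c₂ + - 1#) + (((a * w) * h) * Xₜ) * (1# + - c₁)) + (((inv u * a) * w) * X) * (1# + - c₃)) ≡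
        (- (ϱ * Xₜ) + (inv u * X) * d₄) + (((a * φ 2t-2 X) * (d₁ * d₂ + - 1#) + (((a * w) * h) * Xₜ) * (1# + - d₁)) + (((inv u * a) * w) * X) * (1# + - d₃))
      simplify refl refl refl refl = refl

-- Matrices that carry one linear set to another

module Equivalence {N : ℕ} (K : FiniteField N) {p r t′ : ℕ} (pp : Prime p) (N≡[p^r]^n : N ≡ (p ℕ.^ r) ℕ.^ Positions.n t′)
                   (3≤q : 3 ℕ.≤ p ℕ.^ r) (1≢-1 : ¬ (FiniteField.1# K ≡ FiniteField.-_ K (FiniteField.1# K))) where
  open FiniteField K
  open Positions t′
  open FieldProperties K
  open Ratio K {p} {r} {t′} pp N≡[p^r]^n 3≤q 1≢-1 public

  private
    <n : ∀ i → {True (i Fin.<? top)} → position i ℕ.< n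
    <n i {w} = position-< i top {w}

  b≢0 : ∀ {h} → Admissible′ h → b_ h ≢ 0#
  b≢0 adm = *≢0 (admissible≢0 adm) (inv≢0 (φ≢0 2t-1 (admissible≢0 adm)))

  a≢0 : ∀ {h} → Admissible′ h → a_ h ≢ 0#
  a≢0 adm e = *≢0 (admissible≢0 adm) (inv≢0 (φ≢0 t+1 (admissible≢0 adm))) (neg-injective (trans e (sym RP.-0#≈0#)))

  φ≡0 : ∀ i {x} → φ i x ≡ 0# → x ≡ 0#
  φ≡0 i {x} e = φ-injective i (trans e (sym (φ-0 i)))

  private
    -- Kills the coefficients at i and -i together: exponent 1 + q^i gives x y = 0, and exponent 1 +
    -- q + q^i gives a linear relation in which both scalars must be nonzero.
    both-zero : ∀ {A B x y} → A ≢ 0# → B ≢ 0# → x * y ≡ 0# → A * y + x * B ≡ 0# → x ≡ 0# × y ≡ 0#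
    both-zero {A} {B} {x} {y} A≢0 B≢0 xy≡0 e with x ≟ 0#
    ... | yes x≡0 = x≡0 , *≡0 (trans (sym (trans (cong (λ z → A * y + z * B) x≡0) (trans (cong (A * y +_) (zeroˡ B)) (+-identityʳ _)))) e) A≢0
    ... | no x≢0 with y≡0 ← *≡0 xy≡0 x≢0 = contradiction (*≡0 (trans (sym (trans (cong (λ z → A * z + x * B) y≡0) (trans (cong (_+ x * B) (zeroʳ A)) (+-identityˡ _)))) e) x≢0) B≢0

  module Sparseness {G k} (lG : Lin G) (adm : Admissible′ k) (GH : SlopesIn G (f k)) (HG : SlopesIn (f k) G) where
    private
      lf : Lin (f k)
      lf = four-lin 1# 1# (a_ k) (b_ k)

      zero-at : ∀ i → {True (i Fin.<? top)} → {False (1ᵖ Fin.≟ i)} → {False ([t-1] Fin.≟ i)} →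
        {False ([t+1] Fin.≟ i)} → {False ([2t-1] Fin.≟ i)} → coef (position i) (f k) ≡ 0#
      zero-at i {w} {w₁} {w₂} {w₃} {w₄} = coef-four-other i 1# 1# (a_ k) (b_ k) {w} {w₁} {w₂} {w₃} {w₄}

    open SameSlopes lG lf GH HG (zero-at 0ᵖ)

    pair-1 : coef 1 G * φ 1 (coef 2t-1 G) ≡ φ 1 (b_ k)
    pair-1 = trans (coef-pair 1 2t-1 (ℕ.s≤s ℕ.z≤n) (<n 1ᵖ) refl)
      (trans (cong₂ (λ x y → x * φ 1 y) (coef-four-1 1# 1# (a_ k) (b_ k)) (coef-four-2t-1 1# 1# (a_ k) (b_ k))) (*-identityˡ _))

    pair-t-1 : coef t-1 G * φ t-1 (coef t+1 G) ≡ φ t-1 (a_ k)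
    pair-t-1 = trans (coef-pair t-1 t+1 (ℕ.s≤s ℕ.z≤n) (<n [t-1]) (t+ 4 6))
      (trans (cong₂ (λ x y → x * φ t-1 y) (coef-four-t-1 1# 1# (a_ k) (b_ k)) (coef-four-t+1 1# 1# (a_ k) (b_ k))) (*-identityˡ _))

    coef-1≢0 : coef 1 G ≢ 0#
    coef-1≢0 = *≢0ˡ (λ e → b≢0 adm (φ≡0 1 (trans (sym pair-1) e)))

    private
      coef-2t-1≢0 : coef 2t-1 G ≢ 0#
      coef-2t-1≢0 e = *≢0ʳ (λ e → b≢0 adm (φ≡0 1 (trans (sym pair-1) e))) (trans (cong (φ 1) e) (φ-0 1))

      coef-t-1≢0 : coef t-1 G ≢ 0#
      coef-t-1≢0 = *≢0ˡ (λ e → a≢0 adm (φ≡0 t-1 (trans (sym pair-t-1) e)))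

      coef-t+1≢0 : coef t+1 G ≢ 0#
      coef-t+1≢0 e = *≢0ʳ (λ e → a≢0 adm (φ≡0 t-1 (trans (sym pair-t-1) e))) (trans (cong (φ t-1) e) (φ-0 t-1))

      *0 : ∀ x i {y} → y ≡ 0# → x * φ i y ≡ 0#
      *0 x i e = trans (cong (λ y → x * φ i y) e) (trans (cong (x *_) (φ-0 i)) (zeroʳ x))

      0+0 : ∀ {x y} → x ≡ 0# → y ≡ 0# → x + y ≡ 0#
      0+0 refl refl = +-identityˡ 0#

      0*0* : ∀ {x} y z → x ≡ 0# → (x * y) * z ≡ 0#
      0*0* y z refl = trans (cong (_* z) (zeroˡ y)) (zeroˡ z)

      around-0 : coef 2 G ≡ 0# × φ 2 (coef 2t-2 G) ≡ 0#
      around-0 = both-zero (*≢0 coef-1≢0 (φ≢0 1 coef-1≢0)) (*≢0 (φ≢0 1 coef-2t-1≢0) (φ≢0 2 coef-2t-1≢0))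
        (trans (coef-pair 2 2t-2 (ℕ.s≤s ℕ.z≤n) (<n 2ᵖ) refl) (*0 _ 2 (zero-at [2t-2])))
        (trans (cong ((coef 1 G * φ 1 (coef 1 G)) * φ 2 (coef 2t-2 G) +_) (sym (*-assoc _ _ _)))
          (trans (coef-triple 2 (ℕ.s≤s (ℕ.s≤s ℕ.z≤n)) (<n 2ᵖ) refl refl refl refl)
            (0+0 (*0 _ 2 (zero-at [2t-2])) (0*0* _ _ (zero-at 2ᵖ)))))

      -- With j = t + 2 the two scalars are products of conjugates of the coefficients at ±1 and t ±
      -- 1, all known to be nonzero.
      around-t : coef t+2 G ≡ 0# × φ t+2 (coef t-2 G) ≡ 0#
      around-t = both-zero (*≢0 coef-1≢0 (φ≢0 1 coef-t+1≢0)) (*≢0 (φ≢0 1 coef-2t-1≢0) (φ≢0 t+2 coef-t-1≢0))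
        (trans (coef-pair t+2 t-2 (ℕ.s≤s ℕ.z≤n) (<n [t+2]) (t+ 7 3)) (*0 _ t+2 (zero-at [t-2])))
        (trans (cong ((coef 1 G * φ 1 (coef t+1 G)) * φ t+2 (coef t-2 G) +_) (sym (*-assoc _ _ _)))
          (trans (coef-triple t+2 (ℕ.s≤s (ℕ.s≤s ℕ.z≤n)) (<n [t+2]) refl (t+ 7 3) refl (t+ 7 4))
            (0+0 (*0 _ t+2 (zero-at [t-2])) (0*0* _ _ (zero-at [t+2])))))

    sparse : Sparse G
    sparse = record
      { at-0 = coef-0≡0
      ; at-2 = proj₁ around-0
      ; at-t-2 = φ≡0 t+2 (proj₂ around-t)
      -- The degree t is its own opposite modulo n, so exponent 1 + q^t already gives the
      -- coefficient times its own conjugate.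
      ; at-t = decidable-stable (coef t G ≟ 0#) (λ ne → *≢0 ne (φ≢0 t ne)
          (trans (coef-pair t t (ℕ.s≤s ℕ.z≤n) (<n [t]) (t+ 5 5)) (*0 _ t (zero-at [t]))))
      ; at-t+2 = proj₁ around-t
      ; at-2t-2 = φ≡0 2 (proj₂ around-0)
      }

  module _ {h k a b c d : F} (adm-h : Admissible′ h) (adm-k : Admissible′ k) (det≢0 : a * d + - (b * c) ≢ 0#) where
    private
      u w : F → F
      u x = a * x + b * f h x
      w x = c * x + d * f h x

      lf : Lin (f h)
      lf = four-lin 1# 1# (a_ h) (b_ h)

      lin-combination : ∀ a b → Lin (λ x → a * x + b * f h x)
      lin-combination a b = lin-+ (lin-*ˡ a lin-id) (lin-*ˡ b lf)

      inverse-ratio : ∀ {y s λ′} → λ′ ≢ 0# → (λ′ * s) * inv (λ′ * y) ≡ s * inv y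
      inverse-ratio {y} {s} {λ′} ne = trans (cong ((λ′ * s) *_) (inv-* λ′ y))
        (trans (solve 4 (λ l s i j → (l :* s) :* (i :* j) := (l :* i) :* (s :* j)) refl λ′ s (inv λ′) (inv y))
          (trans (cong (_* (s * inv y)) (inv-r λ′ ne)) (*-identityˡ _)))

      slope≢0⇒≢0 : ∀ G {x} → slope G x ≢ 0# → x ≢ 0#
      slope≢0⇒≢0 G ne refl = ne (trans (cong (G 0# *_) inv-0) (zeroʳ _))

    ratio-of-equivalent :
      (∀ x → x ≢ 0# → ∃[ y ] (y ≢ 0# × SamePoint (a * x + b * f h x , c * x + d * f h x) (y , f k y))) →
      (∀ y → y ≢ 0# → ∃[ x ] (x ≢ 0# × SamePoint (a * x + b * f h x , c * x + d * f h x) (y , f k y))) →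
      let m = k * inv h in (m * m) * (φ 2 m * φ 2 m) ≡ 1#
    ratio-of-equivalent into onto = by-cases (a ≟ 0#)
      where
      open ≡-Reasoning
      -- L_k does not contain the point ⟨(0,1)⟩, so the first coordinate of an image vector never
      -- vanishes. This is what makes the image a graph over the first coordinate.
      u-kernel : ∀ {x} → u x ≡ 0# → x ≡ 0#
      u-kernel {x} ux≡0 = decidable-stable (x ≟ 0#) (λ x≢0 → case into x x≢0 of λ
        (y , y≢0 , λ′ , λ≢0 , ux≡λy , _) → *≢0 λ≢0 y≢0 (trans (sym ux≡λy) ux≡0))
      u-injective : ∀ {x y} → u x ≡ u y → x ≡ y
      u-injective {x} {y} e = x-y≡0⇒x≡y (u-kernel (trans (lin-additive lu x (- y)) (trans (cong (_+ u (- y)) e)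
          (trans (sym (lin-additive lu y (- y))) (trans (cong u (-‿inverseʳ y)) (lin-0 lu))))))
        where lu = lin-combination a b
      u-inverse = lin-inverse (lin-combination a b) u-injective
      v = proj₁ u-inverse
      vu : ∀ x → v (u x) ≡ x
      vu = proj₁ (proj₂ (proj₂ u-inverse))
      uv : ∀ x → u (v x) ≡ x
      uv = proj₂ (proj₂ (proj₂ u-inverse))
      G : F → F
      G y = w (v y)
      lG : Lin G
      lG = lin-∘ (lin-combination c d) (proj₁ (proj₂ u-inverse))
      Gu≡w : ∀ x → G (u x) ≡ w x
      Gu≡w x = cong w (vu x)
      G-in : SlopesIn G (f k)
      G-in z s≢0 = case into (v z) vz≢0 of λ
          (y , y≢0 , λ′ , λ≢0 , uvz≡λy , wvz≡λfy) → y , sym (trans (cong₂ (λ p q → p * inv q) wvz≡λfy (trans (sym (uv z)) uvz≡λy)) (inverse-ratio λ≢0))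
        where
        vz≢0 : v z ≢ 0#
        vz≢0 e = slope≢0⇒≢0 G s≢0 (trans (sym (uv z)) (trans (cong u e) (lin-0 (lin-combination a b))))
      f-in : SlopesIn (f k) G
      f-in y s≢0 = case onto y (slope≢0⇒≢0 (f k) s≢0) of λ
        (x , x≢0 , λ′ , λ≢0 , ux≡λy , wx≡λfy) → u x , trans (cong₂ (λ p q → p * inv q) (trans (Gu≡w x) wx≡λfy) ux≡λy) (inverse-ratio λ≢0)
      open Sparseness lG adm-k G-in f-in
      open Sparse sparse

      at-1 : coef 1 G * φ 1 a ≡ d * 1#
      at-1 = trans (coefficient-equation lG h a b c d Gu≡w 1ᵖ {0} {t+2} {t} {2} at-0 at-t+2 at-t at-2
        (inj₁ refl) (inj₂ (t+ 7 4)) (inj₂ (t+ 5 6)) (inj₂ refl)) (cong (d *_) (coef-four-1 1# 1# (a_ h) (b_ h)))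
      at-t-1 : coef t-1 G * φ t-1 a ≡ d * 1#
      at-t-1 = trans (coefficient-equation lG h a b c d Gu≡w [t-1] {t-2} {0} {2t-2} {t} at-t-2 at-0 at-2t-2 at-t
        (inj₁ (ℕ.+-comm t-2 1)) (inj₁ refl) (inj₂ wrap) (inj₂ (trans (ℕ.+-comm t 2t-1) (n+ t-1)))) (cong (d *_) (coef-four-t-1 1# 1# (a_ h) (b_ h)))
        where
        wrap : 2t-2 ℕ.+ t+1 ≡ t-1 ℕ.+ n
        wrap = trans (ℕ.+-suc 2t-2 t) (n+ t-1)
      at-t+1 : coef t+1 G * φ t+1 a ≡ d * a_ h
      at-t+1 = trans (coefficient-equation lG h a b c d Gu≡w [t+1] {t} {2} {0} {t+2} at-t at-2 at-0 at-t+2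
        (inj₁ (ℕ.+-comm t 1)) (inj₁ refl) (inj₁ refl) (inj₂ (trans (ℕ.+-comm t+2 2t-1) (n+ t+1)))) (cong (d *_) (coef-four-t+1 1# 1# (a_ h) (b_ h)))
      at-2t-1 : coef 2t-1 G * φ 2t-1 a ≡ d * b_ h
      at-2t-1 = trans (coefficient-equation lG h a b c d Gu≡w [2t-1] {2t-2} {t} {t-2} {0} at-2t-2 at-t at-t-2 at-0
        (inj₁ (ℕ.+-comm 2t-2 1)) (inj₁ (t+ 5 4)) (inj₁ (t+ 3 6)) (inj₁ refl)) (cong (d *_) (coef-four-2t-1 1# 1# (a_ h) (b_ h)))

      Conclusion : Set
      Conclusion = ((k * inv h) * (k * inv h)) * (φ 2 (k * inv h) * φ 2 (k * inv h)) ≡ 1#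

      diagonal : a ≢ 0# → Conclusion
      -- The compared coefficients read F_s a^(q^s) = d (ψ_h)_s, so κ = d and λ = 1/a.
      diagonal a≢0 = ratio-equation adm-h adm-k d (inv a)
        (trans (cong₂ (λ x y → x * φ 1 y) (sym (trans (solved 1 at-1) (cong (_* φ 1 (inv a)) (*-identityʳ d)))) (sym (trans (solved 2t-1 at-2t-1) (swap _ _ _)))) pair-1)
        (trans (cong₂ (λ x y → x * φ t-1 y) (sym (trans (solved t-1 at-t-1) (cong (_* φ t-1 (inv a)) (*-identityʳ d)))) (sym (trans (solved t+1 at-t+1) (swap _ _ _)))) pair-t-1)
        where
        swap : ∀ x y z → (x * y) * z ≡ (x * z) * y
        swap = solve 3 (λ x y z → (x :* y) :* z := (x :* z) :* y) refl
        solved : ∀ i {s} → coef i G * φ i a ≡ s → coef i G ≡ s * φ i (inv a)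
        solved i {s} e = begin
          coef i G ≡⟨ sym (*-identityʳ _) ⟩
          coef i G * 1# ≡⟨ cong (coef i G *_) (sym (trans (sym (φ-* i a (inv a))) (trans (cong (φ i) (inv-r a a≢0)) (φ-1 i)))) ⟩
          coef i G * (φ i a * φ i (inv a)) ≡⟨ sym (*-assoc _ _ _) ⟩
          (coef i G * φ i a) * φ i (inv a) ≡⟨ cong (_* φ i (inv a)) e ⟩
          s * φ i (inv a) ∎

      -- In this case G = c (b f_h)⁻¹, which the inversion formula expresses through f⁻_h.
      antidiagonal : a ≡ 0# → Conclusion
      antidiagonal a≡0 = ratio-equation adm-h adm-k κ λ′
        (trans (cong₂ (λ x y → x * φ 1 y) (sym (trans (coef-G 1) (trans (cong (λ z → κ * (z * φ 1 λ′)) (coef-four-1 1# (- 1#) (- a_ h) (b_ h))) (cong (κ *_) (*-identityˡ _)))))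
          (sym (trans (coef-G 2t-1) (trans (cong (λ z → κ * (z * φ 2t-1 λ′)) (coef-four-2t-1 1# (- 1#) (- a_ h) (b_ h))) (solve 3 (λ x y z → x :* (y :* z) := (x :* z) :* y) refl κ (b_ h) (φ 2t-1 λ′)))))) pair-1)
        (trans (trans signs (cong₂ (λ x y → x * φ t-1 y) (sym (trans (coef-G t-1) (cong (λ z → κ * (z * φ t-1 λ′)) (coef-four-t-1 1# (- 1#) (- a_ h) (b_ h)))))
          (sym (trans (coef-G t+1) (cong (λ z → κ * (z * φ t+1 λ′)) (coef-four-t+1 1# (- 1#) (- a_ h) (b_ h))))))) pair-t-1)
        where
        open Inversion K {p} {r} {t′} pp N≡[p^r]^n 3≤q 1≢-1 adm-h using (θ; D≢0; f-θ-f⁻-θ)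
        -- The comparison at degree 1, where ψ_h has coefficient 1, has left side 0 when a = 0. The
        -- determinant then forces b ≠ 0.
        d≡0 : d ≡ 0#
        d≡0 = trans (sym (*-identityʳ d)) (trans (sym at-1) (trans (cong (λ z → coef 1 G * φ 1 z) a≡0) (trans (cong (coef 1 G *_) (φ-0 1)) (zeroʳ _))))
        b≢0′ : b ≢ 0#
        b≢0′ b≡0 = det≢0 (trans (cong₂ (λ x y → x * d + - (y * c)) a≡0 b≡0) (solve 2 (λ c d → :0 :* d :+ :- (:0 :* c) := :0) refl c d))
        f-kernel : ∀ {x} → f h x ≡ 0# → x ≡ 0#
        f-kernel {x} e = u-kernel (trans (cong₂ (λ y z → y * x + b * z) a≡0 e) (solve 2 (λ x b → :0 :* x :+ b :* :0 := :0) refl x b))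
        -- Read off from ψ_h⁻¹(y / b) = θ f⁻(θ y′) with y′ = -y / b; the sign is the one in
        -- `f-θ-f⁻-θ`.
        κ λ′ : F
        κ = c * θ
        λ′ = - (θ * inv b)
        G≡ : ∀ y → G y ≡ κ * f⁻ h (λ′ * y)
        G≡ y = begin
          G y ≡⟨ cong G (sym ux≡y) ⟩
          G (u x) ≡⟨ Gu≡w x ⟩
          c * x + d * f h x ≡⟨ trans (cong (λ z → c * x + z * f h x) d≡0) (trans (cong (c * x +_) (zeroˡ _)) (+-identityʳ _)) ⟩
          c * (θ * f⁻ h (θ * y′)) ≡⟨ sym (*-assoc _ _ _) ⟩
          κ * f⁻ h (θ * y′) ≡⟨ cong (λ z → κ * f⁻ h z) (solve 3 (λ θ b y → θ :* (:- (b :* y)) := (:- (θ :* b)) :* y) refl θ (inv b) y) ⟩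
          κ * f⁻ h (λ′ * y) ∎
          where
          y′ x : F
          y′ = - (inv b * y)
          x = θ * f⁻ h (θ * y′)
          ux≡y : u x ≡ y
          ux≡y = begin
            a * x + b * f h x ≡⟨ cong₂ (λ s z → s * x + b * z) a≡0 (f-θ-f⁻-θ (D≢0 f-kernel) y′) ⟩
            0# * x + b * - y′ ≡⟨ solve 4 (λ x b b⁻ y → :0 :* x :+ b :* (:- (:- (b⁻ :* y))) := (b :* b⁻) :* y) refl x b (inv b) y ⟩
            (b * inv b) * y ≡⟨ trans (cong (_* y) (inv-r b b≢0′)) (*-identityˡ y) ⟩
            y ∎
        lf⁻ : Lin (f⁻ h)
        lf⁻ = four-lin 1# (- 1#) (- a_ h) (b_ h)
        coef-G : ∀ i → coef i G ≡ κ * (coef i (f⁻ h) * φ i λ′)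
        coef-G i = trans (coef-cong i G≡) (trans (coef-*ˡ i κ _) (cong (κ *_) (coef-∘* i λ′ (f⁻ h) (lin-0 lf⁻))))
        -- The sign changes of `f⁻` at t - 1 and t + 1 meet in a single product, so `ratio-equation`
        -- applies with unchanged right-hand side.
        signs : (κ * φ t-1 λ′) * φ t-1 ((κ * φ t+1 λ′) * a_ h) ≡ (κ * (- 1# * φ t-1 λ′)) * φ t-1 (κ * (- a_ h * φ t+1 λ′))
        signs = begin
          (κ * φ t-1 λ′) * φ t-1 ((κ * φ t+1 λ′) * a_ h) ≡⟨ solve 3 (λ κ l x → (κ :* l) :* x := (κ :* ((:- :1) :* l)) :* (:- x)) refl κ (φ t-1 λ′) (φ t-1 ((κ * φ t+1 λ′) * a_ h)) ⟩
          (κ * (- 1# * φ t-1 λ′)) * - φ t-1 ((κ * φ t+1 λ′) * a_ h) ≡⟨ cong ((κ * (- 1# * φ t-1 λ′)) *_) (sym (φ-neg t-1 _)) ⟩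
          (κ * (- 1# * φ t-1 λ′)) * φ t-1 (- ((κ * φ t+1 λ′) * a_ h)) ≡⟨ cong (λ z → (κ * (- 1# * φ t-1 λ′)) * φ t-1 z) (solve 3 (λ κ l x → :- ((κ :* l) :* x) := κ :* ((:- x) :* l)) refl κ (φ t+1 λ′) (a_ h)) ⟩
          (κ * (- 1# * φ t-1 λ′)) * φ t-1 (κ * (- a_ h * φ t+1 λ′)) ∎

      by-cases : Dec (a ≡ 0#) → Conclusion
      by-cases (yes a≡0) = antidiagonal a≡0
      by-cases (no a≢0) = diagonal a≢0

-- Collineations with a field automorphism

module Collineations {N : ℕ} (K : FiniteField N) {p r t′ : ℕ} (pp : Prime p) (N≡[p^r]^n : N ≡ (p ℕ.^ r) ℕ.^ Positions.n t′)
                     (3≤q : 3 ℕ.≤ p ℕ.^ r) (1≢-1 : ¬ (FiniteField.1# K ≡ FiniteField.-_ K (FiniteField.1# K))) where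
  open FiniteField K
  open Positions t′
  open FieldProperties K
  open Equivalence K {p} {r} {t′} pp N≡[p^r]^n 3≤q 1≢-1 public

  private
    ^-φ : ∀ i {j} x → i ≡ j → x ^ (q ℕ.^ i) ≡ φ j x
    ^-φ i x refl = sym (φ-def i x)

  ψ≡f : ∀ h x → ψ K q t h x ≡ f h x
  ψ≡f h x = cong₂ _+_ (cong₂ _+_ (cong₂ _+_
      (trans (cong (x ^_) (sym (ℕ.*-identityʳ q))) (trans (^-φ 1 x refl) (sym (*-identityˡ _))))
      (trans (^-φ t-1 x refl) (sym (*-identityˡ _))))
      (trans (cong₂ (λ y z → - ((h * inv y) * z)) (^-φ (t ℕ.+ 1) h t+1≡) (^-φ (t ℕ.+ 1) x t+1≡)) (RP.-‿distribˡ-* _ _)))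
      (cong₂ (λ y z → (h * inv y) * z) (^-φ (2 ℕ.* t ℕ.∸ 1) h 2t-1≡) (^-φ (2 ℕ.* t ℕ.∸ 1) x 2t-1≡))
    where
    t+1≡ : t ℕ.+ 1 ≡ 6 ℕ.+ t′
    t+1≡ = ℕ.+-comm t 1
    2t-1≡ : 2 ℕ.* t ℕ.∸ 1 ≡ 9 ℕ.+ (t′ ℕ.+ t′)
    2t-1≡ = trans (cong (λ z → 4 ℕ.+ t′ ℕ.+ z) (ℕ.+-identityʳ t)) (t+ 4 5)

  admissible⇒′ : ∀ {h} → Admissible K q t h → Admissible′ h
  admissible⇒′ {h} adm = trans (trans (*-comm _ _) (cong₂ _*_ (φ-def t h) (sym (^-1 h)))) (trans (sym (^-+ h (q ℕ.^ t) 1)) adm)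

  module AutomorphismOnψ (s : Automorphism) where
    open Automorphism s
    open AutomorphismProperties s

    σ-φ : ∀ i x → σ (φ i x) ≡ φ i (σ x)
    σ-φ i x = trans (cong σ (φ-def i x)) (trans (σ-^ x (q ℕ.^ i)) (sym (φ-def i (σ x))))

    σ-f : ∀ h x → σ (f h x) ≡ f (σ h) (σ x)
    σ-f h x = trans (σ-+ _ _) (cong₂ _+_ (trans (σ-+ _ _) (cong₂ _+_ (trans (σ-+ _ _) (cong₂ _+_
        (trans (σ-* _ _) (cong₂ _*_ σ-1 (σ-φ 1 x))) (trans (σ-* _ _) (cong₂ _*_ σ-1 (σ-φ t-1 x)))))
        (trans (σ-* _ _) (cong₂ _*_ (trans (σ-neg _) (cong -_ (h/φh t+1))) (σ-φ t+1 x)))))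
        (trans (σ-* _ _) (cong₂ _*_ (h/φh 2t-1) (σ-φ 2t-1 x))))
      where
      h/φh : ∀ i → σ (h * inv (φ i h)) ≡ σ h * inv (φ i (σ h))
      h/φh i = trans (σ-* _ _) (cong (σ h *_) (trans (σ-inv _) (cong inv (σ-φ i h))))

    σ-admissible : ∀ {h} → Admissible′ h → Admissible′ (σ h)
    σ-admissible {h} adm = trans (cong (σ h *_) (sym (σ-φ t h))) (trans (sym (σ-* _ _)) (trans (cong σ adm) (trans (σ-neg 1#) (cong -_ σ-1))))

  -- σ maps (x, ψ_h(x)) to (σ x, ψ_{σ h}(σ x)), because the coefficients of ψ_h are built from h by
  -- field operations. Hence the matrix of the collineation alone carries L_{σ h} to L_k.
  ratio-of-PΓL-equivalent : ∀ {h k} → Admissible K q t h → Admissible K q t k →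
    PΓL-equivalent (L K q t h) (L K q t k) →
    Σ Automorphism λ s → let h′ = Automorphism.σ s h ; m = k * inv h′ in
      Admissible′ h′ × Admissible′ k × (m * m) * (φ 2 m * φ 2 m) ≡ 1#
  ratio-of-PΓL-equivalent {h} {k} adm-h adm-k (g , L-into , L-onto) =
    aut , σ-admissible (admissible⇒′ adm-h) , admissible⇒′ adm-k ,
    ratio-of-equivalent (σ-admissible (admissible⇒′ adm-h)) (admissible⇒′ adm-k) det≢0 into onto
    where
    open Collineation g
    open Automorphism aut
    open AutomorphismProperties aut
    open AutomorphismOnψ aut
    h′ : F
    h′ = σ h
    σψ : ∀ x → σ (ψ K q t h x) ≡ f h′ (σ x)
    σψ x = trans (cong σ (ψ≡f h x)) (σ-f h x)
    into : ∀ x → x ≢ 0# → ∃[ y ] (y ≢ 0# × SamePoint (a * x + b * f h′ x , c * x + d * f h′ x) (y , f k y))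
    into x x≢0 = case L-into (x₀ , ψ K q t h x₀) (λ (x₀≡0 , _) → x₀≢0 x₀≡0) (x₀ , x₀≢0 , 1# , 1≢0 , sym (*-identityˡ _) , sym (*-identityˡ _)) of λ
        (y , y≢0 , λ′ , λ≢0 , e₁ , e₂) → y , y≢0 , λ′ , λ≢0 ,
          trans (cong₂ (λ p q → a * p + b * q) (sym σx₀) (sym σψx₀)) e₁ ,
          trans (cong₂ (λ p q → c * p + d * q) (sym σx₀) (sym σψx₀)) (trans e₂ (cong (λ′ *_) (ψ≡f k y)))
      where
      x₀ : F
      x₀ = σ⁻¹ x
      σx₀ : σ x₀ ≡ x
      σx₀ = σ-invʳ x
      σψx₀ : σ (ψ K q t h x₀) ≡ f h′ x
      σψx₀ = trans (σψ x₀) (cong (f h′) σx₀)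
      x₀≢0 : x₀ ≢ 0#
      x₀≢0 e = x≢0 (trans (sym σx₀) (trans (cong σ e) σ-0))
    onto : ∀ y → y ≢ 0# → ∃[ x ] (x ≢ 0# × SamePoint (a * x + b * f h′ x , c * x + d * f h′ x) (y , f k y))
    onto y y≢0 = case L-onto (y , ψ K q t k y) (λ (y≡0 , _) → y≢0 y≡0) (y , y≢0 , 1# , 1≢0 , sym (*-identityˡ _) , sym (*-identityˡ _)) of λ
      { ((v₁ , v₂) , _ , (x , x≢0 , μ , μ≢0 , v₁≡ , v₂≡) , λ′ , λ≢0 , e₁ , e₂) →
        σ x , σ≢0 x≢0 , inv (σ μ) * λ′ , *≢0 (inv≢0 (σ≢0 μ≢0)) λ≢0 ,
        unscale (σ≢0 μ≢0) (cong σ v₁≡) (cong σ v₂≡) e₁ ,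
        unscale (σ≢0 μ≢0) (cong σ v₁≡) (cong σ v₂≡) (trans e₂ (cong (λ′ *_) (ψ≡f k y))) }
      where
      -- A vector of the point set is only a multiple μ of some (x, ψ_h(x)); the scalar σ(μ) is
      -- absorbed into the factor of proportionality.
      unscale : ∀ {x μ λ′ v₁ v₂ a b z} → σ μ ≢ 0# → σ v₁ ≡ σ (μ * x) → σ v₂ ≡ σ (μ * ψ K q t h x) → a * σ v₁ + b * σ v₂ ≡ λ′ * z →
        a * σ x + b * f h′ (σ x) ≡ (inv (σ μ) * λ′) * z
      unscale {x} {μ} {λ′} {v₁} {v₂} {a} {b} {z} σμ≢0 e₁ e₂ e = *-cancelˡ σμ≢0 (begin
        σ μ * (a * σ x + b * f h′ (σ x)) ≡⟨ solve 5 (λ m a b x y → m :* (a :* x :+ b :* y) := a :* (m :* x) :+ b :* (m :* y)) refl (σ μ) a b (σ x) (f h′ (σ x)) ⟩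
        a * (σ μ * σ x) + b * (σ μ * f h′ (σ x)) ≡⟨ cong₂ (λ p q → a * p + b * q) (sym (trans e₁ (σ-* _ _))) (sym (trans e₂ (trans (σ-* _ _) (cong (σ μ *_) (σψ x))))) ⟩
        a * σ v₁ + b * σ v₂ ≡⟨ e ⟩
        λ′ * z ≡⟨ cong (_* z) (sym (trans (cong (_* λ′) (inv-r _ σμ≢0)) (*-identityˡ λ′))) ⟩
        ((σ μ * inv (σ μ)) * λ′) * z ≡⟨ solve 4 (λ m i l z → ((m :* i) :* l) :* z := m :* ((i :* l) :* z)) refl (σ μ) (inv (σ μ)) λ′ z ⟩
        σ μ * ((inv (σ μ) * λ′) * z) ∎)
        where open ≡-Reasoning

  private
    *≡1⇒^≡ : ∀ {z k} e → z ≢ 0# → (k * inv z) ^ e ≡ 1# → k ^ e ≡ z ^ e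
    *≡1⇒^≡ {z} {k} e z≢0 eq = begin
      k ^ e ≡⟨ cong (_^ e) (sym (trans (*-assoc _ _ _) (trans (cong (k *_) (inv-l z z≢0)) (*-identityʳ k)))) ⟩
      ((k * inv z) * z) ^ e ≡⟨ *-^ _ _ e ⟩
      (k * inv z) ^ e * z ^ e ≡⟨ trans (cong (_* z ^ e) eq) (*-identityˡ _) ⟩
      z ^ e ∎
      where open ≡-Reasoning

    admissible-ratio : ∀ {z k} → Admissible′ z → Admissible′ k → (k * inv z) * φ t (k * inv z) ≡ 1#
    admissible-ratio {z} {k} adm-z adm-k = begin
      (k * inv z) * φ t (k * inv z) ≡⟨ cong ((k * inv z) *_) (trans (φ-* t _ _) (cong (φ t k *_) (φ-inv t z))) ⟩
      (k * inv z) * (φ t k * inv (φ t z)) ≡⟨ solve 4 (λ a b c d → (a :* b) :* (c :* d) := (a :* c) :* (b :* d)) refl k (inv z) (φ t k) (inv (φ t z)) ⟩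
      (k * φ t k) * (inv z * inv (φ t z)) ≡⟨ cong ((k * φ t k) *_) (sym (inv-* z (φ t z))) ⟩
      (k * φ t k) * inv (z * φ t z) ≡⟨ cong₂ (λ x y → x * inv y) adm-k adm-z ⟩
      - 1# * inv (- 1#) ≡⟨ inv-r _ -1≢0 ⟩
      1# ∎
      where open ≡-Reasoning

  same-power : ∀ {z k} → Admissible′ z → let m = k * inv z in (m * m) * (φ 2 m * φ 2 m) ≡ 1# → k ^ (2 ℕ.* (q ℕ.^ 2 ℕ.+ 1)) ≡ z ^ (2 ℕ.* (q ℕ.^ 2 ℕ.+ 1))
  same-power {z} {k} adm eq = *≡1⇒^≡ e (admissible≢0 adm) (begin
      m ^ (2 ℕ.* (q ℕ.^ 2 ℕ.+ 1)) ≡⟨ cong (m ^_) (ℕ.*-comm 2 (q ℕ.^ 2 ℕ.+ 1)) ⟩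
      m ^ ((q ℕ.^ 2 ℕ.+ 1) ℕ.* 2) ≡⟨ ^-* m (q ℕ.^ 2 ℕ.+ 1) 2 ⟩
      (m ^ (q ℕ.^ 2 ℕ.+ 1)) ^ 2 ≡⟨ cong (_^ 2) (trans (^-+ m (q ℕ.^ 2) 1) (cong₂ _*_ (sym (φ-def 2 m)) (^-1 m))) ⟩
      (φ 2 m * m) ^ 2 ≡⟨ solve 2 (λ a b → (a :* b) :* ((a :* b) :* :1) := (b :* b) :* (a :* a)) refl (φ 2 m) m ⟩
      (m * m) * (φ 2 m * φ 2 m) ≡⟨ eq ⟩
      1# ∎)
    where
    open ≡-Reasoning
    e = 2 ℕ.* (q ℕ.^ 2 ℕ.+ 1)
    m = k * inv z

  -- Put X = m². Then X^(q²) = X⁻¹, so X^(q⁴) = X, and the norm condition X^(q^t) = X⁻¹ depends only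
  -- on t modulo 4. Residue 0 gives X = X⁻¹ at once; an odd residue gives X^q = X⁻¹ = X^(q²), hence
  -- X^q = X and X² = 1. Residue 2 only repeats the first relation.
  same-fourth-power : t ℕ.% 4 ≢ 2 → ∀ {z k} → Admissible′ z → Admissible′ k → let m = k * inv z in (m * m) * (φ 2 m * φ 2 m) ≡ 1# → k ^ 4 ≡ z ^ 4
  same-fourth-power t≢2 {z} {k} adm-z adm-k eq = *≡1⇒^≡ 4 (admissible≢0 adm-z)
      (trans (solve 1 (λ m → m :* (m :* (m :* (m :* :1))) := (m :* m) :* (m :* m)) refl m) (by-residue (t ℕ.% 4) (m%n<n t 4) t≢2 Xφᵢ))
    where
    m X : F
    m = k * inv z
    X = m * m
    X≢0 : X ≢ 0#
    X≢0 = *≢0ˡ (λ e → 1≢0 (trans (sym eq) e))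
    Xφ₂ : X * φ 2 X ≡ 1#
    Xφ₂ = trans (cong (X *_) (φ-* 2 m m)) eq
    Xφₜ : X * φ t X ≡ 1#
    Xφₜ = trans (cong (X *_) (φ-* t m m)) (trans (solve 2 (λ m n → (m :* m) :* (n :* n) := (m :* n) :* (m :* n)) refl m (φ t m))
      (trans (cong₂ _*_ (admissible-ratio adm-z adm-k) (admissible-ratio adm-z adm-k)) (*-identityˡ 1#)))
    applied : ∀ i j → X * φ j X ≡ 1# → φ i X * φ (i ℕ.+ j) X ≡ 1#
    applied i j e = trans (cong (φ i X *_) (sym (φ-φ i j X))) (trans (sym (φ-* i _ _)) (trans (cong (φ i) e) (φ-1 i)))
    φ₄X : φ 4 X ≡ X
    φ₄X = *-cancelˡ (φ≢0 2 X≢0) (trans (applied 2 2 Xφ₂) (trans (sym Xφ₂) (*-comm _ _)))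
    φ-+4k : ∀ i k → φ (i ℕ.+ k ℕ.* 4) X ≡ φ i X
    φ-+4k i zero = cong (λ j → φ j X) (ℕ.+-identityʳ i)
    φ-+4k i (suc k) = trans (cong (λ j → φ j X) (trans (cong (i ℕ.+_) (ℕ.+-comm 4 (k ℕ.* 4))) (sym (ℕ.+-assoc i (k ℕ.* 4) 4))))
      (trans (sym (φ-φ (i ℕ.+ k ℕ.* 4) 4 X)) (trans (cong (φ (i ℕ.+ k ℕ.* 4)) φ₄X) (φ-+4k i k)))
    Xφᵢ : X * φ (t ℕ.% 4) X ≡ 1#
    Xφᵢ = trans (cong (X *_) (sym (trans (cong (λ j → φ j X) (m≡m%n+[m/n]*n t 4)) (φ-+4k (t ℕ.% 4) (t ℕ./ 4))))) Xφₜ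
    residue-1 : X * φ 1 X ≡ 1# → X * X ≡ 1#
    residue-1 e = trans (cong (X *_) (sym (*-cancelʳ (φ≢0 2 X≢0) (trans (applied 1 1 e) (sym Xφ₂))))) e
    by-residue : ∀ i → i ℕ.< 4 → i ≢ 2 → X * φ i X ≡ 1# → X * X ≡ 1#
    by-residue 0 _ _ e = trans (cong (X *_) (sym (φ-id X))) e
    by-residue 1 _ _ e = residue-1 e
    by-residue 2 _ ne e = contradiction refl ne
    by-residue 3 _ _ e = residue-1 (trans (trans (*-comm _ _) (cong (φ 1 X *_) (sym φ₄X))) (applied 1 3 e))
    by-residue (suc (suc (suc (suc i)))) (ℕ.s≤s (ℕ.s≤s (ℕ.s≤s (ℕ.s≤s ())))) _ _

-- Counting admissible elements and choosing representatives

module ℕS = Data.Nat.Solver.+-*-Solver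

module Selection {N : ℕ} (K : FiniteField N) {p r t′ : ℕ} (pp : Prime p) (N≡[p^r]^n : N ≡ (p ℕ.^ r) ℕ.^ Positions.n t′)
                 (3≤q : 3 ℕ.≤ p ℕ.^ r) (1≢-1 : ¬ (FiniteField.1# K ≡ FiniteField.-_ K (FiniteField.1# K))) where
  open FiniteField K
  open Positions t′
  open FieldProperties K
  open Polynomials K
  open Collineations K {p} {r} {t′} pp N≡[p^r]^n 3≤q 1≢-1

  private
    Q : ℕ
    Q = q ℕ.^ t

    1<Q : 1 ℕ.< Q
    1<Q = ℕ.^-monoʳ-< q (ℕ.<-≤-trans (ℕ.s≤s (ℕ.s≤s ℕ.z≤n)) 3≤q) (ℕ.s≤s (ℕ.z≤n {4 ℕ.+ t′}))

    Q²≡N : Q ℕ.* Q ≡ N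
    Q²≡N = trans (sym (ℕ.^-distribˡ-+-* q t t)) (trans (cong (q ℕ.^_) (t+ 5 5)) (sym N≡[p^r]^n))

    length-concatMap : ∀ {A : Set} (g : A → List F) b xs → (∀ x → List.length (g x) ℕ.≤ b) → List.length (List.concatMap g xs) ℕ.≤ List.length xs ℕ.* b
    length-concatMap g b [] l = ℕ.z≤n
    length-concatMap g b (x ∷ xs) l = subst (ℕ._≤ b ℕ.+ List.length xs ℕ.* b) (sym (List.length-++ (g x)))
      (ℕ.+-mono-≤ (l x) (length-concatMap g b xs l))

    Q-2 : ∃[ Q′ ] Q ≡ suc (suc Q′)
    Q-2 with Q | 1<Q
    ... | suc (suc Q′) | _ = Q′ , refl
    ... | suc zero | ℕ.s≤s ()

    Q′ : ℕ
    Q′ = proj₁ Q-2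
    Q≡ : Q ≡ suc (suc Q′)
    Q≡ = proj₂ Q-2

    -- The candidates other than -1 for the value of the norm x^(Q+1) at a nonzero x; there are at
    -- most `Q′` = Q - 2 of them since -1 is itself a root.
    other-norms : List F
    other-norms = List.filter (λ y → ¬? (y ≟ - 1#)) (^-solutions (suc Q′) 1#)

    [-1]^[Q-1] : (- 1#) ^ suc Q′ ≡ 1#
    [-1]^[Q-1] = *-cancelˡ -1≢0 (trans (trans (cong ((- 1#) ^_) (sym Q≡)) (trans (sym (φ-def t _)) (trans (φ-neg t 1#) (cong -_ (φ-1 t))))) (sym (*-identityʳ _)))

    length-other-norms : List.length other-norms ℕ.≤ Q′
    length-other-norms = ℕ.≤-pred (^-solutions-bound Q′ 1# (- 1# ∷ other-norms)
      (All.map (λ ne e → ne (sym e)) (all-filter (λ y → ¬? (y ≟ - 1#)) (^-solutions (suc Q′) 1#)) ∷ filter⁺ _ (filter⁺ _ elements-unique))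
      ([-1]^[Q-1] ∷ All.filter⁺ _ (all-filter _ elements)))

    ∉-concatMap : ∀ {A : Set} (g : A → List F) {x y xs} → y ∉ List.concatMap g xs → x ∈ xs → y ∉ g x
    ∉-concatMap g {xs = xs} y∉ x∈xs y∈gx = y∉ (∈-concatMap⁺ g (Any.map (λ { refl → y∈gx }) x∈xs))

  -- The norm x ↦ x^{Q+1} maps the Q² - 1 nonzero elements to the at most Q - 1 roots of y^{Q-1} = 1, each having
  -- at most Q + 1 preimages; hence each of these roots, in particular -1, has exactly Q + 1 preimages.
  admissible-avoiding : ∀ xs → List.length xs ℕ.< Q ℕ.+ 1 → ∃[ k ] (Admissible K q t k × k ∉ xs)
  admissible-avoiding xs len = k , norm-k , λ k∈xs → k∉ (Any.there (∈-++⁺ʳ _ k∈xs))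
    where
    bad : List F
    -- An element outside this list is nonzero, has no norm other than -1 and avoids `xs`. The list
    -- has fewer than 1 + (Q - 2)(Q + 1) + (Q + 1) = Q² = N entries.
    bad = 0# ∷ (List.concatMap (^-solutions (Q ℕ.+ 1)) other-norms List.++ xs)
    bad-length : List.length bad ℕ.< N
    bad-length = begin-strict
      suc (List.length (List.concatMap (^-solutions (Q ℕ.+ 1)) other-norms List.++ xs)) ≡⟨ cong suc (List.length-++ (List.concatMap (^-solutions (Q ℕ.+ 1)) other-norms)) ⟩
      suc (List.length (List.concatMap (^-solutions (Q ℕ.+ 1)) other-norms) ℕ.+ List.length xs)
        <⟨ ℕ.s≤s (ℕ.+-mono-≤-< (ℕ.≤-trans (length-concatMap _ (Q ℕ.+ 1) other-norms (λ y → length-^-solutions (Q ℕ.+ 1) y 0<Q+1))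
             (ℕ.*-monoˡ-≤ (Q ℕ.+ 1) length-other-norms)) len) ⟩
      suc (Q′ ℕ.* (Q ℕ.+ 1) ℕ.+ (Q ℕ.+ 1)) ≡⟨ cong (λ z → suc (Q′ ℕ.* (z ℕ.+ 1) ℕ.+ (z ℕ.+ 1))) Q≡ ⟩
      suc (Q′ ℕ.* (suc (suc Q′) ℕ.+ 1) ℕ.+ (suc (suc Q′) ℕ.+ 1))
        ≡⟨ ℕS.solve 1 (λ x → ℕS.con 1 ℕS.:+ (x ℕS.:* ((ℕS.con 2 ℕS.:+ x) ℕS.:+ ℕS.con 1) ℕS.:+ ((ℕS.con 2 ℕS.:+ x) ℕS.:+ ℕS.con 1))
             ℕS.:= (ℕS.con 2 ℕS.:+ x) ℕS.:* (ℕS.con 2 ℕS.:+ x)) refl Q′ ⟩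
      suc (suc Q′) ℕ.* suc (suc Q′) ≡⟨ cong (λ z → z ℕ.* z) (sym Q≡) ⟩
      Q ℕ.* Q ≡⟨ Q²≡N ⟩
      N ∎
      where
      open ℕ.≤-Reasoning
      0<Q+1 : 0 ℕ.< Q ℕ.+ 1
      0<Q+1 = ℕ.≤-trans (ℕ.<⇒≤ 1<Q) (ℕ.m≤m+n Q 1)
    found = exists-∉ bad bad-length
    k : F
    k = proj₁ found
    k∉ : k ∉ bad
    k∉ = proj₂ found
    k≢0 : k ≢ 0#
    k≢0 e = k∉ (Any.here e)
    y : F
    y = k ^ (Q ℕ.+ 1)
    y^[Q-1]≡1 : y ^ suc Q′ ≡ 1#
    y^[Q-1]≡1 = *-cancelˡ k≢0 (begin
      k * y ^ suc Q′ ≡⟨ cong (k *_) (sym (^-* k (Q ℕ.+ 1) (suc Q′))) ⟩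
      k ^ suc ((Q ℕ.+ 1) ℕ.* suc Q′) ≡⟨ cong (λ z → k ^ suc ((z ℕ.+ 1) ℕ.* suc Q′)) Q≡ ⟩
      k ^ suc ((suc (suc Q′) ℕ.+ 1) ℕ.* suc Q′)
        ≡⟨ cong (k ^_) (ℕS.solve 1 (λ x → ℕS.con 1 ℕS.:+ ((ℕS.con 2 ℕS.:+ x) ℕS.:+ ℕS.con 1) ℕS.:* (ℕS.con 1 ℕS.:+ x) ℕS.:= (ℕS.con 2 ℕS.:+ x) ℕS.:* (ℕS.con 2 ℕS.:+ x)) refl Q′) ⟩
      k ^ (suc (suc Q′) ℕ.* suc (suc Q′)) ≡⟨ cong (k ^_) (trans (cong (λ z → z ℕ.* z) (sym Q≡)) Q²≡N) ⟩
      k ^ N ≡⟨ trans (fermat k) (sym (*-identityʳ k)) ⟩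
      k * 1# ∎)
      where open ≡-Reasoning
    norm-k : y ≡ - 1#
    norm-k = decidable-stable (y ≟ - 1#) (λ ne → ∉-concatMap (^-solutions (Q ℕ.+ 1)) {xs = other-norms} (λ k∈ → k∉ (Any.there (∈-++⁺ˡ k∈)))
      (∈-filter⁺ _ (∈-^-solutions (suc Q′) y^[Q-1]≡1) ne) (∈-^-solutions (Q ℕ.+ 1) refl))

  private
    N≡p^[rn] : N ≡ p ℕ.^ (r ℕ.* n)
    N≡p^[rn] = trans N≡[p^r]^n (ℕ.^-*-assoc p r n)

    conjugates-of : ∀ h → Σ (List F) λ zs → List.length zs ℕ.≤ r ℕ.* n × (∀ σ → Automorphism.σ σ h ∈ zs)
    conjugates-of = conjugates {p} {r ℕ.* n} pp N≡p^[rn]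

    -- Covers every k for which the e-th powers of k and of some image of h under an automorphism
    -- agree. The bound r n e on its length is the denominator in the theorem.
    related : ℕ → F → List F
    related e h = List.concatMap (λ z → ^-solutions e (z ^ e)) (proj₁ (conjugates-of h))

    length-related : ∀ e → 0 ℕ.< e → ∀ h → List.length (related e h) ℕ.≤ (r ℕ.* n) ℕ.* e
    length-related e 0<e h = ℕ.≤-trans (length-concatMap (λ z → ^-solutions e (z ^ e)) e (proj₁ (conjugates-of h)) (λ z → length-^-solutions e (z ^ e) 0<e))
      (ℕ.*-monoˡ-≤ e (proj₁ (proj₂ (conjugates-of h))))

    ∈-related : ∀ e {h k} (s : Automorphism) → k ^ e ≡ Automorphism.σ s h ^ e → k ∈ related e h
    ∈-related e {h} {k} s eq = decidable-stable′ (λ k∉ → ∉-concatMap (λ z → ^-solutions e (z ^ e)) k∉ (proj₂ (proj₂ (conjugates-of h)) s) (∈-^-solutions e eq))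
      where
      open import Data.List.Membership.DecPropositional _≟_ using (_∈?_)
      decidable-stable′ = decidable-stable (k ∈? related e h)

  -- The elements to avoid number at most l c, where c = r n e; this is less than Q + 1 because (l +
  -- 1) c is at most Q + 1 and c is positive.
  inequivalent-family : ∀ e → 0 ℕ.< e →
    (∀ {h k} → Admissible K q t h → Admissible K q t k → PΓL-equivalent (L K q t h) (L K q t k) →
      Σ Automorphism λ s → k ^ e ≡ Automorphism.σ s h ^ e) →
    ∀ l → l ℕ.* ((r ℕ.* n) ℕ.* e) ℕ.≤ q ℕ.^ t ℕ.+ 1 → 0 ℕ.< (r ℕ.* n) ℕ.* e → AtLeastInequivalent K q t l
  inequivalent-family e 0<e powers zero _ _ = (λ ()) , (λ ()) , (λ ())
  inequivalent-family e 0<e powers (suc l) bound 0<c = extended , admissible , inequivalent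
    where
    c : ℕ
    c = (r ℕ.* n) ℕ.* e
    smaller = inequivalent-family e 0<e powers l (ℕ.≤-trans (ℕ.m≤n+m _ c) bound) 0<c
    hs : Fin l → F
    hs = proj₁ smaller
    excluded : List F
    excluded = List.concatMap (related e) (List.tabulate hs)
    excluded-length : List.length excluded ℕ.< Q ℕ.+ 1
    excluded-length = ℕ.<-≤-trans (ℕ.≤-<-trans (subst (λ m → List.length excluded ℕ.≤ m ℕ.* c) (List.length-tabulate hs)
        (length-concatMap (related e) c (List.tabulate hs) (length-related e 0<e))) (ℕ.m<n+m (l ℕ.* c) 0<c)) bound
    new = admissible-avoiding excluded excluded-length
    k : F
    k = proj₁ new
    extended : Fin (suc l) → F
    extended Fin.zero = k
    extended (Fin.suc i) = hs i
    admissible : ∀ i → Admissible K q t (extended i)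
    admissible Fin.zero = proj₁ (proj₂ new)
    admissible (Fin.suc i) = proj₁ (proj₂ smaller) i
    k∉related : ∀ i → k ∉ related e (hs i)
    k∉related i = ∉-concatMap (related e) (proj₂ (proj₂ new)) (∈-tabulate⁺ i)
    inequivalent : ∀ i j → ¬ (i ≡ j) → ¬ PΓL-equivalent (L K q t (extended i)) (L K q t (extended j))
    inequivalent Fin.zero Fin.zero ne _ = ne refl
    inequivalent (Fin.suc i) (Fin.suc j) ne eq = proj₂ (proj₂ smaller) i j (λ i≡j → ne (cong Fin.suc i≡j)) eq
    inequivalent (Fin.suc i) Fin.zero _ eq = case powers (admissible (Fin.suc i)) (admissible Fin.zero) eq of λ
      (s , k^e≡) → k∉related i (∈-related e s k^e≡)
    -- Here the automorphism acts on the new element. Its inverse, applied to the relation between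
    -- e-th powers, places the new element among those related to `hs j`.
    inequivalent Fin.zero (Fin.suc j) _ eq = case powers (admissible Fin.zero) (admissible (Fin.suc j)) eq of λ
      (s , h^e≡) → k∉related j (∈-related e (AutomorphismProperties.inverse s) (applied s h^e≡))
      where
      applied : ∀ s → hs j ^ e ≡ Automorphism.σ s k ^ e → k ^ e ≡ Automorphism.σ⁻¹ s (hs j) ^ e
      applied s h^e≡ = sym (trans (sym (AutomorphismProperties.σ-^ (AutomorphismProperties.inverse s) (hs j) e))
        (trans (cong σ⁻¹ (trans h^e≡ (sym (AutomorphismProperties.σ-^ s k e)))) (σ-invˡ _)))
        where open Automorphism s

-- The two lower bounds

open import Data.Nat using (_*_; _+_; _^_; _%_; _>_)

theorem5p1 : (p r t : ℕ) → Prime p → p ≢ 2 → r > 0 → t > 4 →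
    (K : FiniteField (p ^ (r * (2 * t)))) →
    (t % 4 ≢ 2 → AtLeastInequivalent K (p ^ r) t (floorDiv ((p ^ r) ^ t + 1) (8 * r * t))) ×
    (t % 4 ≡ 2 → AtLeastInequivalent K (p ^ r) t
    (floorDiv ((p ^ r) ^ t + 1) (4 * r * t * ((p ^ r) ^ 2 + 1))))
theorem5p1 p r t@(suc (suc (suc (suc (suc t′))))) pp p≢2 r>0 (ℕ.s≤s (ℕ.s≤s (ℕ.s≤s (ℕ.s≤s (ℕ.s≤s ℕ.z≤n))))) K =
    (λ t≢2 → family 4 (ℕ.s≤s ℕ.z≤n) (8 * r * t) 8rt (λ {h} {k} adm-h adm-k eq → let s , a , b , e = ratio-of-PΓL-equivalent {h} {k} adm-h adm-k eq in s , same-fourth-power t≢2 a b e)) ,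
    (λ _ → family (2 * (q² + 1)) (ℕ.*-mono-≤ {1} {2} {1} {q² + 1} (ℕ.s≤s ℕ.z≤n) (ℕ.m≤n+m 1 q²)) (4 * r * t * (q² + 1)) 4rt[q²+1]
      (λ {h} {k} adm-h adm-k eq → let s , a , b , e = ratio-of-PΓL-equivalent {h} {k} adm-h adm-k eq in s , same-power a e))
  where
  q² = (p ^ r) ^ 2
  n = 10 + (t′ + t′)
  2<p : 2 ℕ.< p
  2<p = ℕ.≤∧≢⇒< (ℕ.nonTrivial⇒n>1 p {{prime⇒nonTrivial pp}}) (λ e → p≢2 (sym e))
  instance
    p-nonZero : ℕ.NonZero p
    p-nonZero = prime⇒nonZero pp
  3≤q : 3 ℕ.≤ p ^ r
  3≤q = ℕ.≤-trans 2<p (subst (ℕ._≤ p ^ r) (ℕ.^-identityʳ p) (ℕ.^-monoʳ-≤ p r>0))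
  2t≡n : 2 * t ≡ n
  2t≡n = ℕS.solve 1 (λ x → ℕS.con 2 ℕS.:* (ℕS.con 5 ℕS.:+ x) ℕS.:= ℕS.con 10 ℕS.:+ (x ℕS.:+ x)) refl t′
  N≡[p^r]^n : p ^ (r * (2 * t)) ≡ (p ^ r) ^ n
  N≡[p^r]^n = trans (cong (λ k → p ^ (r * k)) 2t≡n) (sym (ℕ.^-*-assoc p r n))
  -- Odd characteristic: 1 = -1 would mean 2 · 1 = 0, although 0 < 2 < p.
  1≢-1 : ¬ (FiniteField.1# K ≡ FiniteField.-_ K (FiniteField.1# K))
  1≢-1 e = ·1≢0 2 (ℕ.s≤s ℕ.z≤n) 2<p (trans (·-suc 1 (FiniteField.1# K)) (trans (cong (FiniteField._+_ K (FiniteField.1# K)) e) (-‿inverseʳ (FiniteField.1# K))))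
    where
    open FieldProperties K
    open Characteristic K {p} {r * (2 * t)} pp refl
  open Collineations K {p} {r} {t′} pp N≡[p^r]^n 3≤q 1≢-1 using (ratio-of-PΓL-equivalent; same-fourth-power; same-power)
  open Selection K {p} {r} {t′} pp N≡[p^r]^n 3≤q 1≢-1 using (inequivalent-family)

  8rt : r * n * 4 ≡ 8 * r * t
  8rt = ℕS.solve 2 (λ r x → r ℕS.:* (ℕS.con 10 ℕS.:+ (x ℕS.:+ x)) ℕS.:* ℕS.con 4 ℕS.:= ℕS.con 8 ℕS.:* r ℕS.:* (ℕS.con 5 ℕS.:+ x)) refl r t′
  4rt[q²+1] : r * n * (2 * (q² + 1)) ≡ 4 * r * t * (q² + 1)
  4rt[q²+1] = ℕS.solve 3 (λ r x s → r ℕS.:* (ℕS.con 10 ℕS.:+ (x ℕS.:+ x)) ℕS.:* (ℕS.con 2 ℕS.:* s) ℕS.:= ℕS.con 4 ℕS.:* r ℕS.:* (ℕS.con 5 ℕS.:+ x) ℕS.:* s) refl r t′ (q² + 1)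

  floorDiv-*≤ : ∀ a b → floorDiv a b * b ℕ.≤ a
  floorDiv-*≤ a zero = ℕ.z≤n
  floorDiv-*≤ a (suc b) = m/n*n≤m a (suc b)

  family : ∀ e → 0 ℕ.< e → ∀ c → r * n * e ≡ c →
    (∀ {h k} → Admissible K (p ^ r) t h → Admissible K (p ^ r) t k → FiniteField.PΓL-equivalent K (L K (p ^ r) t h) (L K (p ^ r) t k) →
      Σ (FiniteField.Automorphism K) λ s → FiniteField._^_ K k e ≡ FiniteField._^_ K (FiniteField.Automorphism.σ s h) e) →
    AtLeastInequivalent K (p ^ r) t (floorDiv ((p ^ r) ^ t + 1) c)
  family e 0<e c refl powers = inequivalent-family e 0<e powers _ (floorDiv-*≤ ((p ^ r) ^ t + 1) (r * n * e))
    (ℕ.*-mono-≤ {1} {r * n} {1} {e} (ℕ.*-mono-≤ {1} {r} {1} {n} r>0 (ℕ.s≤s ℕ.z≤n)) 0<e)
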